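{- Let $p>3$ be a prime with $\big(\frac p{23}\big)=1$. Then $$\sum_{k=0}^{[p/3]}\binom{3k}k\equiv\begin{cases}1\pmod p&\text{if }p=x^2+xy+52y^2\text{ or }p=8x^2+7xy+8y^2,\\ (39x-10y)/(23y)\pmod p&\text{if }p=13x^2+xy+4y^2\neq13,\\ -(87x+19y)/(23y)\pmod p&\text{if }p=29x^2+5xy+2y^2\neq 29,\end{cases}$$ where in each case $x,y\in\mathbb Z$.
   Context: $[x]$ denotes the greatest integer not exceeding $x$; $\big(\frac{\cdot}{\cdot}\big)$ is the Legendre symbol. Quotients of integers prime to $p$ are interpreted modulo $p$. -}

module Defs where

open import Data.Nat as ℕ using (ℕ; zero; suc; _%_)
open import Data.Nat.Combinatorics using (_C_)
open import Data.Nat.Primality using (Prime)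
open import Data.Integer as ℤ using (ℤ; +_; _-_)
open import Data.Integer.Divisibility as ℤD using ()
open import Data.Product using (∃; _×_)
open import Relation.Binary.PropositionalEquality using (_≡_; _≢_)

infix 4 _≡_[mod_]
_≡_[mod_] : ℤ → ℤ → ℤ → Set
a ≡ b [mod m ] = m ℤD.∣ (a - b)

Legendre23IsOne : ℕ → Set
Legendre23IsOne a = (a % 23 ≢ 0) × ∃ λ t → (t ℕ.* t) % 23 ≡ a % 23

sumBinom3 : ℕ → ℕ
sumBinom3 zero = 1
sumBinom3 (suc n) = sumBinom3 n ℕ.+ ((3 ℕ.* suc n) C suc n)

floor3 : ℕ → ℕ
floor3 p = p ℕ./ 3

qf : ℤ → ℤ → ℤ → ℤ → ℤ → ℤ
qf a b c x y = a ℤ.* x ℤ.* x ℤ.+ b ℤ.* x ℤ.* y ℤ.+ c ℤ.* y ℤ.* y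

{-# OPTIONS --safe #-}
module Submission where

-- Put n = ⌊p/3⌋. Then C(3k,k) ≡ C(n+k,2k)(−27)ᵏ (mod p), so the sum is the Morgan-Voyce polynomial bₙ at −27,
-- that is (ρⁿ⁺¹ + ρ⁻ⁿ)/(ρ + 1) with ρ + ρ⁻¹ = −25. If p is represented by one of the forms, with leading
-- coefficient e, then λ = a − 9yω for a suitable a has norm ep + 9y² and ρ = λ/λ̄ modulo p, so the sum is
-- determined by the cubic residue symbol of λ modulo p. By cubic reciprocity this is the symbol of p modulo λ, and
-- ep ≡ −(3y)² (mod λ) reduces it to the symbols of 3y, which is trivial, and of e, which is again the symbol of λ
-- modulo e and is found by computation.
--
-- Reciprocity between a rational prime q and a primary λ: λ is up to sign a product of Jacobi sums J, where
-- g³ = ℓJ for a Gauss sum g in the group ring of ℤ/ℓ over ℤ[ω] (up to the trivial character), and g^q is given by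
-- the Frobenius map modulo q.

open import Defs
open import Algebra.Bundles using (CommutativeRing)
open import Data.Empty using (⊥)
open import Data.Fin using (Fin; toℕ; fromℕ; inject₁; fromℕ<) renaming (zero to fz; suc to fs)
open import Data.Fin.Patterns
import Data.Fin.Properties as Finₚ
open import Data.Integer as ℤ using (ℤ; +_; -[1+_])
import Data.Integer.DivMod as ℤ/
open import Data.Integer.Divisibility.Signed as ℤ∣ using (_∣_; divides; _∣?_)
import Data.Integer.Properties as ℤₚ
open import Data.Integer.Tactic.RingSolver using (solve-∀)
open import Data.List using ([]; _∷_)
open import Data.List.Relation.Unary.All using (All; []; _∷_)
open import Data.Maybe using (just; nothing)
open import Data.Nat as ℕ using (ℕ; zero; suc; _>_)
open import Data.Nat.Combinatorics using (_C_; nCn≡1; nCk+nC[k+1]≡[n+1]C[k+1]; k>n⇒nCk≡0; nCk≡nC[n∸k])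
import Data.Nat.DivMod as ℕ/
import Data.Nat.Divisibility as ℕ∣
open import Data.Nat.Induction using (<-wellFounded)
open import Data.Nat.ListAction using (product)
open import Data.Nat.Primality using (Prime; euclidsLemma; prime⇒nonZero; prime⇒nonTrivial; ¬prime[1]; prime⇒irreducible; prime?; prime[2]; productOfPrimes≢0)
open import Data.Nat.Primality.Factorisation using (PrimeFactorisation; factorise)
import Data.Nat.Properties as ℕₚ
open import Data.Nat.Tactic.RingSolver using () renaming (solve-∀ to ℕ-solve-∀)
open import Data.Product using (∃; _×_; _,_; proj₁; proj₂)
open import Data.Sum using (inj₁; inj₂; _⊎_; [_,_]′)
open import Induction.WellFounded using (Acc; acc)
open import Level using (0ℓ)
import Relation.Binary.PropositionalEquality as ≡
open import Relation.Binary.PropositionalEquality using (_≡_; refl; sym; trans; cong; cong₂; subst; _≢_; subst₂)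
open import Relation.Nullary using (contradiction; ¬_; yes; no; Dec)
open import Relation.Nullary.Decidable using (from-yes; from-no; _→-dec_; _⊎-dec_)
open import Tactic.RingSolver using () renaming (solve-∀ to ring-∀)
open import Tactic.RingSolver.Core.AlmostCommutativeRing using (AlmostCommutativeRing; fromCommutativeRing)

-- The constants come from completing two squares. The four forms have discriminant -207 = -9·23, so
-- 4ep = (2ex + By)² + 207y² with B the middle coefficient, while 4N(λ) = (2a + 9y)² + 243y². Hence
-- a = ex - (9 - B)y/2 gives N(λ) = ep + 9y². Modulo p the norm is then (9y)²/9, so (λ - λ̄)²/N(λ) ≡
-- -3·9 = -27 = ρ + ρ⁻¹ - 2, the argument of bₙ.
--
-- The outcome is S tr(λ) ≡ tr(uλ) (mod p), with u the symbol of λ. Modulo p the square of tr(λ) is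
-- -207y², so p ≠ 23 allows division by tr(λ); the stated fractions are what results for u = ω² and
-- u = ω.
--
-- Two obstacles shape the rest. The group ring of ℤ/ℓ, unlike a cyclotomic ring, retains the
-- trivial character, so ℓ is replaced by an element `V` that acts as ℓ on elements of sum zero. And
-- 3y may be divisible by 3, where reciprocity says nothing; this costs an auxiliary primary element
-- σ.

Ring : Set₁
Ring = CommutativeRing 0ℓ 0ℓ

-- Quotients of a commutative ring by a principal ideal

module Quotient (R : Ring) (q : CommutativeRing.Carrier R) where
  open CommutativeRing R
  open import Relation.Binary.Reasoning.Setoid setoid
  open import Algebra.Properties.Ring ring using (-‿distribˡ-*; -‿+-comm)
  open import Algebra.Properties.CommutativeSemigroup +-commutativeSemigroup using (interchange)

  -- The carrier is kept and only equality is weakened, with an explicit quotient as witness. The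
  -- modulus 0 is allowed and gives back the equality of R; exact identities between Jacobi sums are
  -- obtained in this way.
  record _≈q_ (x y : Carrier) : Set where
    constructor mod
    field
      quot  : Carrier
      equal : x ≈ y + quot * q

  lift : ∀ {x y} → x ≈ y → x ≈q y
  lift {x} {y} e = mod 0# (begin
    x           ≈⟨ e ⟩
    y           ≈⟨ +-identityʳ y ⟨
    y + 0#      ≈⟨ +-congˡ (zeroˡ q) ⟨
    y + 0# * q  ∎)

  q-sym : ∀ {x y} → x ≈q y → y ≈q x
  q-sym {x} {y} (mod k e) = mod (- k) (begin
    y                    ≈⟨ +-identityʳ y ⟨
    y + 0#               ≈⟨ +-congˡ (-‿inverseʳ (k * q)) ⟨
    y + (k * q - k * q)  ≈⟨ +-assoc y (k * q) (- (k * q)) ⟨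
    (y + k * q) - k * q  ≈⟨ +-cong (sym₁ e) (-‿distribˡ-* k q) ⟩
    x + (- k) * q        ∎)
    where sym₁ = CommutativeRing.sym R

  q-trans : ∀ {x y z} → x ≈q y → y ≈q z → x ≈q z
  q-trans {x} {y} {z} (mod k e) (mod l f) = mod (l + k) (begin
    x                    ≈⟨ e ⟩
    y + k * q            ≈⟨ +-congʳ f ⟩
    (z + l * q) + k * q  ≈⟨ +-assoc z (l * q) (k * q) ⟩
    z + (l * q + k * q)  ≈⟨ +-congˡ (distribʳ q l k) ⟨
    z + (l + k) * q      ∎)

  q-+-cong : ∀ {x y u v} → x ≈q y → u ≈q v → (x + u) ≈q (y + v)
  q-+-cong {x} {y} {u} {v} (mod k e) (mod l f) = mod (k + l) (begin
    x + u                      ≈⟨ +-cong e f ⟩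
    (y + k * q) + (v + l * q)  ≈⟨ interchange y (k * q) v (l * q) ⟩
    (y + v) + (k * q + l * q)  ≈⟨ +-congˡ (distribʳ q k l) ⟨
    (y + v) + (k + l) * q      ∎)

  q-neg-cong : ∀ {x y} → x ≈q y → (- x) ≈q (- y)
  q-neg-cong {x} {y} (mod k e) = mod (- k) (begin
    - x              ≈⟨ -‿cong e ⟩
    - (y + k * q)    ≈⟨ -‿+-comm y (k * q) ⟨
    - y - k * q      ≈⟨ +-congˡ (-‿distribˡ-* k q) ⟩
    - y + - k * q    ∎)

  q-*-congˡ : ∀ x {u v} → u ≈q v → (x * u) ≈q (x * v)
  q-*-congˡ x {u} {v} (mod k e) = mod (x * k) (begin
    x * u                ≈⟨ *-congˡ e ⟩
    x * (v + k * q)      ≈⟨ distribˡ x v (k * q) ⟩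
    x * v + x * (k * q)  ≈⟨ +-congˡ (*-assoc x k q) ⟨
    x * v + x * k * q    ∎)

  q-*-cong : ∀ {x y u v} → x ≈q y → u ≈q v → (x * u) ≈q (y * v)
  q-*-cong {x} {y} {u} {v} e f =
    q-trans (q-*-congˡ x f) (q-trans (lift (*-comm x v)) (q-trans (q-*-congˡ v e) (lift (*-comm v y))))

  quotientRing : Ring
  quotientRing = record
    { Carrier = Carrier ; _≈_ = _≈q_ ; _+_ = _+_ ; _*_ = _*_ ; -_ = -_ ; 0# = 0# ; 1# = 1#
    ; isCommutativeRing = record
      { isRing = record
        { +-isAbelianGroup = record
          { isGroup = record
            { isMonoid = record
              { isSemigroup = record
                { isMagma = record
                  { isEquivalence = record
                    { refl = lift (CommutativeRing.refl R) ; sym = q-sym ; trans = q-trans }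
                  ; ∙-cong = q-+-cong }
                ; assoc = λ x y z → lift (+-assoc x y z) }
              ; identity = (λ x → lift (+-identityˡ x)) , (λ x → lift (+-identityʳ x)) }
            ; inverse = (λ x → lift (-‿inverseˡ x)) , (λ x → lift (-‿inverseʳ x))
            ; ⁻¹-cong = q-neg-cong }
          ; comm = λ x y → lift (+-comm x y) }
        ; *-cong = q-*-cong
        ; *-assoc = λ x y z → lift (*-assoc x y z)
        ; *-identity = (λ x → lift (*-identityˡ x)) , (λ x → lift (*-identityʳ x))
        ; distrib = (λ x y z → lift (distribˡ x y z)) , (λ x y z → lift (distribʳ x y z)) }
      ; *-comm = λ x y → lift (*-comm x y) } }

-- The Eisenstein integers

record 𝔼 : Set where
  constructor ⟨_,_⟩
  field
    re im : ℤ
open 𝔼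

infixl 6 _+ᴱ_
infixl 7 _*ᴱ_
infix  8 -ᴱ_

int : ℤ → 𝔼
int a = ⟨ a , + 0 ⟩

0ᴱ 1ᴱ : 𝔼
0ᴱ = int (+ 0)
1ᴱ = int (+ 1)

norm : 𝔼 → ℤ
norm x = re x ℤ.* re x ℤ.- re x ℤ.* im x ℤ.+ im x ℤ.* im x

-- ⟨ a , b ⟩ stands for a + bω, where ω² = −1 − ω.
opaque
  _+ᴱ_ _*ᴱ_ : 𝔼 → 𝔼 → 𝔼
  x +ᴱ y = ⟨ re x ℤ.+ re y , im x ℤ.+ im y ⟩
  x *ᴱ y = ⟨ re x ℤ.* re y ℤ.- im x ℤ.* im y , re x ℤ.* im y ℤ.+ im x ℤ.* re y ℤ.- im x ℤ.* im y ⟩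

  -ᴱ_ conj : 𝔼 → 𝔼
  -ᴱ x = ⟨ ℤ.- re x , ℤ.- im x ⟩
  conj x = ⟨ re x ℤ.- im x , ℤ.- im x ⟩

  +ᴱ-assoc : ∀ x y z → (x +ᴱ y) +ᴱ z ≡ x +ᴱ (y +ᴱ z)
  +ᴱ-assoc x y z = cong₂ ⟨_,_⟩ (ℤₚ.+-assoc (re x) (re y) (re z)) (ℤₚ.+-assoc (im x) (im y) (im z))

  +ᴱ-comm : ∀ x y → x +ᴱ y ≡ y +ᴱ x
  +ᴱ-comm x y = cong₂ ⟨_,_⟩ (ℤₚ.+-comm (re x) (re y)) (ℤₚ.+-comm (im x) (im y))

  +ᴱ-identityˡ : ∀ x → 0ᴱ +ᴱ x ≡ x
  +ᴱ-identityˡ x = cong₂ ⟨_,_⟩ (ℤₚ.+-identityˡ (re x)) (ℤₚ.+-identityˡ (im x))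

  -ᴱ-inverseˡ : ∀ x → (-ᴱ x) +ᴱ x ≡ 0ᴱ
  -ᴱ-inverseˡ x = cong₂ ⟨_,_⟩ (ℤₚ.+-inverseˡ (re x)) (ℤₚ.+-inverseˡ (im x))

  *ᴱ-comm : ∀ x y → x *ᴱ y ≡ y *ᴱ x
  *ᴱ-comm ⟨ a , b ⟩ ⟨ c , d ⟩ = cong₂ ⟨_,_⟩ (f a b c d) (g a b c d)
    where
    f : ∀ a b c d → a ℤ.* c ℤ.- b ℤ.* d ≡ c ℤ.* a ℤ.- d ℤ.* b
    f = solve-∀
    g : ∀ a b c d → a ℤ.* d ℤ.+ b ℤ.* c ℤ.- b ℤ.* d ≡ c ℤ.* b ℤ.+ d ℤ.* a ℤ.- d ℤ.* b
    g = solve-∀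

  *ᴱ-assoc : ∀ x y z → (x *ᴱ y) *ᴱ z ≡ x *ᴱ (y *ᴱ z)
  *ᴱ-assoc ⟨ a , b ⟩ ⟨ c , d ⟩ ⟨ e , h ⟩ = cong₂ ⟨_,_⟩ (f a b c d e h) (g a b c d e h)
    where
    f : ∀ a b c d e f → (a ℤ.* c ℤ.- b ℤ.* d) ℤ.* e ℤ.- (a ℤ.* d ℤ.+ b ℤ.* c ℤ.- b ℤ.* d) ℤ.* f
      ≡ a ℤ.* (c ℤ.* e ℤ.- d ℤ.* f) ℤ.- b ℤ.* (c ℤ.* f ℤ.+ d ℤ.* e ℤ.- d ℤ.* f)
    f = solve-∀
    g : ∀ a b c d e f → (a ℤ.* c ℤ.- b ℤ.* d) ℤ.* f ℤ.+ (a ℤ.* d ℤ.+ b ℤ.* c ℤ.- b ℤ.* d) ℤ.* e ℤ.- (a ℤ.* d ℤ.+ b ℤ.* c ℤ.- b ℤ.* d) ℤ.* f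
      ≡ a ℤ.* (c ℤ.* f ℤ.+ d ℤ.* e ℤ.- d ℤ.* f) ℤ.+ b ℤ.* (c ℤ.* e ℤ.- d ℤ.* f) ℤ.- b ℤ.* (c ℤ.* f ℤ.+ d ℤ.* e ℤ.- d ℤ.* f)
    g = solve-∀

  *ᴱ-identityˡ : ∀ x → 1ᴱ *ᴱ x ≡ x
  *ᴱ-identityˡ ⟨ a , b ⟩ = cong₂ ⟨_,_⟩ (f a b) (g a b)
    where
    f : ∀ a b → + 1 ℤ.* a ℤ.- + 0 ℤ.* b ≡ a
    f = solve-∀
    g : ∀ a b → + 1 ℤ.* b ℤ.+ + 0 ℤ.* a ℤ.- + 0 ℤ.* b ≡ b
    g = solve-∀

  *ᴱ-distribˡ : ∀ x y z → x *ᴱ (y +ᴱ z) ≡ (x *ᴱ y) +ᴱ (x *ᴱ z)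
  *ᴱ-distribˡ ⟨ a , b ⟩ ⟨ c , d ⟩ ⟨ e , h ⟩ = cong₂ ⟨_,_⟩ (f a b c d e h) (g a b c d e h)
    where
    f : ∀ a b c d e f → a ℤ.* (c ℤ.+ e) ℤ.- b ℤ.* (d ℤ.+ f) ≡ (a ℤ.* c ℤ.- b ℤ.* d) ℤ.+ (a ℤ.* e ℤ.- b ℤ.* f)
    f = solve-∀
    g : ∀ a b c d e f → a ℤ.* (d ℤ.+ f) ℤ.+ b ℤ.* (c ℤ.+ e) ℤ.- b ℤ.* (d ℤ.+ f)
      ≡ (a ℤ.* d ℤ.+ b ℤ.* c ℤ.- b ℤ.* d) ℤ.+ (a ℤ.* f ℤ.+ b ℤ.* e ℤ.- b ℤ.* f)
    g = solve-∀

𝔼-ring : Ring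
𝔼-ring = record
  { Carrier = 𝔼 ; _≈_ = _≡_ ; _+_ = _+ᴱ_ ; _*_ = _*ᴱ_ ; -_ = -ᴱ_ ; 0# = 0ᴱ ; 1# = 1ᴱ
  ; isCommutativeRing = record
    { isRing = record
      { +-isAbelianGroup = record
        { isGroup = record
          { isMonoid = record
            { isSemigroup = record
              { isMagma = record { isEquivalence = ≡.isEquivalence ; ∙-cong = cong₂ _+ᴱ_ }
              ; assoc = +ᴱ-assoc }
            ; identity = +ᴱ-identityˡ , λ x → trans (+ᴱ-comm x 0ᴱ) (+ᴱ-identityˡ x) }
          ; inverse = -ᴱ-inverseˡ , λ x → trans (+ᴱ-comm x (-ᴱ x)) (-ᴱ-inverseˡ x)
          ; ⁻¹-cong = cong -ᴱ_ }
        ; comm = +ᴱ-comm }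
      ; *-cong = cong₂ _*ᴱ_
      ; *-assoc = *ᴱ-assoc
      ; *-identity = *ᴱ-identityˡ , λ x → trans (*ᴱ-comm x 1ᴱ) (*ᴱ-identityˡ x)
      ; distrib = *ᴱ-distribˡ , λ x y z → trans (*ᴱ-comm (y +ᴱ z) x)
          (trans (*ᴱ-distribˡ x y z) (cong₂ _+ᴱ_ (*ᴱ-comm x y) (*ᴱ-comm x z))) }
    ; *-comm = *ᴱ-comm } }

E/ : ℤ → Ring
E/ q = Quotient.quotientRing 𝔼-ring (int q)
Z/ : ℤ → Ring
Z/ q = Quotient.quotientRing ℤₚ.+-*-commutativeRing q

-- Binomial coefficients, finite sums and the Frobenius map

absorption : ∀ n k → suc k ℕ.* (suc n C suc k) ≡ suc n ℕ.* (n C k)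
absorption zero zero = refl
absorption zero (suc k) = trans (cong (suc (suc k) ℕ.*_) (k>n⇒nCk≡0 {1} {suc (suc k)} (ℕ.s≤s (ℕ.s≤s ℕ.z≤n))))
  (trans (ℕₚ.*-zeroʳ (suc (suc k))) (sym (cong (1 ℕ.*_) (k>n⇒nCk≡0 {0} {suc k} (ℕ.s≤s ℕ.z≤n)))))
absorption (suc n) zero = begin
  1 ℕ.* (suc (suc n) C 1)          ≡⟨ cong (1 ℕ.*_) (nCk+nC[k+1]≡[n+1]C[k+1] (suc n) 0) ⟨
  1 ℕ.* (1 ℕ.+ (suc n C 1))        ≡⟨ cong (λ z → 1 ℕ.+ z ℕ.+ 0) (ℕₚ.*-identityˡ (suc n C 1)) ⟨
  1 ℕ.* (1 ℕ.+ 1 ℕ.* (suc n C 1))  ≡⟨ cong (λ z → 1 ℕ.* (1 ℕ.+ z)) (absorption n zero) ⟩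
  1 ℕ.* (1 ℕ.+ suc n ℕ.* 1)        ≡⟨ ℕₚ.*-identityˡ _ ⟩
  1 ℕ.+ suc n ℕ.* 1                ∎
  where open ≡.≡-Reasoning
absorption (suc n) (suc k) = begin
  suc (suc k) ℕ.* (suc (suc n) C suc (suc k))
    ≡⟨ cong (suc (suc k) ℕ.*_) (nCk+nC[k+1]≡[n+1]C[k+1] (suc n) (suc k)) ⟨
  suc (suc k) ℕ.* (x ℕ.+ y)
    ≡⟨ split k x y ⟩
  suc k ℕ.* x ℕ.+ x ℕ.+ suc (suc k) ℕ.* y
    ≡⟨ cong₂ (λ u v → u ℕ.+ x ℕ.+ v) (absorption n k) (absorption n (suc k)) ⟩
  suc n ℕ.* u ℕ.+ x ℕ.+ suc n ℕ.* v
    ≡⟨ join n x u v ⟩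
  suc n ℕ.* (u ℕ.+ v) ℕ.+ x
    ≡⟨ cong (λ z → suc n ℕ.* z ℕ.+ x) (nCk+nC[k+1]≡[n+1]C[k+1] n k) ⟩
  suc n ℕ.* x ℕ.+ x
    ≡⟨ ℕₚ.+-comm (suc n ℕ.* x) x ⟩
  suc (suc n) ℕ.* x ∎
  where
  open ≡.≡-Reasoning
  x = suc n C suc k
  y = suc n C suc (suc k)
  u = n C k
  v = n C suc k
  split : ∀ k x y → suc (suc k) ℕ.* (x ℕ.+ y) ≡ suc k ℕ.* x ℕ.+ x ℕ.+ suc (suc k) ℕ.* y
  split = ℕ-solve-∀
  join : ∀ n x u v → suc n ℕ.* u ℕ.+ x ℕ.+ suc n ℕ.* v ≡ suc n ℕ.* (u ℕ.+ v) ℕ.+ x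
  join = ℕ-solve-∀

prime∣binomial : ∀ {n k} → Prime (suc n) → k ℕ.< n → suc n ℕ∣.∣ (suc n C suc k)
prime∣binomial {n} {k} pr k<n with euclidsLemma (suc k) (suc n C suc k) pr
                                     (ℕ∣.divides (n C k) (trans (absorption n k) (ℕₚ.*-comm (suc n) (n C k))))
... | inj₁ d = contradiction (ℕ∣.∣⇒≤ d) (ℕₚ.<⇒≱ (ℕ.s≤s k<n))
... | inj₂ d = d

-- Depends on the bare operation only, so a power in a ring and the same power in any of its
-- quotients are one term and need no conversion.
pow : {A : Set} → (A → A → A) → A → A → ℕ → A
pow _∙_ ε x zero    = ε
pow _∙_ ε x (suc n) = x ∙ pow _∙_ ε x n

fold< : {A : Set} → (A → A → A) → A → (ℕ → A) → ℕ → A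
fold< _∙_ ε f zero    = ε
fold< _∙_ ε f (suc n) = fold< _∙_ ε f n ∙ f n

module RingTheory (K : Ring) where
  open CommutativeRing K renaming (refl to ≈refl; sym to ≈sym; trans to ≈trans) public
  open import Relation.Binary.Reasoning.Setoid setoid public
  open import Algebra.Properties.CommutativeSemigroup +-commutativeSemigroup public using ()
    renaming (interchange to +-interchange)
  open import Algebra.Properties.CommutativeSemigroup *-commutativeSemigroup public using ()
    renaming (interchange to *-interchange; x∙yz≈y∙xz to *-exchangeˡ)
  open import Algebra.Properties.Semiring.Mult semiring public using (×-assocˡ; ×-homo-1; ×-congˡ) renaming (_×_ to _·_)
  open import Algebra.Properties.Group +-group public using () renaming (∙-cancelʳ to +-cancelʳ; ∙-cancelˡ to +-cancelˡ)

  infixr 8 _^_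
  _^_ : Carrier → ℕ → Carrier
  x ^ n = pow _*_ 1# x n

  ^-cong : ∀ n {x y} → x ≈ y → x ^ n ≈ y ^ n
  ^-cong zero    e = ≈refl
  ^-cong (suc n) e = *-cong e (^-cong n e)

  ^-+ : ∀ x m n → x ^ (m ℕ.+ n) ≈ x ^ m * x ^ n
  ^-+ x zero    n = ≈sym (*-identityˡ _)
  ^-+ x (suc m) n = ≈trans (*-congˡ (^-+ x m n)) (≈sym (*-assoc _ _ _))

  ^-distrib-* : ∀ x y n → (x * y) ^ n ≈ x ^ n * y ^ n
  ^-distrib-* x y zero    = ≈sym (*-identityˡ 1#)
  ^-distrib-* x y (suc n) = ≈trans (*-congˡ (^-distrib-* x y n)) (*-interchange x y (x ^ n) (y ^ n))

  1^ : ∀ n → 1# ^ n ≈ 1#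
  1^ zero    = ≈refl
  1^ (suc n) = ≈trans (*-identityˡ _) (1^ n)

  ^-^ : ∀ x m n → (x ^ m) ^ n ≈ x ^ (m ℕ.* n)
  ^-^ x zero    n = 1^ n
  ^-^ x (suc m) n = ≈trans (^-distrib-* x (x ^ m) n) (≈trans (*-congˡ (^-^ x m n)) (≈sym (^-+ x n (m ℕ.* n))))

  Σ< : (ℕ → Carrier) → ℕ → Carrier
  Σ< = fold< _+_ 0#

  Σ-cong< : ∀ n {f g : ℕ → Carrier} → (∀ i → i ℕ.< n → f i ≈ g i) → Σ< f n ≈ Σ< g n
  Σ-cong< zero    e = ≈refl
  Σ-cong< (suc n) e = +-cong (Σ-cong< n (λ i p → e i (ℕₚ.m<n⇒m<1+n p))) (e n ℕₚ.≤-refl)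

  Σ-cong : ∀ n {f g : ℕ → Carrier} → (∀ i → f i ≈ g i) → Σ< f n ≈ Σ< g n
  Σ-cong n e = Σ-cong< n (λ i _ → e i)

  Σ-head : ∀ n f → Σ< f (suc n) ≈ f 0 + Σ< (λ i → f (suc i)) n
  Σ-head zero    f = +-comm _ _
  Σ-head (suc n) f = ≈trans (+-congʳ (Σ-head n f)) (+-assoc _ _ _)

  Σ-+ : ∀ n f g → Σ< (λ i → f i + g i) n ≈ Σ< f n + Σ< g n
  Σ-+ zero    f g = ≈sym (+-identityˡ 0#)
  Σ-+ (suc n) f g = ≈trans (+-congʳ (Σ-+ n f g)) (+-interchange _ _ _ _)

  Σ-*ˡ : ∀ n c f → Σ< (λ i → c * f i) n ≈ c * Σ< f n
  Σ-*ˡ zero    c f = ≈sym (zeroʳ c)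
  Σ-*ˡ (suc n) c f = ≈trans (+-congʳ (Σ-*ˡ n c f)) (≈sym (distribˡ c _ _))

  Σ-0 : ∀ n {f : ℕ → Carrier} → (∀ i → i ℕ.< n → f i ≈ 0#) → Σ< f n ≈ 0#
  Σ-0 zero    e = ≈refl
  Σ-0 (suc n) e = ≈trans (+-cong (Σ-0 n (λ i p → e i (ℕₚ.m<n⇒m<1+n p))) (e n ℕₚ.≤-refl)) (+-identityˡ 0#)

  Σ-swap : ∀ m n (f : ℕ → ℕ → Carrier) → Σ< (λ i → Σ< (f i) n) m ≈ Σ< (λ j → Σ< (λ i → f i j) m) n
  Σ-swap zero    n f = ≈sym (Σ-0 n (λ _ _ → ≈refl))
  Σ-swap (suc m) n f = ≈trans (+-congʳ (Σ-swap m n f)) (≈sym (Σ-+ n _ _))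

  Σ-const : ∀ n c → Σ< (λ _ → c) n ≈ n · c
  Σ-const zero    c = ≈refl
  Σ-const (suc n) c = ≈trans (+-comm _ _) (+-congˡ (Σ-const n c))

  module Frobenius {q : ℕ} (pr : Prime q) (char : ∀ x → q · x ≈ 0#) where
    open import Algebra.Properties.Semiring.Exp semiring using () renaming (_^_ to _^ₛ_)
    open import Algebra.Properties.CommutativeSemiring.Binomial commutativeSemiring
      using (theorem; binomialTerm)
    open import Algebra.Properties.Monoid.Sum +-monoid using (sum; sum-init-last; sum-cong-≋; sum-replicate-zero)

    private
      pow≡ : ∀ x n → x ^ n ≡ x ^ₛ n
      pow≡ x zero    = refl
      pow≡ x (suc n) = cong (x *_) (pow≡ x n)

      ∣⇒·≈0 : ∀ {n} x → q ℕ∣.∣ n → n · x ≈ 0#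
      ∣⇒·≈0 x (ℕ∣.divides m refl) = ≈trans (×-congˡ (ℕₚ.*-comm m q)) (≈trans (≈sym (×-assocˡ x q m)) (char _))

    ^-char-+ : ∀ x y → (x + y) ^ q ≈ x ^ q + y ^ q
    ^-char-+ x y = go q refl
      where
      go : ∀ n → n ≡ q → (x + y) ^ n ≈ x ^ n + y ^ n
      go zero e = contradiction (subst (λ z → ℕ.NonZero z) (sym e) (prime⇒nonZero pr)) λ ()
      go (suc n) e = begin
        (x + y) ^ suc n    ≡⟨ pow≡ (x + y) (suc n) ⟩
        (x + y) ^ₛ suc n   ≈⟨ theorem (suc n) x y ⟩
        t fz + sum (λ i → t (fs i)) ≈⟨ +-cong t₀ (sum-init-last (λ i → t (fs i))) ⟩
        y ^ suc n + (sum (λ i → t (fs (inject₁ i))) + t (fs (fromℕ n)))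
          ≈⟨ +-congˡ (+-cong (≈trans (sum-cong-≋ mid) (sum-replicate-zero n)) tₙ) ⟩
        y ^ suc n + (0# + x ^ suc n) ≈⟨ +-congˡ (+-identityˡ _) ⟩
        y ^ suc n + x ^ suc n        ≈⟨ +-comm _ _ ⟩
        x ^ suc n + y ^ suc n        ∎
        where
        t : Fin (suc (suc n)) → Carrier
        t = binomialTerm x y (suc n)
        t₀ : t fz ≈ y ^ suc n
        t₀ = ≈trans (×-homo-1 _) (≈trans (*-identityˡ _) (reflexive (sym (pow≡ y (suc n)))))
        mid : ∀ i → t (fs (inject₁ i)) ≈ 0#
        mid i = ∣⇒·≈0 _ (subst (λ z → z ℕ∣.∣ (suc n C suc (toℕ (inject₁ i)))) e
          (prime∣binomial (subst Prime (sym e) pr) (subst (ℕ._< n) (sym (Finₚ.toℕ-inject₁ i)) (Finₚ.toℕ<n i))))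
        tₙ : t (fs (fromℕ n)) ≈ x ^ suc n
        tₙ rewrite Finₚ.toℕ-fromℕ n | nCn≡1 (suc n) | ℕₚ.n∸n≡0 n =
          ≈trans (×-homo-1 _) (≈trans (*-identityʳ _) (reflexive (sym (pow≡ x (suc n)))))

    0^q : 0# ^ q ≈ 0#
    0^q = go q refl
      where
      go : ∀ n → n ≡ q → 0# ^ n ≈ 0#
      go zero e = contradiction (subst (λ z → ℕ.NonZero z) (sym e) (prime⇒nonZero pr)) λ ()
      go (suc n) e = zeroˡ _

    ^-char-Σ : ∀ n f → Σ< f n ^ q ≈ Σ< (λ i → f i ^ q) n
    ^-char-Σ zero    f = 0^q
    ^-char-Σ (suc n) f = ≈trans (^-char-+ _ _) (+-congʳ (^-char-Σ n f))

-- Group rings of cyclic groups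

ℤ-step-ind : (P : ℤ → Set) → P (+ 0) → (∀ c → P c → P (c ℤ.+ + 1)) → (∀ c → P (c ℤ.+ + 1) → P c) → ∀ c → P c
ℤ-step-ind P base up down (+ n) = pos n
  where
  pos : ∀ n → P (+ n)
  pos zero    = base
  pos (suc n) = subst P (cong +_ (ℕₚ.+-comm n 1)) (up (+ n) (pos n))
ℤ-step-ind P base up down -[1+ n ] = neg n
  where
  neg : ∀ n → P -[1+ n ]
  neg zero    = down -[1+ 0 ] base
  neg (suc n) = down -[1+ suc n ] (neg n)

∣-by-eq : ∀ {k m n} → m ≡ n → k ∣ m → k ∣ n
∣-by-eq e = subst (_ ∣_) e

∤-small : ∀ {ℓ i} → suc i ℕ.< ℓ → ¬ (+ ℓ ∣ + suc i)
∤-small i<ℓ d = ℕₚ.<⇒≱ i<ℓ (ℕ∣.∣⇒≤ (ℤ∣.∣⇒∣ᵤ d))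

sum< : {A : Set} → (A → A → A) → A → ℕ → (ℤ → A) → A
sum< _∙_ ε zero    F = ε
sum< _∙_ ε (suc n) F = sum< _∙_ ε n F ∙ F (+ n)

-- Functions on ℤ of period ℓ with values in K form, under convolution, the group ring K[ℤ/ℓ].
module Periodic (K : Ring) (ℓ : ℕ) .{{_ : ℕ.NonZero ℓ}} where
  open RingTheory K

  IsPeriodic : (ℤ → Carrier) → Set
  IsPeriodic F = ∀ x → F (x ℤ.+ + ℓ) ≈ F x

  ∑ : (ℤ → Carrier) → Carrier
  ∑ F = sum< _+_ 0# ℓ F

  sum<≡Σ< : ∀ n F → sum< _+_ 0# n F ≡ Σ< (λ i → F (+ i)) n
  sum<≡Σ< zero    F = refl
  sum<≡Σ< (suc n) F = cong (_+ F (+ n)) (sum<≡Σ< n F)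

  ∑≈Σ : ∀ F → ∑ F ≈ Σ< (λ i → F (+ i)) ℓ
  ∑≈Σ F = reflexive (sum<≡Σ< ℓ F)

  private
    via : ∀ F G → Σ< (λ i → F (+ i)) ℓ ≈ Σ< (λ i → G (+ i)) ℓ → ∑ F ≈ ∑ G
    via F G e = ≈trans (∑≈Σ F) (≈trans e (≈sym (∑≈Σ G)))

  ∑-cong : ∀ {F G} → (∀ x → F x ≈ G x) → ∑ F ≈ ∑ G
  ∑-cong {F} {G} e = via F G (Σ-cong ℓ (λ i → e (+ i)))

  private
    eqF : ∀ (F : ℤ → Carrier) {x y} → x ≡ y → F x ≈ F y
    eqF F e = reflexive (cong F e)
    a₁ : ∀ x l c → x ℤ.+ l ℤ.+ c ≡ x ℤ.+ c ℤ.+ l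
    a₁ = solve-∀
    a₂ : ∀ x l c → c ℤ.- (x ℤ.+ l) ≡ c ℤ.- x ℤ.- l
    a₂ = solve-∀
    a₃ : ∀ x l → x ℤ.- l ℤ.+ l ≡ x
    a₃ = solve-∀

  periodic-shift : ∀ {F} c → IsPeriodic F → IsPeriodic (λ x → F (x ℤ.+ c))
  periodic-shift {F} c p x = ≈trans (eqF F (a₁ x (+ ℓ) c)) (p (x ℤ.+ c))

  periodic-flip : ∀ {F} c → IsPeriodic F → IsPeriodic (λ x → F (c ℤ.- x))
  periodic-flip {F} c p x = ≈trans (eqF F (a₂ x (+ ℓ) c))
    (≈trans (≈sym (p (c ℤ.- x ℤ.- + ℓ))) (eqF F (a₃ (c ℤ.- x) (+ ℓ))))

  periodic-* : ∀ {F G} → IsPeriodic F → IsPeriodic G → IsPeriodic (λ x → F x * G x)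
  periodic-* p r x = *-cong (p x) (r x)

  periodic-≡ : ∀ {F} → IsPeriodic F → ∀ {x y} → + ℓ ∣ (x ℤ.- y) → F x ≈ F y
  periodic-≡ {F} p {x} {y} (divides k e) = ≈trans (eqF F (trans (a x y) (cong (λ z → y ℤ.+ z) e))) (multiple k y)
    where
    a : ∀ x y → x ≡ y ℤ.+ (x ℤ.- y)
    a = solve-∀
    b : ∀ y c l → y ℤ.+ (c ℤ.+ + 1) ℤ.* l ≡ y ℤ.+ c ℤ.* l ℤ.+ l
    b = solve-∀
    step : ∀ c y → F (y ℤ.+ (c ℤ.+ + 1) ℤ.* + ℓ) ≈ F (y ℤ.+ c ℤ.* + ℓ)
    step c y = ≈trans (eqF F (b y c (+ ℓ))) (p _)
    multiple : ∀ k y → F (y ℤ.+ k ℤ.* + ℓ) ≈ F y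
    multiple = ℤ-step-ind (λ k → ∀ y → F (y ℤ.+ k ℤ.* + ℓ) ≈ F y)
      (λ y → eqF F (ℤₚ.+-identityʳ y))
      (λ c h y → ≈trans (step c y) (h y))
      (λ c h y → ≈trans (≈sym (step c y)) (h y))

  -- A shift by 1 trades the term F(0) for F(ℓ), which is equal to it by periodicity; every other
  -- shift iterates this one or undoes it.
  ∑-shift : ∀ {F} c → IsPeriodic F → ∑ (λ x → F (x ℤ.+ c)) ≈ ∑ F
  ∑-shift {F} c p = ℤ-step-ind (λ c → ∑ (λ x → F (x ℤ.+ c)) ≈ ∑ F)
    (∑-cong λ x → eqF F (ℤₚ.+-identityʳ x))
    (λ c h → ≈trans (step c) h) (λ c h → ≈trans (≈sym (step c)) h) c
    where
    one : ∀ {G} → IsPeriodic G → ∑ (λ x → G (x ℤ.+ + 1)) ≈ ∑ G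
    one {G} r = via (λ x → G (x ℤ.+ + 1)) G (+-cancelˡ (G (+ 0)) _ _ (begin
      G (+ 0) + Σ< (λ i → G (+ (i ℕ.+ 1))) ℓ ≈⟨ +-congˡ (Σ-cong ℓ (λ i → eqF G (cong +_ (ℕₚ.+-comm i 1)))) ⟩
      G (+ 0) + Σ< (λ i → G (+ suc i)) ℓ     ≈⟨ Σ-head ℓ (λ i → G (+ i)) ⟨
      Σ< (λ i → G (+ i)) ℓ + G (+ ℓ)         ≈⟨ +-comm _ _ ⟩
      G (+ ℓ) + Σ< (λ i → G (+ i)) ℓ         ≈⟨ +-congʳ (≈trans (eqF G (sym (ℤₚ.+-identityˡ (+ ℓ)))) (r (+ 0))) ⟩
      G (+ 0) + Σ< (λ i → G (+ i)) ℓ         ∎))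
    b : ∀ x c → x ℤ.+ (c ℤ.+ + 1) ≡ x ℤ.+ + 1 ℤ.+ c
    b = solve-∀
    step : ∀ c → ∑ (λ x → F (x ℤ.+ (c ℤ.+ + 1))) ≈ ∑ (λ x → F (x ℤ.+ c))
    step c = ≈trans (∑-cong λ x → eqF F (b x c)) (one (periodic-shift c p))

  -- Summing in the opposite order turns the arguments -i into i + 1 - ℓ, so a reflection becomes a
  -- shift.
  ∑-flip : ∀ {F} c → IsPeriodic F → ∑ (λ x → F (c ℤ.- x)) ≈ ∑ F
  ∑-flip {F} c p = begin
    ∑ (λ x → F (c ℤ.- x))                     ≈⟨ via (λ x → F (c ℤ.- x)) (λ x → F (c ℤ.+ (x ℤ.+ (+ 1 ℤ.- + ℓ)))) (reverse ℓ (λ x → F (c ℤ.+ x))) ⟩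
    ∑ (λ x → F (c ℤ.+ (x ℤ.+ (+ 1 ℤ.- + ℓ)))) ≈⟨ (∑-cong λ x → eqF F (b x c (+ 1 ℤ.- + ℓ))) ⟩
    ∑ (λ x → F (x ℤ.+ (c ℤ.+ (+ 1 ℤ.- + ℓ)))) ≈⟨ ∑-shift _ p ⟩
    ∑ F                                       ∎
    where
    b : ∀ x c d → c ℤ.+ (x ℤ.+ d) ≡ x ℤ.+ (c ℤ.+ d)
    b = solve-∀
    d₁ : ∀ n → ℤ.- n ≡ + 0 ℤ.+ (+ 1 ℤ.- (n ℤ.+ + 1))
    d₁ = solve-∀
    d₂ : ∀ i n → i ℤ.+ (+ 1 ℤ.- n) ≡ i ℤ.+ + 1 ℤ.+ (+ 1 ℤ.- (n ℤ.+ + 1))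
    d₂ = solve-∀
    +1 : ∀ n → + n ℤ.+ + 1 ≡ + suc n
    +1 n = cong +_ (ℕₚ.+-comm n 1)
    reverse : ∀ n G → Σ< (λ i → G (ℤ.- + i)) n ≈ Σ< (λ i → G (+ i ℤ.+ (+ 1 ℤ.- + n))) n
    reverse zero G = ≈refl
    reverse (suc n) G = begin
      Σ< (λ i → G (ℤ.- + i)) n + G (ℤ.- + n)
        ≈⟨ +-cong (reverse n G) (eqF G (trans (d₁ (+ n)) (cong (λ z → + 0 ℤ.+ (+ 1 ℤ.- z)) (+1 n)))) ⟩
      Σ< (λ i → G (+ i ℤ.+ (+ 1 ℤ.- + n))) n + G (+ 0 ℤ.+ (+ 1 ℤ.- + suc n))
        ≈⟨ +-comm _ _ ⟩
      G (+ 0 ℤ.+ (+ 1 ℤ.- + suc n)) + Σ< (λ i → G (+ i ℤ.+ (+ 1 ℤ.- + n))) n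
        ≈⟨ +-congˡ (Σ-cong n λ i → eqF G (trans (d₂ (+ i) (+ n)) (cong₂ (λ u v → u ℤ.+ (+ 1 ℤ.- v)) (+1 i) (+1 n)))) ⟩
      G (+ 0 ℤ.+ (+ 1 ℤ.- + suc n)) + Σ< (λ i → G (+ suc i ℤ.+ (+ 1 ℤ.- + suc n))) n
        ≈⟨ Σ-head n (λ i → G (+ i ℤ.+ (+ 1 ℤ.- + suc n))) ⟨
      Σ< (λ i → G (+ i ℤ.+ (+ 1 ℤ.- + suc n))) (suc n) ∎

  δ : ℤ → Carrier
  δ x with + ℓ ∣? x
  ... | yes _ = 1#
  ... | no _  = 0#

  δ-yes : ∀ {x} → + ℓ ∣ x → δ x ≈ 1#
  δ-yes {x} d with + ℓ ∣? x
  ... | yes _ = ≈refl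
  ... | no n  = contradiction d n

  δ-no : ∀ {x} → ¬ (+ ℓ ∣ x) → δ x ≈ 0#
  δ-no {x} n with + ℓ ∣? x
  ... | yes d = contradiction d n
  ... | no _  = ≈refl

  δ-iff : ∀ {x y} → (+ ℓ ∣ x → + ℓ ∣ y) → (+ ℓ ∣ y → + ℓ ∣ x) → δ x ≈ δ y
  δ-iff {x} {y} f g with + ℓ ∣? x
  ... | yes d = ≈sym (δ-yes (f d))
  ... | no n  = ≈sym (δ-no (λ d → n (g d)))

  δ-periodic : IsPeriodic δ
  δ-periodic x = δ-iff (λ d → ∣-by-eq (a x (+ ℓ)) (ℤ∣.∣m∣n⇒∣m-n d ℤ∣.∣-refl)) (λ d → ℤ∣.∣m∣n⇒∣m+n d ℤ∣.∣-refl)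
    where
    a : ∀ x l → x ℤ.+ l ℤ.- l ≡ x
    a = solve-∀

  ∑-δ : ∀ (F : ℤ → Carrier) → ∑ (λ x → δ x * F x) ≈ F (+ 0)
  ∑-δ F = ≈trans (∑≈Σ _) (go ℓ refl)
    where
    go : ∀ n → n ≡ ℓ → Σ< (λ i → δ (+ i) * F (+ i)) n ≈ F (+ 0)
    go zero e = contradiction (sym e) (ℕ.≢-nonZero⁻¹ ℓ)
    go (suc n) e = begin
      Σ< (λ i → δ (+ i) * F (+ i)) (suc n) ≈⟨ Σ-head n (λ i → δ (+ i) * F (+ i)) ⟩
      δ (+ 0) * F (+ 0) + Σ< (λ i → δ (+ suc i) * F (+ suc i)) n
        ≈⟨ +-cong (≈trans (*-congʳ (δ-yes (divides (+ 0) refl))) (*-identityˡ _))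
                  (Σ-0 n λ i i<n → ≈trans (*-congʳ (δ-no (∤-small (subst (suc i ℕ.<_) e (ℕ.s≤s i<n))))) (zeroˡ _)) ⟩
      F (+ 0) + 0# ≈⟨ +-identityʳ _ ⟩
      F (+ 0) ∎

  ∑-pick : ∀ {F} z → IsPeriodic F → ∑ (λ x → δ (x ℤ.- z) * F x) ≈ F z
  ∑-pick {F} z p = begin
    ∑ (λ x → δ (x ℤ.- z) * F x)
      ≈⟨ ∑-shift z (periodic-* (periodic-shift (ℤ.- z) δ-periodic) p) ⟨
    ∑ (λ x → δ (x ℤ.+ z ℤ.- z) * F (x ℤ.+ z))
      ≈⟨ ∑-cong (λ x → *-congʳ (eqF δ (a x z))) ⟩
    ∑ (λ x → δ x * F (x ℤ.+ z))
      ≈⟨ ∑-δ (λ x → F (x ℤ.+ z)) ⟩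
    F (+ 0 ℤ.+ z)
      ≈⟨ eqF F (ℤₚ.+-identityˡ z) ⟩
    F z ∎
    where
    a : ∀ x z → x ℤ.+ z ℤ.- z ≡ x
    a = solve-∀

  ∑-swap : ∀ (F : ℤ → ℤ → Carrier) → ∑ (λ x → ∑ (F x)) ≈ ∑ (λ y → ∑ (λ x → F x y))
  ∑-swap F = begin
    ∑ (λ x → ∑ (F x))                                 ≈⟨ ∑-cong (λ x → ∑≈Σ (F x)) ⟩
    ∑ (λ x → Σ< (λ j → F x (+ j)) ℓ)                  ≈⟨ ∑≈Σ _ ⟩
    Σ< (λ i → Σ< (λ j → F (+ i) (+ j)) ℓ) ℓ           ≈⟨ Σ-swap ℓ ℓ (λ i j → F (+ i) (+ j)) ⟩
    Σ< (λ j → Σ< (λ i → F (+ i) (+ j)) ℓ) ℓ           ≈⟨ ∑≈Σ _ ⟨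
    ∑ (λ y → Σ< (λ i → F (+ i) y) ℓ)                  ≈⟨ ∑-cong (λ y → ∑≈Σ (λ x → F x y)) ⟨
    ∑ (λ y → ∑ (λ x → F x y))                         ∎

  ∑-*ˡ : ∀ c F → ∑ (λ x → c * F x) ≈ c * ∑ F
  ∑-*ˡ c F = ≈trans (∑≈Σ _) (≈trans (Σ-*ˡ ℓ c _) (*-congˡ (≈sym (∑≈Σ F))))

  ∑-*ʳ : ∀ c F → ∑ (λ x → F x * c) ≈ ∑ F * c
  ∑-*ʳ c F = ≈trans (∑-cong λ x → *-comm _ _) (≈trans (∑-*ˡ c F) (*-comm _ _))

  ∑-+ : ∀ F G → ∑ (λ x → F x + G x) ≈ ∑ F + ∑ G
  ∑-+ F G = ≈trans (∑≈Σ _) (≈trans (Σ-+ ℓ _ _) (+-cong (≈sym (∑≈Σ F)) (≈sym (∑≈Σ G))))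

  δ-dilate : ∀ c c′ → + ℓ ∣ (c ℤ.* c′ ℤ.- + 1) → ∀ x y → δ (y ℤ.- c ℤ.* x) ≈ δ (x ℤ.- c′ ℤ.* y)
  δ-dilate c c′ i x y = δ-iff
    (λ d → ∣-by-eq (e₁ x y c c′) (ℤ∣.∣m∣n⇒∣m-n (ℤ∣.∣n⇒∣m*n (ℤ.- c′) d) (ℤ∣.∣n⇒∣m*n x i)))
    (λ d → ∣-by-eq (e₂ x y c c′) (ℤ∣.∣m∣n⇒∣m-n (ℤ∣.∣n⇒∣m*n (ℤ.- c) d) (ℤ∣.∣n⇒∣m*n y i)))
    where
    e₁ : ∀ x y c c′ → (ℤ.- c′) ℤ.* (y ℤ.- c ℤ.* x) ℤ.- x ℤ.* (c ℤ.* c′ ℤ.- + 1) ≡ x ℤ.- c′ ℤ.* y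
    e₁ = solve-∀
    e₂ : ∀ x y c c′ → (ℤ.- c) ℤ.* (x ℤ.- c′ ℤ.* y) ℤ.- y ℤ.* (c ℤ.* c′ ℤ.- + 1) ≡ y ℤ.- c ℤ.* x
    e₂ = solve-∀

  -- No permutation of the residues is constructed. F(cx) is expanded against δ, the two sums are
  -- exchanged, and y ≡ cx is rewritten as x ≡ c′y, where c′ inverts c modulo ℓ.
  ∑-dilate : ∀ {F} c c′ → + ℓ ∣ (c ℤ.* c′ ℤ.- + 1) → IsPeriodic F → ∑ (λ x → F (c ℤ.* x)) ≈ ∑ F
  ∑-dilate {F} c c′ i p = begin
    ∑ (λ x → F (c ℤ.* x))
      ≈⟨ ∑-cong (λ x → ∑-pick (c ℤ.* x) p) ⟨
    ∑ (λ x → ∑ (λ y → δ (y ℤ.- c ℤ.* x) * F y))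
      ≈⟨ ∑-swap _ ⟩
    ∑ (λ y → ∑ (λ x → δ (y ℤ.- c ℤ.* x) * F y))
      ≈⟨ ∑-cong (λ y → ∑-cong (λ x → *-congʳ (δ-dilate c c′ i x y))) ⟩
    ∑ (λ y → ∑ (λ x → δ (x ℤ.- c′ ℤ.* y) * F y))
      ≈⟨ ∑-cong (λ y → ∑-pick (c′ ℤ.* y) (λ _ → ≈refl)) ⟩
    ∑ F ∎

  record Per : Set where
    constructor per
    field
      at     : ℤ → Carrier
      period : IsPeriodic at
  open Per public

  record _≋_ (f g : Per) : Set where
    constructor pointwise
    field app : ∀ x → at f x ≈ at g x
  open _≋_ public

  conv : (ℤ → Carrier) → (ℤ → Carrier) → ℤ → Carrier
  conv f g s = ∑ (λ x → f x * g (s ℤ.- x))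

  abstract
    ⊛-period : ∀ f g → IsPeriodic (conv (at f) (at g))
    ⊛-period f g s = ∑-cong λ x → *-congˡ (≈trans (eqF (at g) (a₁ s (+ ℓ) (ℤ.- x))) (period g (s ℤ.- x)))

    •-period : ∀ c f → IsPeriodic (λ x → c * at f x)
    •-period c f x = *-congˡ (period f x)

  _⊛_ _⊞_ : Per → Per → Per
  f ⊛ g = per (conv (at f) (at g)) (⊛-period f g)
  f ⊞ g = per (λ x → at f x + at g x) (λ x → +-cong (period f x) (period g x))

  δᴾ : Per
  δᴾ = per δ δ-periodic

  const : Carrier → Per
  const c = per (λ _ → c) (λ _ → ≈refl)

  private
    s-s-x : ∀ s x → s ℤ.- (s ℤ.- x) ≡ x
    s-s-x = solve-∀

    perConv : ∀ f g s → IsPeriodic (λ x → at f x * at g (s ℤ.- x))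
    perConv f g s = periodic-* (period f) (periodic-flip s (period g))

  ⊛-comm : ∀ f g → (f ⊛ g) ≋ (g ⊛ f)
  ⊛-comm f g = pointwise λ s → begin
    ∑ (λ x → at f x * at g (s ℤ.- x))                     ≈⟨ ∑-flip s (perConv f g s) ⟨
    ∑ (λ x → at f (s ℤ.- x) * at g (s ℤ.- (s ℤ.- x)))     ≈⟨ ∑-cong (λ x → ≈trans (*-congˡ (eqF (at g) (s-s-x s x))) (*-comm _ _)) ⟩
    ∑ (λ x → at g x * at f (s ℤ.- x))                     ∎

  ⊛-identityˡ : ∀ f → (δᴾ ⊛ f) ≋ f
  ⊛-identityˡ f = pointwise λ s → ≈trans (∑-δ (λ x → at f (s ℤ.- x))) (eqF (at f) (ℤₚ.+-identityʳ s))

  ⊛-assoc : ∀ f g h → ((f ⊛ g) ⊛ h) ≋ (f ⊛ (g ⊛ h))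
  ⊛-assoc f g h = pointwise λ s → begin
    ∑ (λ y → ∑ (λ x → F x * G (y ℤ.- x)) * H (s ℤ.- y))
      ≈⟨ ∑-cong (λ y → ∑-*ʳ (H (s ℤ.- y)) _) ⟨
    ∑ (λ y → ∑ (λ x → F x * G (y ℤ.- x) * H (s ℤ.- y)))
      ≈⟨ ∑-swap _ ⟩
    ∑ (λ x → ∑ (λ y → F x * G (y ℤ.- x) * H (s ℤ.- y)))
      ≈⟨ ∑-cong (λ x → ≈trans (∑-cong (λ y → *-assoc _ _ _)) (∑-*ˡ (F x) _)) ⟩
    ∑ (λ x → F x * ∑ (λ y → G (y ℤ.- x) * H (s ℤ.- y)))
      ≈⟨ ∑-cong (λ x → *-congˡ (∑-shift x (periodic-* (periodic-shift (ℤ.- x) (period g)) (periodic-flip s (period h))))) ⟨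
    ∑ (λ x → F x * ∑ (λ y → G (y ℤ.+ x ℤ.- x) * H (s ℤ.- (y ℤ.+ x))))
      ≈⟨ ∑-cong (λ x → *-congˡ (∑-cong λ y → *-cong (eqF G (b₁ y x)) (eqF H (b₂ s y x)))) ⟩
    ∑ (λ x → F x * ∑ (λ y → G y * H (s ℤ.- x ℤ.- y))) ∎
    where
    F = at f
    G = at g
    H = at h
    b₁ : ∀ y x → y ℤ.+ x ℤ.- x ≡ y
    b₁ = solve-∀
    b₂ : ∀ s y x → s ℤ.- (y ℤ.+ x) ≡ s ℤ.- x ℤ.- y
    b₂ = solve-∀

  ⊛-distribˡ : ∀ f g h → (f ⊛ (g ⊞ h)) ≋ ((f ⊛ g) ⊞ (f ⊛ h))
  ⊛-distribˡ f g h = pointwise λ s → ≈trans (∑-cong λ x → distribˡ _ _ _) (∑-+ _ _)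

  ⊛-cong : ∀ {f g u v} → f ≋ g → u ≋ v → (f ⊛ u) ≋ (g ⊛ v)
  ⊛-cong e e′ = pointwise λ s → ∑-cong λ x → *-cong (app e x) (app e′ (s ℤ.- x))

  ≋-trans : ∀ {f g h} → f ≋ g → g ≋ h → f ≋ h
  ≋-trans e e′ = pointwise λ x → ≈trans (app e x) (app e′ x)

  ≋-sym : ∀ {f g} → f ≋ g → g ≋ f
  ≋-sym e = pointwise λ x → ≈sym (app e x)

  groupRing : Ring
  groupRing = record
    { Carrier = Per ; _≈_ = _≋_ ; _+_ = _⊞_ ; _*_ = _⊛_
    ; -_ = λ f → per (λ x → - at f x) (λ x → -‿cong (period f x)) ; 0# = const 0# ; 1# = δᴾ
    ; isCommutativeRing = record
      { isRing = record
        { +-isAbelianGroup = record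
          { isGroup = record
            { isMonoid = record
              { isSemigroup = record
                { isMagma = record
                  { isEquivalence = record { refl = pointwise λ _ → ≈refl ; sym = ≋-sym ; trans = ≋-trans }
                  ; ∙-cong = λ e e′ → pointwise λ x → +-cong (app e x) (app e′ x) }
                ; assoc = λ f g h → pointwise λ x → +-assoc _ _ _ }
              ; identity = (λ f → pointwise λ x → +-identityˡ _) , (λ f → pointwise λ x → +-identityʳ _) }
            ; inverse = (λ f → pointwise λ x → -‿inverseˡ _) , (λ f → pointwise λ x → -‿inverseʳ _)
            ; ⁻¹-cong = λ e → pointwise λ x → -‿cong (app e x) }
          ; comm = λ f g → pointwise λ x → +-comm _ _ }
        ; *-cong = ⊛-cong
        ; *-assoc = ⊛-assoc
        ; *-identity = ⊛-identityˡ , λ f → ≋-trans (⊛-comm f δᴾ) (⊛-identityˡ f)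
        ; distrib = ⊛-distribˡ , λ f g h → ≋-trans (⊛-comm (g ⊞ h) f)
            (≋-trans (⊛-distribˡ f g h) (pointwise λ x → +-cong (app (⊛-comm f g) x) (app (⊛-comm f h) x))) }
      ; *-comm = ⊛-comm } }

  infixr 7 _•_
  _•_ : Carrier → Per → Per
  c • f = per (λ x → c * at f x) (•-period c f)

  •-⊛ : ∀ c f g → ((c • f) ⊛ g) ≋ (c • (f ⊛ g))
  •-⊛ c f g = pointwise λ s → ≈trans (∑-cong λ x → *-assoc _ _ _) (∑-*ˡ c _)

  module G = RingTheory groupRing

  -- The element c[z] of the group ring, with [z] the basis vector of the class of z.
  mono : Carrier → ℤ → Per
  mono c z = per (λ x → δ (x ℤ.- z) * c) (λ x → *-congʳ (periodic-shift (ℤ.- z) δ-periodic x))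

  mono-⊛ : ∀ c z d w → (mono c z ⊛ mono d w) ≋ mono (c * d) (z ℤ.+ w)
  mono-⊛ c z d w = pointwise λ s → begin
    ∑ (λ x → δ (x ℤ.- z) * c * (δ (s ℤ.- x ℤ.- w) * d))
      ≈⟨ ∑-cong (λ x → ≈trans (*-assoc _ _ _) (*-congˡ (*-exchangeˡ _ _ _))) ⟩
    ∑ (λ x → δ (x ℤ.- z) * (δ (s ℤ.- x ℤ.- w) * (c * d)))
      ≈⟨ ∑-pick z (λ x → *-congʳ (periodic-flip {λ y → δ (y ℤ.- w)} s (periodic-shift (ℤ.- w) δ-periodic) x)) ⟩
    δ (s ℤ.- z ℤ.- w) * (c * d)
      ≈⟨ *-congʳ (eqF δ (b s z w)) ⟩
    δ (s ℤ.- (z ℤ.+ w)) * (c * d) ∎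
    where
    b : ∀ s z w → s ℤ.- z ℤ.- w ≡ s ℤ.- (z ℤ.+ w)
    b = solve-∀

  mono-^ : ∀ c z n → (mono c z G.^ n) ≋ mono (c ^ n) (+ n ℤ.* z)
  mono-^ c z zero = pointwise λ x → ≈trans (eqF δ (sym (ℤₚ.+-identityʳ x))) (≈sym (*-identityʳ _))
  mono-^ c z (suc n) = ≋-trans (⊛-cong {mono c z} {mono c z} (pointwise λ _ → ≈refl) (mono-^ c z n)) (≋-trans (mono-⊛ c z _ _)
    (pointwise λ x → *-congʳ (eqF (λ t → δ (x ℤ.- t)) (sym (ℤₚ.suc-* (+ n) z)))))

  at-Σ : ∀ F n s → at (G.Σ< F n) s ≈ Σ< (λ i → at (F i) s) n
  at-Σ F zero    s = ≈refl
  at-Σ F (suc n) s = +-congʳ (at-Σ F n s)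

  at-· : ∀ n f s → at (n G.· f) s ≈ n · at f s
  at-· zero    f s = ≈refl
  at-· (suc n) f s = +-congˡ (at-· n f s)

  monomials : ∀ f → f ≋ G.Σ< (λ i → mono (at f (+ i)) (+ i)) ℓ
  monomials f = pointwise λ s → ≈sym (≈trans (≈trans (at-Σ _ ℓ s) (≈sym (∑≈Σ (λ x → δ (s ℤ.- x) * at f x)))) (≈trans
    (∑-cong λ x → *-congʳ (δ-iff (λ d → ∣-by-eq (b s x) (ℤ∣.∣m⇒∣-m d)) (λ d → ∣-by-eq (b x s) (ℤ∣.∣m⇒∣-m d)))) (∑-pick s (period f))))
    where
    b : ∀ s x → ℤ.- (s ℤ.- x) ≡ x ℤ.- s
    b = solve-∀

  -- In characteristic q the q-th power of ∑ f(x)[x] is ∑ f(x)^q [qx], and qx ≡ s means x ≡ q′s.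
  frobenius : ∀ {q} → Prime q → (∀ x → q · x ≈ 0#) → ∀ q′ → + ℓ ∣ (+ q ℤ.* q′ ℤ.- + 1) →
              ∀ f s → at (f G.^ q) s ≈ at f (q′ ℤ.* s) ^ q
  frobenius {q} pr char q′ i f s = begin
    at (f G.^ q) s
      ≈⟨ app (G.^-cong q (monomials f)) s ⟩
    at (G.Σ< (λ i → mono (at f (+ i)) (+ i)) ℓ G.^ q) s
      ≈⟨ app (^-char-Σ ℓ _) s ⟩
    at (G.Σ< (λ i → mono (at f (+ i)) (+ i) G.^ q) ℓ) s
      ≈⟨ ≈trans (at-Σ _ ℓ s) (≈sym (∑≈Σ (λ x → at (mono (at f x) x G.^ q) s))) ⟩
    ∑ (λ x → at (mono (at f x) x G.^ q) s)
      ≈⟨ ∑-cong (λ x → app (mono-^ (at f x) x q) s) ⟩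
    ∑ (λ x → δ (s ℤ.- + q ℤ.* x) * at f x ^ q)
      ≈⟨ ∑-cong (λ x → *-congʳ (δ-dilate (+ q) q′ i x s)) ⟩
    ∑ (λ x → δ (x ℤ.- q′ ℤ.* s) * at f x ^ q)
      ≈⟨ ∑-pick (q′ ℤ.* s) (λ x → ^-cong q (period f x)) ⟩
    at f (q′ ℤ.* s) ^ q ∎
    where open G.Frobenius pr (λ f → pointwise λ s → ≈trans (at-· q f s) (char (at f s)))

-- Power sums and Fermat's theorem

module Z = RingTheory ℤₚ.+-*-commutativeRing
open Z using () renaming (Σ< to Σℤ)

∣⇒≈ : ∀ {q x y} → q ∣ (x ℤ.- y) → CommutativeRing._≈_ (Z/ q) x y
∣⇒≈ {q} {x} {y} (divides k e) = Quotient.mod k (trans (a x y) (cong (λ z → y ℤ.+ z) e))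
  where
  a : ∀ x y → x ≡ y ℤ.+ (x ℤ.- y)
  a = solve-∀

≈⇒∣ : ∀ {q x y} → CommutativeRing._≈_ (Z/ q) x y → q ∣ (x ℤ.- y)
≈⇒∣ {q} {x} {y} (Quotient.mod k e) = divides k (trans (cong (λ z → z ℤ.- y) e) (a y (k ℤ.* q)))
  where
  a : ∀ y z → y ℤ.+ z ℤ.- y ≡ z
  a = solve-∀

∣⇒≈0 : ∀ {q x} → q ∣ x → CommutativeRing._≈_ (Z/ q) x (+ 0)
∣⇒≈0 {q} {x} d = ∣⇒≈ (∣-by-eq (sym (ℤₚ.+-identityʳ x)) d)

≈0⇒∣ : ∀ {q x} → CommutativeRing._≈_ (Z/ q) x (+ 0) → q ∣ x
≈0⇒∣ {q} {x} d = ∣-by-eq (ℤₚ.+-identityʳ x) (≈⇒∣ d)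

prime∣* : ∀ {q} → Prime q → ∀ x y → + q ∣ x ℤ.* y → + q ∣ x ⊎ + q ∣ y
prime∣* {q} pr x y d with euclidsLemma ℤ.∣ x ∣ ℤ.∣ y ∣ pr (subst (q ℕ∣.∣_) (ℤₚ.abs-* x y) (ℤ∣.∣⇒∣ᵤ d))
... | inj₁ e = inj₁ (ℤ∣.∣ᵤ⇒∣ e)
... | inj₂ e = inj₂ (ℤ∣.∣ᵤ⇒∣ e)

prime∤* : ∀ {q} → Prime q → ∀ {x y} → ¬ (+ q ∣ x) → ¬ (+ q ∣ y) → ¬ (+ q ∣ x ℤ.* y)
prime∤* pr {x} {y} nx ny d with prime∣* pr x y d
... | inj₁ e = nx e
... | inj₂ e = ny e

prime∤1 : ∀ {q} → Prime q → ¬ (+ q ∣ + 1)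
prime∤1 pr d = ¬prime[1] (subst Prime (ℕ∣.∣1⇒≡1 (ℤ∣.∣⇒∣ᵤ d)) pr)

prime∣prime : ∀ {q r} → Prime q → Prime r → + q ∣ + r → q ≡ r
prime∣prime pq pr d with prime⇒irreducible pr (ℤ∣.∣⇒∣ᵤ d)
... | inj₁ e = contradiction (subst Prime e pq) ¬prime[1]
... | inj₂ e = e

·≡* : ∀ n x → n Z.· x ≡ + n ℤ.* x
·≡* zero    x = refl
·≡* (suc n) x = trans (cong (λ z → x ℤ.+ z) (·≡* n x)) (sym (ℤₚ.suc-* (+ n) x))

Δ : (ℤ → ℤ) → ℤ → ℤ
Δ f x = f (x ℤ.+ + 1) ℤ.- f x

-- The n-th difference of f vanishes. This is all that is needed of a polynomial of degree below n.
Killed : ℕ → (ℤ → ℤ) → Set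
Killed zero    f = ∀ x → f x ≡ + 0
Killed (suc n) f = Killed n (Δ f)

Killed-cong : ∀ n {f g} → (∀ x → f x ≡ g x) → Killed n f → Killed n g
Killed-cong zero    e h x = trans (sym (e x)) (h x)
Killed-cong (suc n) e h = Killed-cong n (λ x → cong₂ ℤ._-_ (e _) (e x)) h

Killed-+ : ∀ n {f g} → Killed n f → Killed n g → Killed n (λ x → f x ℤ.+ g x)
Killed-+ zero    h k x = cong₂ ℤ._+_ (h x) (k x)
Killed-+ (suc n) {f} {g} h k = Killed-cong n (λ x → a (f (x ℤ.+ + 1)) (f x) (g (x ℤ.+ + 1)) (g x)) (Killed-+ n h k)
  where
  a : ∀ p q r s → (p ℤ.- q) ℤ.+ (r ℤ.- s) ≡ (p ℤ.+ r) ℤ.- (q ℤ.+ s)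
  a = solve-∀

Killed-* : ∀ n c {f} → Killed n f → Killed n (λ x → c ℤ.* f x)
Killed-* zero    c h x = trans (cong (c ℤ.*_) (h x)) (ℤₚ.*-zeroʳ c)
Killed-* (suc n) c {f} h = Killed-cong n (λ x → a c (f (x ℤ.+ + 1)) (f x)) (Killed-* n c h)
  where
  a : ∀ c p q → c ℤ.* (p ℤ.- q) ≡ c ℤ.* p ℤ.- c ℤ.* q
  a = solve-∀

-- Leibniz rule for differences: Δ((ux + c)f) = (ux + u + c)Δf + uf, where both summands need at
-- most one difference fewer.
Killed-linear : ∀ n u c {f} → Killed n f → Killed (suc n) (λ x → (u ℤ.* x ℤ.+ c) ℤ.* f x)
Killed-linear zero u c {f} h x = cong₂ ℤ._-_ (z (x ℤ.+ + 1)) (z x)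
  where
  z : ∀ x → (u ℤ.* x ℤ.+ c) ℤ.* f x ≡ + 0
  z x = trans (cong ((u ℤ.* x ℤ.+ c) ℤ.*_) (h x)) (ℤₚ.*-zeroʳ (u ℤ.* x ℤ.+ c))
Killed-linear (suc n) u c {f} h = Killed-cong (suc n) (λ x → a u c x (f x) (f (x ℤ.+ + 1)))
  (Killed-+ (suc n) {λ x → (u ℤ.* x ℤ.+ (u ℤ.+ c)) ℤ.* Δ f x} {λ x → u ℤ.* f x}
    (Killed-linear n u (u ℤ.+ c) h) (Killed-* (suc n) u {f} h))
  where
  a : ∀ u c x p q → (u ℤ.* x ℤ.+ (u ℤ.+ c)) ℤ.* (q ℤ.- p) ℤ.+ u ℤ.* p
    ≡ (u ℤ.* (x ℤ.+ + 1) ℤ.+ c) ℤ.* q ℤ.- (u ℤ.* x ℤ.+ c) ℤ.* p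
  a = solve-∀

Killed-linear-^ : ∀ k n u c {f} → Killed n f → Killed (k ℕ.+ n) (λ x → (u ℤ.* x ℤ.+ c) Z.^ k ℤ.* f x)
Killed-linear-^ zero    n u c {f} h = Killed-cong n (λ x → sym (ℤₚ.*-identityˡ (f x))) h
Killed-linear-^ (suc k) n u c {f} h =
  Killed-cong (suc (k ℕ.+ n)) (λ x → sym (ℤₚ.*-assoc (u ℤ.* x ℤ.+ c) ((u ℤ.* x ℤ.+ c) Z.^ k) (f x)))
    (Killed-linear (k ℕ.+ n) u c (Killed-linear-^ k n u c h))

iterΔ : ℕ → (ℤ → ℤ) → ℤ → ℤ
iterΔ zero    f = f
iterΔ (suc j) f = iterΔ j (Δ f)

newton : ∀ m n f → Killed n f → f (+ m) ≡ Σℤ (λ j → + (m C j) ℤ.* iterΔ j f (+ 0)) n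
newton m zero f h = h (+ m)
newton zero (suc n) f h = sym (trans (Z.Σ-head n _)
  (trans (cong₂ ℤ._+_ (ℤₚ.*-identityˡ (f (+ 0))) (Z.Σ-0 n λ i _ →
    cong (λ z → + z ℤ.* iterΔ (suc i) f (+ 0)) (k>n⇒nCk≡0 {0} {suc i} (ℕ.s≤s ℕ.z≤n)))) (ℤₚ.+-identityʳ (f (+ 0)))))
newton (suc m) (suc n) f h = begin
  f (+ suc m)
    ≡⟨ trans (cong (λ z → f (+ z)) (ℕₚ.+-comm 1 m)) (a (f (+ m)) (f (+ (m ℕ.+ 1)))) ⟩
  f (+ m) ℤ.+ Δ f (+ m)
    ≡⟨ cong₂ ℤ._+_ (newton m (suc n) f h) (newton m n (Δ f) h) ⟩
  Σℤ (λ j → + (m C j) ℤ.* d j) (suc n) ℤ.+ Σℤ (λ j → + (m C j) ℤ.* d (suc j)) n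
    ≡⟨ cong (ℤ._+ Σℤ (λ j → + (m C j) ℤ.* d (suc j)) n) (Z.Σ-head n _) ⟩
  (+ (m C 0) ℤ.* d 0 ℤ.+ Σℤ (λ j → + (m C suc j) ℤ.* d (suc j)) n) ℤ.+ Σℤ (λ j → + (m C j) ℤ.* d (suc j)) n
    ≡⟨ trans (ℤₚ.+-assoc (+ (m C 0) ℤ.* d 0) _ _) (cong (λ z → + (m C 0) ℤ.* d 0 ℤ.+ z) (sym (Z.Σ-+ n _ _))) ⟩
  + (m C 0) ℤ.* d 0 ℤ.+ Σℤ (λ j → + (m C suc j) ℤ.* d (suc j) ℤ.+ + (m C j) ℤ.* d (suc j)) n
    ≡⟨ cong (λ z → + (m C 0) ℤ.* d 0 ℤ.+ z) (Z.Σ-cong n λ j → trans (sym (ℤₚ.*-distribʳ-+ (d (suc j)) (+ (m C suc j)) (+ (m C j))))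
         (cong (λ z → + z ℤ.* d (suc j)) (trans (ℕₚ.+-comm (m C suc j) (m C j)) (nCk+nC[k+1]≡[n+1]C[k+1] m j)))) ⟩
  + (suc m C 0) ℤ.* d 0 ℤ.+ Σℤ (λ j → + (suc m C suc j) ℤ.* d (suc j)) n
    ≡⟨ Z.Σ-head n _ ⟨
  Σℤ (λ j → + (suc m C j) ℤ.* d j) (suc n) ∎
  where
  open ≡.≡-Reasoning
  d : ℕ → ℤ
  d j = iterΔ j f (+ 0)
  a : ∀ p q → q ≡ p ℤ.+ (q ℤ.- p)
  a = solve-∀

-- Newton's interpolation formula summed over its argument: each C(m, j) becomes C(m, j + 1).
newton-Σ : ∀ m n f → Killed n f → Σℤ (λ i → f (+ i)) m ≡ Σℤ (λ j → + (m C suc j) ℤ.* iterΔ j f (+ 0)) n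
newton-Σ zero n f h = sym (Z.Σ-0 n λ j _ → cong (λ z → + z ℤ.* iterΔ j f (+ 0)) (k>n⇒nCk≡0 {0} {suc j} (ℕ.s≤s ℕ.z≤n)))
newton-Σ (suc m) n f h = trans (cong₂ ℤ._+_ (newton-Σ m n f h) (newton m n f h))
  (trans (sym (Z.Σ-+ n _ _)) (Z.Σ-cong n λ j → trans (sym (ℤₚ.*-distribʳ-+ (iterΔ j f (+ 0)) (+ (m C suc j)) (+ (m C j))))
    (cong (λ z → + z ℤ.* iterΔ j f (+ 0)) (trans (ℕₚ.+-comm (m C suc j) (m C j)) (nCk+nC[k+1]≡[n+1]C[k+1] m j)))))

Σ-∣ : ∀ {q} n {f : ℕ → ℤ} → (∀ i → i ℕ.< n → q ∣ f i) → q ∣ Σℤ f n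
Σ-∣ zero    h = divides (+ 0) refl
Σ-∣ (suc n) h = ℤ∣.∣m∣n⇒∣m+n (Σ-∣ n (λ i p → h i (ℕₚ.m<n⇒m<1+n p))) (h n ℕₚ.≤-refl)

-- A polynomial of degree at most ℓ - 2 sums to 0 over the residues modulo ℓ, because only the
-- coefficients C(ℓ, j + 1) with 0 < j + 1 < ℓ occur. No primitive root modulo ℓ is required.
prime∣Σ : ∀ {ℓ} n f → Prime ℓ → Killed n f → n ℕ.< ℓ → + ℓ ∣ Σℤ (λ i → f (+ i)) ℓ
prime∣Σ {suc l} n f pr h (ℕ.s≤s n≤l) = ∣-by-eq (sym (newton-Σ (suc l) n f h))
  (Σ-∣ n λ j j<n → ℤ∣.∣m⇒∣m*n {m = + (suc l C suc j)} (iterΔ j f (+ 0)) (ℤ∣.∣ᵤ⇒∣ (prime∣binomial pr (ℕₚ.<-≤-trans j<n n≤l))))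

module Fermat {ℓ : ℕ} (pr : Prime ℓ) where
  open RingTheory (Z/ (+ ℓ))

  char : ∀ x → ℓ · x ≈ 0#
  char x = ∣⇒≈0 (∣-by-eq (sym (trans (same ℓ x) (·≡* ℓ x))) (ℤ∣.∣m⇒∣m*n x ℤ∣.∣-refl))
    where
    same : ∀ n x → n · x ≡ n Z.· x
    same zero    x = refl
    same (suc n) x = cong (λ z → x ℤ.+ z) (same n x)
  open Frobenius pr char

  fermat : ∀ x → x ^ ℓ ≈ x
  fermat = ℤ-step-ind (λ x → x ^ ℓ ≈ x) 0^q
    (λ c h → ≈trans (^-char-+ c (+ 1)) (+-cong h (1^ ℓ)))
    (λ c h → +-cancelʳ (+ 1) _ _ (≈trans (≈sym (≈trans (^-char-+ c (+ 1)) (+-congˡ {c ^ ℓ} (1^ ℓ)))) h))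

  cancel : ∀ {x y z} → ¬ (+ ℓ ∣ x) → x * y ≈ x * z → y ≈ z
  cancel {x} {y} {z} nx e with prime∣* pr x (y ℤ.- z) (∣-by-eq (a x y z) (≈⇒∣ e))
    where
    a : ∀ x y z → x ℤ.* y ℤ.- x ℤ.* z ≡ x ℤ.* (y ℤ.- z)
    a = solve-∀
  ... | inj₁ d = contradiction d nx
  ... | inj₂ d = ∣⇒≈ d

  fermat-unit : ∀ {n x} → ℓ ≡ suc n → ¬ (+ ℓ ∣ x) → x ^ n ≈ 1#
  fermat-unit {n} {x} refl nx = cancel nx (≈trans (fermat x) (≈sym (*-identityʳ x)))

  inverse : ∀ x → ¬ (+ ℓ ∣ x) → ∃ λ y → + ℓ ∣ (x ℤ.* y ℤ.- + 1)
  inverse x nx = go ℓ refl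
    where
    go : ∀ n → n ≡ ℓ → ∃ λ y → + ℓ ∣ (x ℤ.* y ℤ.- + 1)
    go 0 refl = contradiction (ℕ.nonTrivial⇒n>1 ℓ {{prime⇒nonTrivial pr}}) λ ()
    go 1 refl = contradiction (ℕ.nonTrivial⇒n>1 ℓ {{prime⇒nonTrivial pr}}) λ { (ℕ.s≤s ()) }
    go (suc (suc n)) e = x ^ n , ≈⇒∣ (fermat-unit (sym e) nx)

-- The cubic character modulo a prime

data C₃ : Set where
  c0 c1 c2 : C₃

infixl 7 _⊙_ _⊡_
_⊙_ : C₃ → C₃ → C₃
c0 ⊙ b  = b
c1 ⊙ c0 = c1
c1 ⊙ c1 = c2
c1 ⊙ c2 = c0
c2 ⊙ c0 = c2
c2 ⊙ c1 = c0
c2 ⊙ c2 = c1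

inv : C₃ → C₃
inv c0 = c0
inv c1 = c2
inv c2 = c1

data C₃⁰ : Set where
  nul : C₃⁰
  rt  : C₃ → C₃⁰

_⊡_ : C₃⁰ → C₃⁰ → C₃⁰
nul  ⊡ _    = nul
rt _ ⊡ nul  = nul
rt a ⊡ rt b = rt (a ⊙ b)

emb : C₃ → 𝔼
emb c0 = 1ᴱ
emb c1 = ⟨ + 0 , + 1 ⟩
emb c2 = ⟨ ℤ.-1ℤ , ℤ.-1ℤ ⟩

emb⁰ : C₃⁰ → 𝔼
emb⁰ nul    = 0ᴱ
emb⁰ (rt a) = emb a

opaque
  unfolding _+ᴱ_

  emb-⊙ : ∀ a b → emb (a ⊙ b) ≡ emb a *ᴱ emb b
  emb-⊙ c0 c0 = refl
  emb-⊙ c0 c1 = refl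
  emb-⊙ c0 c2 = refl
  emb-⊙ c1 c0 = refl
  emb-⊙ c1 c1 = refl
  emb-⊙ c1 c2 = refl
  emb-⊙ c2 c0 = refl
  emb-⊙ c2 c1 = refl
  emb-⊙ c2 c2 = refl

  emb⁰-⊡ : ∀ a b → emb⁰ (a ⊡ b) ≡ emb⁰ a *ᴱ emb⁰ b
  emb⁰-⊡ nul     nul     = refl
  emb⁰-⊡ nul     (rt c0) = refl
  emb⁰-⊡ nul     (rt c1) = refl
  emb⁰-⊡ nul     (rt c2) = refl
  emb⁰-⊡ (rt c0) nul     = refl
  emb⁰-⊡ (rt c1) nul     = refl
  emb⁰-⊡ (rt c2) nul     = refl
  emb⁰-⊡ (rt a)  (rt b)  = emb-⊙ a b

  conj-emb : ∀ a → conj (emb a) ≡ emb (inv a)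
  conj-emb c0 = refl
  conj-emb c1 = refl
  conj-emb c2 = refl

⊙-inv : ∀ a → a ⊙ inv a ≡ c0
⊙-inv c0 = refl
⊙-inv c1 = refl
⊙-inv c2 = refl

⊙≡c0⇒inv : ∀ a b → a ⊙ b ≡ c0 → b ≡ inv a
⊙≡c0⇒inv c0 c0 refl = refl
⊙≡c0⇒inv c1 c2 refl = refl
⊙≡c0⇒inv c2 c1 refl = refl

square≡c0 : ∀ a → a ⊙ a ≡ c0 → a ≡ c0
square≡c0 c0 refl = refl

opaque
  unfolding _+ᴱ_

  -- Distinct values of the character differ by an element of norm 1 or 3, hence remain distinct
  -- modulo a prime that does not lie above 3.
  norm-difference : ∀ u v → u ≡ v ⊎ (norm (emb⁰ u +ᴱ -ᴱ emb⁰ v) ≡ + 1 ⊎ norm (emb⁰ u +ᴱ -ᴱ emb⁰ v) ≡ + 3)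
  norm-difference nul     nul     = inj₁ refl
  norm-difference nul     (rt c0) = inj₂ (inj₁ refl)
  norm-difference nul     (rt c1) = inj₂ (inj₁ refl)
  norm-difference nul     (rt c2) = inj₂ (inj₁ refl)
  norm-difference (rt c0) nul     = inj₂ (inj₁ refl)
  norm-difference (rt c1) nul     = inj₂ (inj₁ refl)
  norm-difference (rt c2) nul     = inj₂ (inj₁ refl)
  norm-difference (rt c0) (rt c0) = inj₁ refl
  norm-difference (rt c0) (rt c1) = inj₂ (inj₂ refl)
  norm-difference (rt c0) (rt c2) = inj₂ (inj₂ refl)
  norm-difference (rt c1) (rt c0) = inj₂ (inj₂ refl)
  norm-difference (rt c1) (rt c1) = inj₁ refl
  norm-difference (rt c1) (rt c2) = inj₂ (inj₂ refl)
  norm-difference (rt c2) (rt c0) = inj₂ (inj₂ refl)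
  norm-difference (rt c2) (rt c1) = inj₂ (inj₂ refl)
  norm-difference (rt c2) (rt c2) = inj₁ refl

infixr 8 _^ᴱ_
_^ᴱ_ : 𝔼 → ℕ → 𝔼
x ^ᴱ n = pow _*ᴱ_ 1ᴱ x n

opaque
  unfolding _+ᴱ_

  conj-int : ∀ a → conj (int a) ≡ int a
  conj-int a = cong₂ ⟨_,_⟩ (ℤₚ.+-identityʳ a) refl

  conj-+ : ∀ x y → conj (x +ᴱ y) ≡ conj x +ᴱ conj y
  conj-+ ⟨ a , b ⟩ ⟨ c , d ⟩ = cong₂ ⟨_,_⟩ (f a b c d) (g b d)
    where
    f : ∀ a b c d → a ℤ.+ c ℤ.- (b ℤ.+ d) ≡ a ℤ.- b ℤ.+ (c ℤ.- d)
    f = solve-∀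
    g : ∀ b d → ℤ.- (b ℤ.+ d) ≡ ℤ.- b ℤ.+ ℤ.- d
    g = solve-∀

  conj-* : ∀ x y → conj (x *ᴱ y) ≡ conj x *ᴱ conj y
  conj-* ⟨ a , b ⟩ ⟨ c , d ⟩ = cong₂ ⟨_,_⟩ (f a b c d) (g a b c d)
    where
    f : ∀ a b c d → a ℤ.* c ℤ.- b ℤ.* d ℤ.- (a ℤ.* d ℤ.+ b ℤ.* c ℤ.- b ℤ.* d) ≡ (a ℤ.- b) ℤ.* (c ℤ.- d) ℤ.- (ℤ.- b) ℤ.* (ℤ.- d)
    f = solve-∀
    g : ∀ a b c d → ℤ.- (a ℤ.* d ℤ.+ b ℤ.* c ℤ.- b ℤ.* d) ≡ (a ℤ.- b) ℤ.* (ℤ.- d) ℤ.+ (ℤ.- b) ℤ.* (c ℤ.- d) ℤ.- (ℤ.- b) ℤ.* (ℤ.- d)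
    g = solve-∀

  conj-conj : ∀ x → conj (conj x) ≡ x
  conj-conj ⟨ a , b ⟩ = cong₂ ⟨_,_⟩ (f a b) (ℤₚ.neg-involutive b)
    where
    f : ∀ a b → a ℤ.- b ℤ.- ℤ.- b ≡ a
    f = solve-∀

conj-^ : ∀ x n → conj (x ^ᴱ n) ≡ conj x ^ᴱ n
conj-^ x zero    = conj-int (+ 1)
conj-^ x (suc n) = trans (conj-* x (x ^ᴱ n)) (cong (conj x *ᴱ_) (conj-^ x n))

opaque
  unfolding _+ᴱ_

  *-conj : ∀ x → x *ᴱ conj x ≡ int (norm x)
  *-conj ⟨ a , b ⟩ = cong₂ ⟨_,_⟩ (f a b) (g a b)
    where
    f : ∀ a b → a ℤ.* (a ℤ.- b) ℤ.- b ℤ.* (ℤ.- b) ≡ a ℤ.* a ℤ.- a ℤ.* b ℤ.+ b ℤ.* b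
    f = solve-∀
    g : ∀ a b → a ℤ.* (ℤ.- b) ℤ.+ b ℤ.* (a ℤ.- b) ℤ.- b ℤ.* (ℤ.- b) ≡ + 0
    g = solve-∀

  int-* : ∀ a x → int a *ᴱ x ≡ ⟨ a ℤ.* re x , a ℤ.* im x ⟩
  int-* a ⟨ c , d ⟩ = cong₂ ⟨_,_⟩ (f a c d) (g a c d)
    where
    f : ∀ a c d → a ℤ.* c ℤ.- + 0 ℤ.* d ≡ a ℤ.* c
    f = solve-∀
    g : ∀ a c d → a ℤ.* d ℤ.+ + 0 ℤ.* c ℤ.- + 0 ℤ.* d ≡ a ℤ.* d
    g = solve-∀

int-cancel : ∀ a .{{_ : ℤ.NonZero a}} {x y} → int a *ᴱ x ≡ int a *ᴱ y → x ≡ y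
int-cancel a {x} {y} e = cong₂ ⟨_,_⟩
  (ℤₚ.*-cancelˡ-≡ a (re x) (re y) (cong re e′)) (ℤₚ.*-cancelˡ-≡ a (im x) (im y) (cong im e′))
  where e′ = trans (sym (int-* a x)) (trans e (int-* a y))

infix 4 _≈_[_]
_≈_[_] : 𝔼 → 𝔼 → ℤ → Set
x ≈ y [ q ] = CommutativeRing._≈_ (E/ q) x y

conj-≈ : ∀ {q x y} → x ≈ y [ q ] → conj x ≈ conj y [ q ]
conj-≈ {q} {x} {y} (Quotient.mod k e) = Quotient.mod (conj k)
  (trans (cong conj e) (trans (conj-+ y (k *ᴱ int q)) (cong (conj y +ᴱ_) (trans (conj-* k (int q)) (cong (conj k *ᴱ_) (conj-int q))))))

≡⇒≈ : ∀ {q x y} → x ≡ y → x ≈ y [ q ]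
≡⇒≈ = Quotient.lift 𝔼-ring _

≈0⇒≡ : ∀ {x y} → x ≈ y [ + 0 ] → x ≡ y
≈0⇒≡ {x} {y} (Quotient.mod k e) = trans e (trans (cong (y +ᴱ_) (CommutativeRing.zeroʳ 𝔼-ring k)) (CommutativeRing.+-identityʳ 𝔼-ring y))

opaque
  unfolding _+ᴱ_

  ≈⇒∣∣ : ∀ {q x y} → x ≈ y [ q ] → q ∣ (re x ℤ.- re y) × q ∣ (im x ℤ.- im y)
  ≈⇒∣∣ {q} {x} {y} (Quotient.mod k e) = divides (re k) (trans (cong (λ z → re z ℤ.- re y) e) (f (re y) (re k) (im k) q))
                                       , divides (im k) (trans (cong (λ z → im z ℤ.- im y) e) (g (im y) (re k) (im k) q))
    where
    f : ∀ y k l q → y ℤ.+ (k ℤ.* q ℤ.- l ℤ.* + 0) ℤ.- y ≡ k ℤ.* q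
    f = solve-∀
    g : ∀ y k l q → y ℤ.+ (k ℤ.* + 0 ℤ.+ l ℤ.* q ℤ.- l ℤ.* + 0) ℤ.- y ≡ l ℤ.* q
    g = solve-∀

  ∣∣⇒≈ : ∀ {q x y} → q ∣ (re x ℤ.- re y) → q ∣ (im x ℤ.- im y) → x ≈ y [ q ]
  ∣∣⇒≈ {q} {x} {y} (divides k e) (divides l e′) = Quotient.mod ⟨ k , l ⟩ (cong₂ ⟨_,_⟩
    (trans (a (re x) (re y)) (trans (cong (λ z → re y ℤ.+ z) e) (sym (f (re y) k l q))))
    (trans (a (im x) (im y)) (trans (cong (λ z → im y ℤ.+ z) e′) (sym (g (im y) k l q)))))
    where
    a : ∀ x y → x ≡ y ℤ.+ (x ℤ.- y)
    a = solve-∀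
    f : ∀ y k l q → y ℤ.+ (k ℤ.* q ℤ.- l ℤ.* + 0) ≡ y ℤ.+ k ℤ.* q
    f = solve-∀
    g : ∀ y k l q → y ℤ.+ (k ℤ.* + 0 ℤ.+ l ℤ.* q ℤ.- l ℤ.* + 0) ≡ y ℤ.+ l ℤ.* q
    g = solve-∀

opaque
  unfolding _+ᴱ_

  suc-int* : ∀ n x → x +ᴱ ⟨ + n ℤ.* re x , + n ℤ.* im x ⟩ ≡ ⟨ + suc n ℤ.* re x , + suc n ℤ.* im x ⟩
  suc-int* n x = cong₂ ⟨_,_⟩ (sym (ℤₚ.suc-* (+ n) (re x))) (sym (ℤₚ.suc-* (+ n) (im x)))

E-char : ∀ q x → CommutativeRing._≈_ (E/ (+ q)) (RingTheory._·_ (E/ (+ q)) q x) 0ᴱ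
E-char q x = ∣∣⇒≈ (∣-by-eq (sym (a (cong re (mult q x)))) (ℤ∣.∣m⇒∣m*n (re x) ℤ∣.∣-refl))
                   (∣-by-eq (sym (a (cong im (mult q x)))) (ℤ∣.∣m⇒∣m*n (im x) ℤ∣.∣-refl))
  where
  open RingTheory (E/ (+ q)) using (_·_)
  a : ∀ {x y} → x ≡ y → x ℤ.- + 0 ≡ y
  a {x} e = trans (ℤₚ.+-identityʳ x) e
  mult : ∀ n x → n · x ≡ ⟨ + n ℤ.* re x , + n ℤ.* im x ⟩
  mult zero    x = refl
  mult (suc n) x = trans (cong (x +ᴱ_) (mult n x)) (suc-int* n x)

prime-3 : Prime 3
prime-3 = from-yes (prime? 3)

module CubicCharacter {ℓ : ℕ} (pr : Prime ℓ) (ℓ≢3 : ℓ ≢ 3) (w : ℤ) (w-root : + ℓ ∣ (w ℤ.* w ℤ.+ w ℤ.+ + 1)) where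
  open import Data.Integer using (_+_; _*_; _-_; -_)

  private
    module F = RingTheory (Z/ (+ ℓ))
  open F using () renaming (_≈_ to _≈ℓ_)
  open Fermat pr

  instance
    ℓ-nonZero : ℕ.NonZero ℓ
    ℓ-nonZero = prime⇒nonZero pr

  ℓ∤3 : ¬ (+ ℓ ∣ + 3)
  ℓ∤3 d = ℓ≢3 (prime∣prime pr prime-3 d)

  private
    ℓ∤w : ¬ (+ ℓ ∣ w)
    ℓ∤w d = prime∤1 pr (∣-by-eq (a w) (ℤ∣.∣m∣n⇒∣m-n w-root (ℤ∣.∣n⇒∣m*n (w + + 1) d)))
      where
      a : ∀ w → w * w + w + + 1 - (w + + 1) * w ≡ + 1
      a = solve-∀
    ℓ∤w-1 : ¬ (+ ℓ ∣ (w - + 1))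
    ℓ∤w-1 d = ℓ∤3 (∣-by-eq (a w) (ℤ∣.∣m∣n⇒∣m-n w-root (ℤ∣.∣n⇒∣m*n (w + + 2) d)))
      where
      a : ∀ w → w * w + w + + 1 - (w + + 2) * (w - + 1) ≡ + 3
      a = solve-∀
    w³≈1 : w F.^ 3 ≈ℓ + 1
    w³≈1 = ∣⇒≈ (∣-by-eq (a w) (ℤ∣.∣n⇒∣m*n (w - + 1) w-root))
      where
      a : ∀ w → (w - + 1) * (w * w + w + + 1) ≡ w * (w * (w * + 1)) - + 1
      a = solve-∀
    w³ᵏ≈1 : ∀ k → w F.^ (3 ℕ.* k) ≈ℓ + 1
    w³ᵏ≈1 k = F.≈trans (F.≈sym (F.^-^ w 3 k)) (F.≈trans (F.^-cong k w³≈1) (F.1^ k))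

  private
    split : ∃ λ k → ℓ ≡ suc (3 ℕ.* k)
    split = go (ℓ ℕ.% 3) (ℕ/.m%n<n ℓ 3) (trans (ℕ/.m≡m%n+[m/n]*n ℓ 3) (cong (ℓ ℕ.% 3 ℕ.+_) (ℕₚ.*-comm (ℓ ℕ./ 3) 3)))
      where
      go : ∀ r → r ℕ.< 3 → ℓ ≡ r ℕ.+ 3 ℕ.* (ℓ ℕ./ 3) → ∃ λ k → ℓ ≡ suc (3 ℕ.* k)
      go 0 _ e = contradiction (sym (prime∣prime prime-3 pr (ℤ∣.∣ᵤ⇒∣ (ℕ∣.divides (ℓ ℕ./ 3) (trans e (ℕₚ.*-comm 3 (ℓ ℕ./ 3))))))) ℓ≢3
      go 1 _ e = ℓ ℕ./ 3 , e
      -- For ℓ = 3k + 2 the relation w³ = 1 gives w^ℓ = w² and Fermat gives w^ℓ = w. Then w ≡ 1, and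
      -- w² + w + 1 ≡ 0 becomes ℓ ∣ 3.
      go 2 _ e = contradiction (≈⇒∣ (cancel ℓ∤w w²≈w)) ℓ∤w-1
        where
        k = ℓ ℕ./ 3
        w²≈w : w F.* w ≈ℓ w F.* + 1
        w²≈w = F.≈trans (F.≈sym (F.≈trans (F.^-+ w 2 (3 ℕ.* k)) (F.≈trans (F.*-congˡ {w F.^ 2} (w³ᵏ≈1 k)) (F.reflexive (a w)))))
          (F.≈trans (F.reflexive (cong (w F.^_) (sym e))) (F.≈trans (fermat w) (F.reflexive (sym (ℤₚ.*-identityʳ w)))))
          where
          a : ∀ w → w * (w * + 1) * + 1 ≡ w * w
          a = solve-∀
      go (suc (suc (suc r))) (ℕ.s≤s (ℕ.s≤s (ℕ.s≤s ()))) e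

  abstract
    ℓ≡1mod3 : ∃ λ k → ℓ ≡ suc (3 ℕ.* k)
    ℓ≡1mod3 = split

  k : ℕ
  k = proj₁ ℓ≡1mod3

  ℓ≡ : ℓ ≡ suc (3 ℕ.* k)
  ℓ≡ = proj₂ ℓ≡1mod3

  k>0 : 0 ℕ.< k
  k>0 = go k ℓ≡
    where
    go : ∀ k → ℓ ≡ suc (3 ℕ.* k) → 0 ℕ.< k
    go zero    e = contradiction (subst (1 ℕ.<_) e (ℕ.nonTrivial⇒n>1 ℓ {{prime⇒nonTrivial pr}})) λ { (ℕ.s≤s ()) }
    go (suc k) e = ℕ.s≤s ℕ.z≤n

  -- The degree bound for `prime∣Σ`: x^k (s - x)^k is annihilated by 2k + 1 differences.
  2k+1<ℓ : k ℕ.+ (k ℕ.+ 1) ℕ.< ℓ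
  2k+1<ℓ = subst (k ℕ.+ (k ℕ.+ 1) ℕ.<_) (sym ℓ≡)
    (ℕ.s≤s (ℕₚ.+-monoʳ-≤ k (ℕₚ.+-monoʳ-≤ k (subst (1 ℕ.≤_) (sym (ℕₚ.+-identityʳ k)) k>0))))

  -- Reduction modulo the prime above ℓ that contains ω − w.
  red : 𝔼 → ℤ
  red x = re x + im x * w

  opaque
    unfolding _+ᴱ_

    red-+ : ∀ x y → red (x +ᴱ y) ≡ red x + red y
    red-+ ⟨ a , b ⟩ ⟨ c , d ⟩ = f a b c d w
      where
      f : ∀ a b c d w → a + c + (b + d) * w ≡ a + b * w + (c + d * w)
      f = solve-∀

    red-neg : ∀ x → red (-ᴱ x) ≡ - red x
    red-neg ⟨ a , b ⟩ = f a b w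
      where
      f : ∀ a b w → - a + (- b) * w ≡ - (a + b * w)
      f = solve-∀

    red-* : ∀ x y → red (x *ᴱ y) ≈ℓ red x * red y
    red-* ⟨ a , b ⟩ ⟨ c , d ⟩ = ∣⇒≈ (∣-by-eq (f a b c d w) (ℤ∣.∣n⇒∣m*n (- (b * d)) w-root))
      where
      f : ∀ a b c d w → - (b * d) * (w * w + w + + 1)
        ≡ a * c - b * d + (a * d + b * c - b * d) * w - (a + b * w) * (c + d * w)
      f = solve-∀

  red∣⇒norm∣ : ∀ x → + ℓ ∣ red x → + ℓ ∣ norm x
  red∣⇒norm∣ ⟨ a , b ⟩ d = ∣-by-eq (f a b w)
    (ℤ∣.∣m∣n⇒∣m+n (ℤ∣.∣m⇒∣m*n (a - b - b * w) d) (ℤ∣.∣n⇒∣m*n (b * b) w-root))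
    where
    f : ∀ a b w → (a + b * w) * (a - b - b * w) + b * b * (w * w + w + + 1)
      ≡ a * a - a * b + b * b
    f = solve-∀

  emb⁰-unique : ∀ u v → red (emb⁰ u) ≈ℓ red (emb⁰ v) → u ≡ v
  emb⁰-unique u v e with norm-difference u v
  ... | inj₁ u≡v = u≡v
  ... | inj₂ n = contradiction (red∣⇒norm∣ (emb⁰ u +ᴱ -ᴱ emb⁰ v) (∣-by-eq eq (≈⇒∣ e))) (bad n)
    where
    eq : red (emb⁰ u) - red (emb⁰ v) ≡ red (emb⁰ u +ᴱ -ᴱ emb⁰ v)
    eq = sym (trans (red-+ (emb⁰ u) (-ᴱ emb⁰ v)) (cong (λ z → red (emb⁰ u) + z) (red-neg (emb⁰ v))))
    bad : ∀ {n} → n ≡ + 1 ⊎ n ≡ + 3 → ¬ (+ ℓ ∣ n)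
    bad (inj₁ refl) = prime∤1 pr
    bad (inj₂ refl) = ℓ∤3

  private
    -- For x prime to ℓ the power u = x^k satisfies u³ = 1, and u³ - 1 splits modulo ℓ as (u - 1)(u
    -- - w)(u + 1 + w).
    classify : ∀ x → ∃ λ v → x F.^ k ≈ℓ red (emb⁰ v)
    classify x with + ℓ ∣? x
    ... | yes d = nul , go k k>0
      where
      go : ∀ k → 0 ℕ.< k → x F.^ k ≈ℓ + 0
      go (suc k) _ = ∣⇒≈0 (ℤ∣.∣m⇒∣m*n (x F.^ k) d)
    ... | no n = go (prime∣* pr (u - + 1) ((u - w) * (u + + 1 + w)) total)
      where
      u = x F.^ k
      u³ : u F.^ 3 ≈ℓ + 1
      u³ = F.≈trans (F.^-^ x k 3) (fermat-unit (trans ℓ≡ (cong suc (ℕₚ.*-comm 3 k))) n)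
      a : ∀ u w → u * (u * (u * + 1)) - + 1 - (u - + 1) * (w * w + w + + 1)
        ≡ (u - + 1) * ((u - w) * (u + + 1 + w))
      a = solve-∀
      total : + ℓ ∣ (u - + 1) * ((u - w) * (u + + 1 + w))
      total = ∣-by-eq (a u w) (ℤ∣.∣m∣n⇒∣m-n (≈⇒∣ u³) (ℤ∣.∣n⇒∣m*n (u - + 1) w-root))
      r₁ : ∀ u w → u - w ≡ u - (+ 0 + + 1 * w)
      r₁ = solve-∀
      r₂ : ∀ u w → u + + 1 + w ≡ u - (ℤ.-1ℤ + ℤ.-1ℤ * w)
      r₂ = solve-∀
      go : + ℓ ∣ (u - + 1) ⊎ + ℓ ∣ (u - w) * (u + + 1 + w) → ∃ λ v → u ≈ℓ red (emb⁰ v)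
      go (inj₁ d) = rt c0 , ∣⇒≈ d
      go (inj₂ d) with prime∣* pr (u - w) (u + + 1 + w) d
      ... | inj₁ e = rt c1 , ∣⇒≈ (∣-by-eq (r₁ u w) e)
      ... | inj₂ e = rt c2 , ∣⇒≈ (∣-by-eq (r₂ u w) e)

  abstract
    χ-exists : ∀ x → ∃ λ v → x F.^ k ≈ℓ red (emb⁰ v)
    χ-exists = classify

  χ : ℤ → C₃⁰
  χ x = proj₁ (χ-exists x)

  χ-spec : ∀ x → x F.^ k ≈ℓ red (emb⁰ (χ x))
  χ-spec x = proj₂ (χ-exists x)

  χ-unique : ∀ x v → x F.^ k ≈ℓ red (emb⁰ v) → χ x ≡ v
  χ-unique x v e = emb⁰-unique (χ x) v (F.≈trans (F.≈sym (χ-spec x)) e)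

  χ-cong : ∀ {x y} → x ≈ℓ y → χ x ≡ χ y
  χ-cong {x} {y} e = χ-unique x (χ y) (F.≈trans (F.^-cong k e) (χ-spec y))

  χ-* : ∀ x y → χ (x * y) ≡ χ x ⊡ χ y
  χ-* x y = χ-unique (x * y) (χ x ⊡ χ y) (F.≈trans (F.^-distrib-* x y k) (F.≈trans (F.*-cong (χ-spec x) (χ-spec y))
    (F.≈trans (F.≈sym (red-* (emb⁰ (χ x)) (emb⁰ (χ y)))) (F.reflexive (cong red (sym (emb⁰-⊡ (χ x) (χ y))))))))

  χ-1 : χ (+ 1) ≡ rt c0
  χ-1 = χ-unique (+ 1) (rt c0) (F.1^ k)

  χ-nul : ∀ {x} → + ℓ ∣ x → χ x ≡ nul
  χ-nul {x} d = χ-unique x nul (go k k>0)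
    where
    go : ∀ j → 0 ℕ.< j → x F.^ j ≈ℓ + 0
    go (suc j) _ = ∣⇒≈0 (ℤ∣.∣m⇒∣m*n (x F.^ j) d)

  χ-unit : ∀ {x} → ¬ (+ ℓ ∣ x) → ∃ λ a → χ x ≡ rt a
  χ-unit {x} n with χ x in eq
  ... | rt a = a , refl
  ... | nul  = contradiction (≈0⇒∣ (F.≈trans (χ-spec x) (F.reflexive (cong (λ v → red (emb⁰ v)) eq)))) (pow∤ k)
    where
    pow∤ : ∀ j → ¬ (+ ℓ ∣ x F.^ j)
    pow∤ zero    = prime∤1 pr
    pow∤ (suc j) = prime∤* pr n (pow∤ j)

  -- The value at -1 has square 1 in a group of order 3, so it is trivial.
  χ-neg : ∀ x → χ (- x) ≡ χ x
  χ-neg x = trans (cong χ (sym (ℤₚ.-1*i≡-i x))) (trans (χ-* ℤ.-1ℤ x) (trans (cong (_⊡ χ x) -1≡) (one (χ x))))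
    where
    one : ∀ v → rt c0 ⊡ v ≡ v
    one nul    = refl
    one (rt _) = refl
    root : ∀ v → v ⊡ v ≡ rt c0 → v ≡ rt c0
    root (rt c0) _ = refl
    -1≡ : χ ℤ.-1ℤ ≡ rt c0
    -1≡ = root (χ ℤ.-1ℤ) (trans (sym (χ-* ℤ.-1ℤ ℤ.-1ℤ)) χ-1)

-- Gauss sums

𝔼-acr : AlmostCommutativeRing 0ℓ 0ℓ
𝔼-acr = fromCommutativeRing 𝔼-ring λ { ⟨ + 0 , + 0 ⟩ → just refl ; _ → nothing }

_≟ᴱ0 : ∀ x → x ≡ 0ᴱ ⊎ x ≢ 0ᴱ
⟨ a , b ⟩ ≟ᴱ0 with a ℤ.≟ + 0 | b ℤ.≟ + 0
... | yes refl | yes refl = inj₁ refl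
... | no n     | _        = inj₂ λ e → n (cong re e)
... | _        | no n     = inj₂ λ e → n (cong im e)

opaque
  unfolding _+ᴱ_

  fixed-by-ω : ∀ s → s ≡ emb c1 *ᴱ s → s ≡ 0ᴱ
  fixed-by-ω ⟨ p , r ⟩ e = cong₂ ⟨_,_⟩ (trans e₁ (cong ℤ.-_ r≡0)) r≡0
    where
    f : ∀ p r → + 0 ℤ.* p ℤ.- + 1 ℤ.* r ≡ ℤ.- r
    f = solve-∀
    g : ∀ p r → + 0 ℤ.* r ℤ.+ + 1 ℤ.* p ℤ.- + 1 ℤ.* r ≡ p ℤ.- r
    g = solve-∀
    h : ∀ p r → + 3 ℤ.* r ≡ (r ℤ.- (p ℤ.- r)) ℤ.+ (p ℤ.- ℤ.- r)
    h = solve-∀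
    e₁ : p ≡ ℤ.- r
    e₁ = trans (cong re e) (f p r)
    e₂ : r ≡ p ℤ.- r
    e₂ = trans (cong im e) (g p r)
    r≡0 : r ≡ + 0
    r≡0 = ℤₚ.*-cancelˡ-≡ (+ 3) r (+ 0) (trans (h p r) (cong₂ ℤ._+_ (ℤₚ.i≡j⇒i-j≡0 e₂) (ℤₚ.i≡j⇒i-j≡0 e₁)))

  emb-c2² : emb c2 *ᴱ emb c2 ≡ emb c1
  emb-c2² = refl

fixed-by-root : ∀ a s → a ≢ c0 → s ≡ emb a *ᴱ s → s ≡ 0ᴱ
fixed-by-root c0 s n e = contradiction refl n
fixed-by-root c1 s n e = fixed-by-ω s e
fixed-by-root c2 s n e = fixed-by-ω s (trans e (trans (cong (emb c2 *ᴱ_) e)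
  (trans (sym (*ᴱ-assoc (emb c2) (emb c2) s)) (cong (_*ᴱ s) emb-c2²))))

opaque
  unfolding _+ᴱ_

  [1+y]x : ∀ x y → x +ᴱ y *ᴱ x ≡ (1ᴱ +ᴱ y) *ᴱ x
  [1+y]x = ring-∀ 𝔼-acr

  1+int : ∀ n → 1ᴱ +ᴱ int (+ n) ≡ int (+ suc n)
  1+int n = refl

  [ld-1]y : ∀ l d y → (l *ᴱ d +ᴱ -ᴱ 1ᴱ) *ᴱ y ≡ l *ᴱ (d *ᴱ y) +ᴱ -ᴱ 1ᴱ *ᴱ y
  [ld-1]y = ring-∀ 𝔼-acr

  x-1*0 : ∀ x → x +ᴱ -ᴱ 1ᴱ *ᴱ 0ᴱ ≡ x
  x-1*0 = ring-∀ 𝔼-acr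

  1[x-y]+y : ∀ x y → 1ᴱ *ᴱ (x +ᴱ -ᴱ y) +ᴱ y ≡ x
  1[x-y]+y = ring-∀ 𝔼-acr

  0[x-y]+y : ∀ x y → 0ᴱ *ᴱ (x +ᴱ -ᴱ y) +ᴱ y ≡ y
  0[x-y]+y = ring-∀ 𝔼-acr

  d[-ly]+y : ∀ y l d → d *ᴱ (-ᴱ (l *ᴱ y)) +ᴱ y ≡ (-ᴱ y) *ᴱ (l *ᴱ d +ᴱ -ᴱ 1ᴱ)
  d[-ly]+y = ring-∀ 𝔼-acr

  x+y-y : ∀ x y → x ≡ (x +ᴱ y) +ᴱ -ᴱ y
  x+y-y = ring-∀ 𝔼-acr

∣-sub : ∀ {q x y} → q ∣ x → q ∣ (y ℤ.- x) → q ∣ y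
∣-sub {q} {x} {y} d e = ∣-by-eq (a x y) (ℤ∣.∣m∣n⇒∣m+n d e)
  where
  a : ∀ x y → x ℤ.+ (y ℤ.- x) ≡ y
  a = solve-∀

module GaussSum {ℓ : ℕ} (pr : Prime ℓ) (ℓ≢3 : ℓ ≢ 3) (w : ℤ) (w-root : + ℓ ∣ (w ℤ.* w ℤ.+ w ℤ.+ + 1)) where
  open CubicCharacter pr ℓ≢3 w w-root public
  private module F = RingTheory (Z/ (+ ℓ))

  χᴱ χ̄ᴱ : ℤ → 𝔼
  χᴱ x = emb⁰ (χ x)
  χ̄ᴱ x = conj (χᴱ x)

  χᴱ-* : ∀ x y → χᴱ (x ℤ.* y) ≡ χᴱ x *ᴱ χᴱ y
  χᴱ-* x y = trans (cong emb⁰ (χ-* x y)) (emb⁰-⊡ (χ x) (χ y))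

  χᴱ-periodic : ∀ x → χᴱ (x ℤ.+ + ℓ) ≡ χᴱ x
  χᴱ-periodic x = cong emb⁰ (χ-cong (∣⇒≈ (∣-by-eq (a x (+ ℓ)) ℤ∣.∣-refl)))
    where
    a : ∀ x l → l ≡ x ℤ.+ l ℤ.- x
    a = solve-∀

  unit⇒∤ : ∀ {c c′} → + ℓ ∣ (c ℤ.* c′ ℤ.- + 1) → ¬ (+ ℓ ∣ c)
  unit⇒∤ {c} {c′} i d = prime∤1 pr (∣-by-eq (a (c ℤ.* c′)) (ℤ∣.∣m∣n⇒∣m-n (ℤ∣.∣m⇒∣m*n c′ d) i))
    where
    a : ∀ x → x ℤ.- (x ℤ.- + 1) ≡ + 1
    a = solve-∀

  χ-inverse : ∀ {c c′} → + ℓ ∣ (c ℤ.* c′ ℤ.- + 1) → χᴱ c *ᴱ χᴱ c′ ≡ 1ᴱ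
  χ-inverse {c} {c′} i = trans (sym (χᴱ-* c c′)) (cong emb⁰ (trans (χ-cong (∣⇒≈ i)) χ-1))

  private
    L : ∃ λ n → ℓ ≡ suc n
    L = 3 ℕ.* k , ℓ≡

  -- If χ were trivial, the sum of the k-th powers modulo ℓ would be ℓ − 1 instead of 0.
  χ-nontrivial : ¬ (∀ x → ¬ (+ ℓ ∣ x) → χ x ≡ rt c0)
  χ-nontrivial all = prime∤1 pr (ℓ∣1 (proj₁ L) (proj₂ L))
    where
    f : ℤ → ℤ
    f x = (+ 1 ℤ.* x ℤ.+ + 0) Z.^ k ℤ.* + 1
    killed : Killed (k ℕ.+ 1) f
    killed = Killed-linear-^ k 1 (+ 1) (+ 0) {λ _ → + 1} (λ _ → refl)
    total : + ℓ ∣ Σℤ (λ i → f (+ i)) ℓ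
    total = prime∣Σ (k ℕ.+ 1) f pr killed (ℕₚ.≤-<-trans (ℕₚ.m≤n+m (k ℕ.+ 1) k) 2k+1<ℓ)
    base : ∀ x → (+ 1 ℤ.* x ℤ.+ + 0) ≡ x
    base = solve-∀
    f≈ : ∀ x → F._≈_ (f x) (red (χᴱ x))
    f≈ x = F.≈trans (F.reflexive (trans (ℤₚ.*-identityʳ ((+ 1 ℤ.* x ℤ.+ + 0) Z.^ k)) (cong (Z._^ k) (base x)))) (χ-spec x)
    ℓ∣1 : ∀ n → ℓ ≡ suc n → + ℓ ∣ + 1
    ℓ∣1 n e = ∣-by-eq (trans (cong (λ z → + z ℤ.- + n) e) (b (+ n)))
                (ℤ∣.∣m∣n⇒∣m-n ℤ∣.∣-refl (∣-sub {y = + n} (subst (λ z → + ℓ ∣ Σℤ (λ i → f (+ i)) z) e total) (≈⇒∣ (F.≈sym sum≈))))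
      where
      b : ∀ n → (+ 1 ℤ.+ n) ℤ.- n ≡ + 1
      b = solve-∀
      ones : ∀ m → Σℤ (λ _ → + 1) m ≡ + m
      ones zero = refl
      ones (suc m) = trans (cong (ℤ._+ + 1) (ones m)) (cong +_ (ℕₚ.+-comm m 1))
      sum≈ : F._≈_ (Σℤ (λ i → f (+ i)) (suc n)) (+ n)
      sum≈ = F.≈trans (F.Σ-head n (λ i → f (+ i))) (F.≈trans (F.+-cong
        (F.≈trans (f≈ (+ 0)) (F.reflexive (cong (λ v → red (emb⁰ v)) (χ-nul {+ 0} (divides (+ 0) refl)))))
        (F.Σ-cong< n {λ i → f (+ suc i)} {λ _ → + 1} λ i i<n → F.≈trans (f≈ (+ suc i)) (F.reflexive
          (cong (λ v → red (emb⁰ v)) (all (+ suc i) (∤-small (subst (suc i ℕ.<_) (sym e) (ℕ.s≤s i<n))))))))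
        (F.reflexive (trans (ℤₚ.+-identityˡ _) (ones n))))

  ∑χ : 𝔼
  ∑χ = sum< _+ᴱ_ 0ᴱ ℓ χᴱ

  -- Dilation by a unit x permutes the residues and gives ∑χ = χ(x)∑χ. A non-zero sum would
  -- therefore force χ(x) = 1 for every unit.
  ∑χ≡0 : ∑χ ≡ 0ᴱ
  ∑χ≡0 with ∑χ ≟ᴱ0
  ... | inj₁ e = e
  ... | inj₂ n = contradiction trivial χ-nontrivial
    where
    module P = Periodic 𝔼-ring ℓ
    fix : ∀ {x a} → ¬ (+ ℓ ∣ x) → χ x ≡ rt a → ∑χ ≡ emb a *ᴱ ∑χ
    fix {x} nx e = trans (sym (P.∑-dilate x (proj₁ (Fermat.inverse pr x nx)) (proj₂ (Fermat.inverse pr x nx)) χᴱ-periodic))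
      (trans (P.∑-cong (λ y → trans (χᴱ-* x y) (cong (λ v → emb⁰ v *ᴱ χᴱ y) e))) (P.∑-*ˡ _ χᴱ))
    trivial : ∀ x → ¬ (+ ℓ ∣ x) → χ x ≡ rt c0
    trivial x nx with χ-unit nx
    ... | c0 , e = e
    ... | c1 , e = contradiction (fixed-by-root c1 ∑χ (λ ()) (fix nx e)) n
    ... | c2 , e = contradiction (fixed-by-root c2 ∑χ (λ ()) (fix nx e)) n

  module Modulo (q : ℤ) where
    open RingTheory (E/ q)
    open Periodic (E/ q) ℓ public

    private
      int·≡ : ∀ n x → n · x ≡ int (+ n) *ᴱ x
      int·≡ zero    x = sym (CommutativeRing.zeroˡ 𝔼-ring x)
      int·≡ (suc n) x = trans (cong (x +ᴱ_) (int·≡ n x)) (trans ([1+y]x x (int (+ n))) (cong (_*ᴱ x) (1+int n)))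

    ℓᴱ : 𝔼
    ℓᴱ = int (+ ℓ)

    ∑-const : ∀ c → ∑ (λ _ → c) ≈ ℓᴱ * c
    ∑-const c = ≈trans (∑≈Σ (λ _ → c)) (≈trans (Σ-const ℓ c) (≡⇒≈ (int·≡ ℓ c)))

    -- `g` is the Gauss sum ∑ χ(x)[x], with [1] in the role of a root of unity of order ℓ. `V` is ℓ
    -- times the idempotent that removes the trivial character, and so stands for ℓ.
    g ḡ V : Per
    g = per χᴱ (λ x → ≡⇒≈ (χᴱ-periodic x))
    ḡ = per χ̄ᴱ (λ x → ≡⇒≈ (cong conj (χᴱ-periodic x)))
    V = per (λ x → ℓᴱ * δ x + - 1#) (λ x → +-congʳ (*-congˡ (δ-periodic x)))

    ∑g≈0 : ∑ χᴱ ≈ 0#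
    ∑g≈0 = ≡⇒≈ ∑χ≡0

    V-⊛ : ∀ f → ∑ (at f) ≈ 0# → (V ⊛ f) ≋ (ℓᴱ • f)
    V-⊛ f z = pointwise λ s → begin
      ∑ (λ x → (ℓᴱ * δ x + - 1#) * at f (s ℤ.- x))
        ≈⟨ ∑-cong (λ x → ≡⇒≈ ([ld-1]y ℓᴱ (δ x) (at f (s ℤ.- x)))) ⟩
      ∑ (λ x → ℓᴱ * (δ x * at f (s ℤ.- x)) + - 1# * at f (s ℤ.- x))
        ≈⟨ ∑-+ _ _ ⟩
      ∑ (λ x → ℓᴱ * (δ x * at f (s ℤ.- x))) + ∑ (λ x → - 1# * at f (s ℤ.- x))
        ≈⟨ +-cong (∑-*ˡ ℓᴱ _) (∑-*ˡ (- 1#) _) ⟩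
      ℓᴱ * ∑ (λ x → δ x * at f (s ℤ.- x)) + - 1# * ∑ (λ x → at f (s ℤ.- x))
        ≈⟨ +-cong (*-congˡ (app (⊛-identityˡ f) s)) (*-congˡ (≈trans (∑-flip s (period f)) z)) ⟩
      ℓᴱ * at f s + - 1# * 0#
        ≈⟨ ≡⇒≈ (x-1*0 (ℓᴱ *ᴱ at f s)) ⟩
      ℓᴱ * at f s ∎

    Equivariant : (ℤ → 𝔼) → Per → Set
    Equivariant a f = ∀ c c′ → + ℓ ∣ (c ℤ.* c′ ℤ.- + 1) → ∀ s → at f (c ℤ.* s) ≈ a c * at f s

    g-equivariant : Equivariant χᴱ g
    g-equivariant c c′ i s = ≡⇒≈ (χᴱ-* c s)

    ḡ-equivariant : Equivariant χ̄ᴱ ḡ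
    ḡ-equivariant c c′ i s = ≡⇒≈ (trans (cong conj (χᴱ-* c s)) (conj-* (χᴱ c) (χᴱ s)))

    ⊛-equivariant : ∀ {a b f h} → Equivariant a f → Equivariant b h → Equivariant (λ c → a c *ᴱ b c) (f ⊛ h)
    ⊛-equivariant {a} {b} {f} {h} u v c c′ i s = begin
      ∑ (λ x → at f x * at h (c ℤ.* s ℤ.- x))
        ≈⟨ ∑-dilate c c′ i (periodic-* (period f) (periodic-flip (c ℤ.* s) (period h))) ⟨
      ∑ (λ x → at f (c ℤ.* x) * at h (c ℤ.* s ℤ.- c ℤ.* x))
        ≈⟨ ∑-cong (λ x → *-cong (u c c′ i x) (≈trans (reflexive (cong (at h) (e c s x))) (v c c′ i (s ℤ.- x)))) ⟩
      ∑ (λ x → (a c * at f x) * (b c * at h (s ℤ.- x)))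
        ≈⟨ ∑-cong (λ x → *-interchange _ _ _ _) ⟩
      ∑ (λ x → (a c * b c) * (at f x * at h (s ℤ.- x)))
        ≈⟨ ∑-*ˡ _ _ ⟩
      (a c * b c) * ∑ (λ x → at f x * at h (s ℤ.- x)) ∎
      where
      e : ∀ c s x → c ℤ.* s ℤ.- c ℤ.* x ≡ c ℤ.* (s ℤ.- x)
      e = solve-∀

    ∑-⊛ : ∀ f h → ∑ (at h) ≈ 0# → ∑ (at (f ⊛ h)) ≈ 0#
    ∑-⊛ f h z = begin
      ∑ (λ s → ∑ (λ x → at f x * at h (s ℤ.- x))) ≈⟨ ∑-swap _ ⟩
      ∑ (λ x → ∑ (λ s → at f x * at h (s ℤ.- x))) ≈⟨ ∑-cong (λ x → ∑-*ˡ (at f x) _) ⟩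
      ∑ (λ x → at f x * ∑ (λ s → at h (s ℤ.- x))) ≈⟨ ∑-cong (λ x → *-congˡ (≈trans (∑-shift (ℤ.- x) (period h)) z)) ⟩
      ∑ (λ x → at f x * 0#)                       ≈⟨ ∑-cong (λ x → zeroʳ (at f x)) ⟩
      ∑ (λ x → 0#)                                ≈⟨ ∑-const 0# ⟩
      ℓᴱ * 0#                                     ≈⟨ zeroʳ ℓᴱ ⟩
      0# ∎

    -- Such an f takes a single value f₁ on the units. The vanishing of f₀ + (ℓ - 1)f₁ gives f₀ - f₁
    -- = -ℓf₁, which leaves only multiples of `V`.
    invariant : ∀ f → (∀ c c′ → + ℓ ∣ (c ℤ.* c′ ℤ.- + 1) → at f c ≈ at f (+ 1)) → ∑ (at f) ≈ 0# →
                f ≋ ((- at f (+ 1)) • V)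
    invariant f inv z = pointwise λ s → ≈trans (value s) (≈trans (*+-cong s) (≡⇒≈ (d[-ly]+y f₁ ℓᴱ (δ s))))
      where
      f₀ f₁ : 𝔼
      f₀ = at f (+ 0)
      f₁ = at f (+ 1)
      value : ∀ x → at f x ≈ δ x * (f₀ + - f₁) + f₁
      value x with + ℓ ∣? x
      ... | yes d = ≈trans (periodic-≡ (period f) (∣-by-eq (sym (ℤₚ.+-identityʳ x)) d)) (≡⇒≈ (sym (1[x-y]+y f₀ f₁)))
      ... | no n  = ≈trans (inv x (proj₁ (Fermat.inverse pr x n)) (proj₂ (Fermat.inverse pr x n))) (≡⇒≈ (sym (0[x-y]+y f₀ f₁)))
      diff : f₀ + - f₁ ≈ - (ℓᴱ * f₁)
      diff = begin
        f₀ + - f₁                           ≈⟨ ≡⇒≈ (x+y-y (f₀ +ᴱ -ᴱ f₁) (ℓᴱ *ᴱ f₁)) ⟩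
        ((f₀ + - f₁) + ℓᴱ * f₁) + - (ℓᴱ * f₁)
          ≈⟨ +-congʳ (+-cong (∑-δ (λ _ → f₀ + - f₁)) (∑-const f₁)) ⟨
        (∑ (λ x → δ x * (f₀ + - f₁)) + ∑ (λ _ → f₁)) + - (ℓᴱ * f₁)
          ≈⟨ +-congʳ (∑-+ _ _) ⟨
        ∑ (λ x → δ x * (f₀ + - f₁) + f₁) + - (ℓᴱ * f₁)
          ≈⟨ +-congʳ (≈trans (≈sym (∑-cong value)) z) ⟩
        0# + - (ℓᴱ * f₁) ≈⟨ +-identityˡ _ ⟩
        - (ℓᴱ * f₁) ∎
      *+-cong : ∀ s → δ s * (f₀ + - f₁) + f₁ ≈ δ s * (- (ℓᴱ * f₁)) + f₁
      *+-cong s = +-congʳ (*-congˡ diff)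

    h h̄ : Per
    h = g ⊛ (g ⊛ g)
    h̄ = ḡ ⊛ (ḡ ⊛ ḡ)

-- Jacobi sums

private module E = RingTheory 𝔼-ring

opaque
  unfolding _+ᴱ_

  emb-cube : ∀ a → emb a ^ᴱ 3 ≡ 1ᴱ
  emb-cube c0 = refl
  emb-cube c1 = refl
  emb-cube c2 = refl

  emb-cube′ : ∀ a → emb a *ᴱ (emb a *ᴱ emb a) ≡ 1ᴱ
  emb-cube′ c0 = refl
  emb-cube′ c1 = refl
  emb-cube′ c2 = refl

  emb-square : ∀ a → emb a *ᴱ emb a ≡ conj (emb a)
  emb-square c0 = refl
  emb-square c1 = refl
  emb-square c2 = refl

  emb-norm : ∀ a → emb a *ᴱ conj (emb a) ≡ 1ᴱ
  emb-norm c0 = refl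
  emb-norm c1 = refl
  emb-norm c2 = refl

  conj-neg : ∀ x → conj (-ᴱ x) ≡ -ᴱ conj x
  conj-neg ⟨ a , b ⟩ = cong₂ ⟨_,_⟩ (f a b) refl
    where
    f : ∀ a b → ℤ.- a ℤ.- ℤ.- b ≡ ℤ.- (a ℤ.- b)
    f = solve-∀

  j[lx]≡[lj]x : ∀ j l x → j *ᴱ (l *ᴱ x) ≡ (l *ᴱ j) *ᴱ x
  j[lx]≡[lj]x = ring-∀ 𝔼-acr

  0y≡1+1[-1] : ∀ y → 0ᴱ *ᴱ y ≡ 1ᴱ +ᴱ 1ᴱ *ᴱ (-ᴱ 1ᴱ)
  0y≡1+1[-1] = ring-∀ 𝔼-acr

  1≡1+0y : ∀ y → 1ᴱ ≡ 1ᴱ +ᴱ 0ᴱ *ᴱ y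
  1≡1+0y = ring-∀ 𝔼-acr

  int-suc-1 : ∀ n → int (+ suc n) +ᴱ -ᴱ 1ᴱ ≡ int (+ n)
  int-suc-1 n = refl

  [l-1]t : ∀ l t → (l +ᴱ -ᴱ 1ᴱ) *ᴱ t ≡ t *ᴱ (l *ᴱ 1ᴱ +ᴱ -ᴱ 1ᴱ)
  [l-1]t = ring-∀ 𝔼-acr

  lx≡-x[l[-1]] : ∀ l x → l *ᴱ x ≡ -ᴱ (x *ᴱ (l *ᴱ (-ᴱ 1ᴱ)))
  lx≡-x[l[-1]] = ring-∀ 𝔼-acr

  x≡-x[-1] : ∀ x → x ≡ -ᴱ (x *ᴱ (-ᴱ 1ᴱ))
  x≡-x[-1] = ring-∀ 𝔼-acr

  l0-1 : ∀ l → l *ᴱ 0ᴱ +ᴱ -ᴱ 1ᴱ ≡ -ᴱ 1ᴱ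
  l0-1 = ring-∀ 𝔼-acr

  [xz]y : ∀ x y z → x *ᴱ z *ᴱ y ≡ x *ᴱ y *ᴱ z
  [xz]y = ring-∀ 𝔼-acr

emb-^3m : ∀ a m → emb a ^ᴱ (3 ℕ.* m) ≡ 1ᴱ
emb-^3m a m = trans (sym (E.^-^ (emb a) 3 m)) (trans (cong (_^ᴱ m) (emb-cube a)) (E.1^ m))

emb⁰-^[1+3m] : ∀ v m → emb⁰ v ^ᴱ suc (3 ℕ.* m) ≡ emb⁰ v
emb⁰-^[1+3m] nul    m = E.zeroˡ (0ᴱ ^ᴱ (3 ℕ.* m))
emb⁰-^[1+3m] (rt a) m = trans (cong (emb a *ᴱ_) (emb-^3m a m)) (E.*-identityʳ (emb a))

emb⁰-^[2+3m] : ∀ v m → emb⁰ v ^ᴱ suc (suc (3 ℕ.* m)) ≡ conj (emb⁰ v)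
emb⁰-^[2+3m] nul    m = trans (E.zeroˡ (0ᴱ ^ᴱ suc (3 ℕ.* m))) (sym (conj-int (+ 0)))
emb⁰-^[2+3m] (rt a) m = trans (cong (emb a *ᴱ_) (emb⁰-^[1+3m] (rt a) m)) (emb-square a)

conj-sum< : ∀ n F → conj (sum< _+ᴱ_ 0ᴱ n F) ≡ sum< _+ᴱ_ 0ᴱ n (λ x → conj (F x))
conj-sum< zero    F = conj-int (+ 0)
conj-sum< (suc n) F = trans (conj-+ (sum< _+ᴱ_ 0ᴱ n F) (F (+ n))) (cong (_+ᴱ conj (F (+ n))) (conj-sum< n F))

module JacobiSum {ℓ : ℕ} (pr : Prime ℓ) (ℓ≢3 : ℓ ≢ 3) (w : ℤ) (w-root : + ℓ ∣ (w ℤ.* w ℤ.+ w ℤ.+ + 1)) where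
  open GaussSum pr ℓ≢3 w w-root public
  private
    module F = RingTheory (Z/ (+ ℓ))
    module P = Periodic 𝔼-ring ℓ

  -- By homogeneity of g³ this is the Jacobi sum J(χ, χ).
  J : 𝔼
  J = -ᴱ P.conv χᴱ (P.conv χᴱ χᴱ) (+ 1)

  ℓᴱ : 𝔼
  ℓᴱ = int (+ ℓ)

  private
    χ³ : ∀ {c} → ¬ (+ ℓ ∣ c) → χᴱ c *ᴱ (χᴱ c *ᴱ χᴱ c) ≡ 1ᴱ
    χ³ n with a , e ← χ-unit n = trans (cong (λ v → emb⁰ v *ᴱ (emb⁰ v *ᴱ emb⁰ v)) e) (emb-cube′ a)

    χχ̄ : ∀ {c} → ¬ (+ ℓ ∣ c) → χᴱ c *ᴱ χ̄ᴱ c ≡ 1ᴱ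
    χχ̄ n with a , e ← χ-unit n = trans (cong (λ v → emb⁰ v *ᴱ conj (emb⁰ v)) e) (emb-norm a)

    χᴱ-1 : χᴱ (+ 1) ≡ 1ᴱ
    χᴱ-1 = cong emb⁰ χ-1

    conj-conv : ∀ f g s → conj (P.conv f g s) ≡ P.conv (λ x → conj (f x)) (λ x → conj (g x)) s
    conj-conv f g s = trans (conj-sum< ℓ _) (P.∑-cong λ x → conj-* (f x) (g (s ℤ.- x)))

    conj-J : -ᴱ P.conv χ̄ᴱ (P.conv χ̄ᴱ χ̄ᴱ) (+ 1) ≡ conj J
    conj-J = sym (trans (conj-neg _) (cong -ᴱ_ (trans (conj-conv χᴱ (P.conv χᴱ χᴱ) (+ 1))
      (P.∑-cong λ x → cong (χ̄ᴱ x *ᴱ_) (conj-conv χᴱ χᴱ (+ 1 ℤ.- x))))))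

  module Mod (q : ℤ) where
    open RingTheory (E/ q)
    open Modulo q hiding (ℓᴱ) public

    private
      c*1 : ∀ f c → at f c ≈ at f (c ℤ.* + 1)
      c*1 f c = reflexive (cong (at f) (sym (ℤₚ.*-identityʳ c)))

    ∑ḡ≈0 : ∑ χ̄ᴱ ≈ 0#
    ∑ḡ≈0 = ≡⇒≈ (trans (sym (conj-sum< ℓ χᴱ)) (trans (cong conj ∑χ≡0) (conj-int (+ 0))))

    -- Dilation by c multiplies g³ by χ(c)³ = 1, so `invariant` applies, and the scalar it produces
    -- is J by definition.
    h≋ : h ≋ (J • V)
    h≋ = invariant h
      (λ c c′ i → ≈trans (c*1 h c) (≈trans
        (⊛-equivariant {f = g} {g ⊛ g} g-equivariant (⊛-equivariant {f = g} {g} g-equivariant g-equivariant) c c′ i (+ 1))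
        (≈trans (*-congʳ (≡⇒≈ (χ³ {c} (unit⇒∤ {c} {c′} i)))) (*-identityˡ _))))
      (∑-⊛ g (g ⊛ g) (∑-⊛ g g ∑g≈0))

    h̄≋ : h̄ ≋ (conj J • V)
    h̄≋ = ≋-trans (invariant h̄
      (λ c c′ i → ≈trans (c*1 h̄ c) (≈trans
        (⊛-equivariant {f = ḡ} {ḡ ⊛ ḡ} ḡ-equivariant (⊛-equivariant {f = ḡ} {ḡ} ḡ-equivariant ḡ-equivariant) c c′ i (+ 1))
        (≈trans (*-congʳ (≡⇒≈ (trans (sym (conj³ (χᴱ c))) (trans (cong conj (χ³ {c} (unit⇒∤ {c} {c′} i))) (conj-int (+ 1)))))) (*-identityˡ _))))
      (∑-⊛ ḡ (ḡ ⊛ ḡ) (∑-⊛ ḡ ḡ ∑ḡ≈0))) (pointwise λ s → *-congʳ (≡⇒≈ conj-J))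
      where
      conj³ : ∀ x → conj (x *ᴱ (x *ᴱ x)) ≡ conj x *ᴱ (conj x *ᴱ conj x)
      conj³ x = trans (conj-* x (x *ᴱ x)) (cong (conj x *ᴱ_) (conj-* x x))

    gḡ≋ : (g ⊛ ḡ) ≋ ((- at (g ⊛ ḡ) (+ 1)) • V)
    gḡ≋ = invariant (g ⊛ ḡ)
      (λ c c′ i → ≈trans (c*1 (g ⊛ ḡ) c) (≈trans (⊛-equivariant {χᴱ} {χ̄ᴱ} {g} {ḡ} g-equivariant ḡ-equivariant c c′ i (+ 1))
        (≈trans (*-congʳ (≡⇒≈ (χχ̄ {c} (unit⇒∤ {c} {c′} i)))) (*-identityˡ _))))
      (∑-⊛ g ḡ ∑ḡ≈0)

    V₁ : at V (+ 1) ≈ - 1#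
    V₁ = ≈trans (+-congʳ (*-congˡ {ℓᴱ} (δ-no {+ 1} (prime∤1 pr)))) (≡⇒≈ (l0-1 ℓᴱ))

    ⊛-• : ∀ c f f′ → (f ⊛ (c • f′)) ≋ (c • (f ⊛ f′))
    ⊛-• c f f′ = ≋-trans (⊛-comm f (c • f′)) (≋-trans (•-⊛ c f′ f) (pointwise λ s → *-congˡ (app (⊛-comm f′ f) s)))

    h⊛g : (h ⊛ g) ≋ ((ℓᴱ * J) • g)
    h⊛g = ≋-trans (⊛-cong {u = g} {g} h≋ (G.≈refl {g})) (≋-trans (•-⊛ J V g) (pointwise λ s →
      ≈trans (*-congˡ (app (V-⊛ g ∑g≈0) s)) (≡⇒≈ (j[lx]≡[lj]x J ℓᴱ (χᴱ s)))))

    -- g³ = JV acts on `g` as the scalar ℓJ. Multiplying powers of g³ by one more `g` thus turns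
    -- them into scalars, ready for comparison with the Frobenius map.
    h^⊛g : ∀ m → ((h G.^ m) ⊛ g) ≋ ((ℓᴱ * J) ^ m • g)
    h^⊛g zero    = ≋-trans (⊛-identityˡ g) (pointwise λ s → ≈sym (*-identityˡ _))
    h^⊛g (suc m) = ≋-trans (⊛-assoc h (h G.^ m) g) (≋-trans (⊛-cong {h} {h} (G.≈refl {h}) (h^⊛g m))
      (≋-trans (⊛-• ((ℓᴱ * J) ^ m) h g) (pointwise λ s →
        ≈trans (*-congˡ (app h⊛g s)) (≡⇒≈ (j[lx]≡[lj]x ((ℓᴱ * J) ^ m) (ℓᴱ * J) (χᴱ s))))))

    g³≋h : (g G.^ 3) ≋ h
    g³≋h = G.*-congˡ {g} (G.*-congˡ {g} (G.*-identityʳ g))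

    g^3m≋ : ∀ m → (g G.^ (3 ℕ.* m)) ≋ (h G.^ m)
    g^3m≋ m = G.≈trans (G.≈sym (G.^-^ g 3 m)) (G.^-cong m g³≋h)

  private
    -- Modulus 0 makes congruence an equality, so the scalar relating gḡ to `V` can be found in ℤ[ω]
    -- itself, where ℓ - 1 may be cancelled.
    module M₀ = Mod (+ 0)

    count : M₀.at (M₀.g M₀.⊛ M₀.ḡ) (+ 0) ≡ ℓᴱ +ᴱ -ᴱ 1ᴱ
    count = ≈0⇒≡ (begin
      ∑ (λ x → χᴱ x * χ̄ᴱ (+ 0 ℤ.- x))   ≈⟨ ∑-cong term ⟩
      ∑ (λ x → 1# + δ x * (- 1#))       ≈⟨ ∑-+ _ _ ⟩
      ∑ (λ x → 1#) + ∑ (λ x → δ x * (- 1#)) ≈⟨ +-cong (∑-const 1#) (∑-δ (λ _ → - 1#)) ⟩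
      ℓᴱ * 1# + - 1#                    ≈⟨ +-congʳ (*-identityʳ ℓᴱ) ⟩
      ℓᴱ + - 1#                         ∎)
      where
      open M₀
      open RingTheory (E/ (+ 0))
      neg : ∀ x → χᴱ (+ 0 ℤ.- x) ≡ χᴱ x
      neg x = cong emb⁰ (trans (cong χ (ℤₚ.+-identityˡ (ℤ.- x))) (χ-neg x))
      term : ∀ x → χᴱ x * χ̄ᴱ (+ 0 ℤ.- x) ≈ 1# + δ x * (- 1#)
      term x with + ℓ ∣? x
      ... | yes d = ≡⇒≈ (trans (cong (λ v → emb⁰ v *ᴱ χ̄ᴱ (+ 0 ℤ.- x)) (χ-nul d)) (0y≡1+1[-1] _))
      ... | no n  = ≡⇒≈ (trans (cong (λ v → χᴱ x *ᴱ conj v) (neg x)) (trans (χχ̄ n) (1≡1+0y _)))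

    ℓ-1 : ℤ
    ℓ-1 = + (3 ℕ.* k)

    instance
      ℓ-1-nonZero : ℤ.NonZero ℓ-1
      ℓ-1-nonZero = go k k>0
        where
        go : ∀ k → 0 ℕ.< k → ℤ.NonZero (+ (3 ℕ.* k))
        go (suc k) _ = _

    ℓᴱ-1 : ℓᴱ +ᴱ -ᴱ 1ᴱ ≡ int ℓ-1
    ℓᴱ-1 = trans (cong (λ n → int (+ n) +ᴱ -ᴱ 1ᴱ) ℓ≡) (int-suc-1 (3 ℕ.* k))

    -- Evaluation at 0: there `V` is ℓ - 1 and gḡ counts the ℓ - 1 units, so (ℓ - 1)t = ℓ - 1.
    gḡ₁ : -ᴱ M₀.at (M₀.g M₀.⊛ M₀.ḡ) (+ 1) ≡ 1ᴱ
    gḡ₁ = int-cancel ℓ-1 (begin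
      int ℓ-1 *ᴱ t                          ≡⟨ cong (_*ᴱ t) ℓᴱ-1 ⟨
      (ℓᴱ +ᴱ -ᴱ 1ᴱ) *ᴱ t                    ≡⟨ [l-1]t ℓᴱ t ⟩
      t *ᴱ (ℓᴱ *ᴱ 1ᴱ +ᴱ -ᴱ 1ᴱ)              ≡⟨ cong (λ z → t *ᴱ (ℓᴱ *ᴱ z +ᴱ -ᴱ 1ᴱ)) (≈0⇒≡ (M₀.δ-yes {+ 0} (divides (+ 0) refl))) ⟨
      t *ᴱ (ℓᴱ *ᴱ M₀.δ (+ 0) +ᴱ -ᴱ 1ᴱ)      ≡⟨ ≈0⇒≡ (M₀.app M₀.gḡ≋ (+ 0)) ⟨
      M₀.at (M₀.g M₀.⊛ M₀.ḡ) (+ 0)          ≡⟨ count ⟩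
      ℓᴱ +ᴱ -ᴱ 1ᴱ                           ≡⟨ ℓᴱ-1 ⟩
      int ℓ-1                               ≡⟨ E.*-identityʳ (int ℓ-1) ⟨
      int ℓ-1 *ᴱ 1ᴱ                         ∎)
      where
      open ≡.≡-Reasoning
      t : 𝔼
      t = -ᴱ M₀.at (M₀.g M₀.⊛ M₀.ḡ) (+ 1)

  -- The counterpart of |g|² = ℓ. The scalar was computed exactly, hence it is 1 for every modulus
  -- q.
  gḡ≋V : ∀ q → let open Mod q in (g ⊛ ḡ) ≋ V
  gḡ≋V q = ≋-trans gḡ≋ (pointwise λ s → ≈trans (*-congʳ (≡⇒≈ gḡ₁)) (*-identityˡ _))
    where
    open Mod q
    open RingTheory (E/ q)

  -- Comparing (g ḡ)³ = V³ = ℓ² V with g³ ḡ³ = J J̄ V² = ℓ J J̄ V.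
  J-norm : J *ᴱ conj J ≡ ℓᴱ
  J-norm = int-cancel (+ ℓ) (trans (lx≡-x[l[-1]] ℓᴱ (J *ᴱ conj J)) (trans (cong -ᴱ_ (≈0⇒≡ values)) (sym (lx≡-x[l[-1]] ℓᴱ ℓᴱ))))
    where
    open Mod (+ 0)
    open RingTheory (E/ (+ 0)) hiding (_^_)
    instance
      _ : ℤ.NonZero (+ ℓ)
      _ = subst (λ n → ℤ.NonZero (+ n)) (sym ℓ≡) _
    ∑V : ∑ (at V) ≈ 0#
    ∑V = ≈trans (∑-cong λ x → ≈sym (app (gḡ≋V (+ 0)) x)) (∑-⊛ g ḡ ∑ḡ≈0)
    hh̄ : (h ⊛ h̄) ≋ ((J * conj J) • (V ⊛ V))
    hh̄ = ≋-trans (⊛-cong h≋ h̄≋) (≋-trans (•-⊛ J V (conj J • V)) (pointwise λ s →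
      ≈trans (*-congˡ (app (⊛-• (conj J) V V) s)) (≈sym (*-assoc _ _ _))))
    regroup : (h ⊛ h̄) ≋ ((g ⊛ ḡ) ⊛ ((g ⊛ ḡ) ⊛ (g ⊛ ḡ)))
    regroup = G.≈trans (G.*-interchange g (g ⊛ g) ḡ (ḡ ⊛ ḡ)) (G.*-congˡ {g ⊛ ḡ} (G.*-interchange g g ḡ ḡ))
    VVV : (h ⊛ h̄) ≋ (V ⊛ (V ⊛ V))
    VVV = ≋-trans regroup (⊛-cong (gḡ≋V (+ 0)) (⊛-cong (gḡ≋V (+ 0)) (gḡ≋V (+ 0))))
    VV₁ : at (V ⊛ V) (+ 1) ≈ ℓᴱ * (- 1#)
    VV₁ = ≈trans (app (V-⊛ V ∑V) (+ 1)) (*-congˡ {ℓᴱ} V₁)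
    VVV₁ : at (V ⊛ (V ⊛ V)) (+ 1) ≈ ℓᴱ * (ℓᴱ * (- 1#))
    VVV₁ = ≈trans (app (V-⊛ (V ⊛ V) (∑-⊛ V V ∑V)) (+ 1)) (*-congˡ {ℓᴱ} VV₁)
    values : (J * conj J) * (ℓᴱ * (- 1#)) ≈ ℓᴱ * (ℓᴱ * (- 1#))
    values = ≈trans (≈sym (≈trans (app hh̄ (+ 1)) (*-congˡ VV₁))) (≈trans (app VVV (+ 1)) VVV₁)

  module _ {q : ℕ} (qr : Prime q) (q≢ℓ : q ≢ ℓ) where
    open Mod (+ q)
    open RingTheory (E/ (+ q))

    private
      ℓ∤q : ¬ (+ ℓ ∣ + q)
      ℓ∤q d = q≢ℓ (sym (prime∣prime pr qr d))
      q′ : ℤ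
      q′ = proj₁ (Fermat.inverse pr (+ q) ℓ∤q)
      i : + ℓ ∣ (+ q ℤ.* q′ ℤ.- + 1)
      i = proj₂ (Fermat.inverse pr (+ q) ℓ∤q)
      frob : ∀ s → at (g G.^ q) s ≈ χᴱ (q′ ℤ.* s) ^ q
      frob s = frobenius qr (E-char q) q′ i g s

      χq′ : χᴱ q′ ≡ χ̄ᴱ (+ q)
      χq′ = trans (sym (E.*-identityˡ (χᴱ q′))) (trans (cong (_*ᴱ χᴱ q′) (sym (χχ̄ ℓ∤q)))
          (trans ([xz]y (χᴱ (+ q)) (χᴱ q′) (χ̄ᴱ (+ q))) (trans (cong (_*ᴱ χ̄ᴱ (+ q)) (χ-inverse i)) (E.*-identityˡ (χ̄ᴱ (+ q))))))

    -- The coefficient of g^q at 1 in two ways: g^(3m+1) = (ℓJ)^m g on one side, and χ(q′)^q = χ(q′)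
    -- = χ̄(q) from the Frobenius map on the other.
    J-power₁ : ∀ m → q ≡ suc (3 ℕ.* m) → (ℓᴱ *ᴱ J) ^ᴱ m ≈ χ̄ᴱ (+ q) [ + q ]
    J-power₁ m e = begin
      (ℓᴱ * J) ^ m                   ≈⟨ *-identityʳ _ ⟨
      (ℓᴱ * J) ^ m * 1#              ≈⟨ *-congˡ (≡⇒≈ χᴱ-1) ⟨
      (ℓᴱ * J) ^ m * χᴱ (+ 1)        ≈⟨ app (h^⊛g m) (+ 1) ⟨
      at ((h G.^ m) ⊛ g) (+ 1)       ≈⟨ app (⊛-comm (h G.^ m) g) (+ 1) ⟩
      at (g ⊛ (h G.^ m)) (+ 1)       ≈⟨ app (G.*-congˡ {g} (g^3m≋ m)) (+ 1) ⟨
      at (g G.^ suc (3 ℕ.* m)) (+ 1) ≡⟨ cong (λ n → at (g G.^ n) (+ 1)) (sym e) ⟩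
      at (g G.^ q) (+ 1)             ≈⟨ frob (+ 1) ⟩
      χᴱ (q′ ℤ.* + 1) ^ q            ≡⟨ cong₂ _^_ (cong χᴱ (ℤₚ.*-identityʳ q′)) e ⟩
      χᴱ q′ ^ suc (3 ℕ.* m)          ≈⟨ ≡⇒≈ (trans (emb⁰-^[1+3m] (χ q′) m) χq′) ⟩
      χ̄ᴱ (+ q)                       ∎

    -- Here q + 1 = 3(m + 1) and the Frobenius map gives g^q = χ(q)ḡ, so g^(3(m+1)) = χ(q)gḡ =
    -- χ(q)V. One more factor `g` makes `V` act as ℓ.
    J-power₂ : ∀ m → q ≡ suc (suc (3 ℕ.* m)) → (ℓᴱ *ᴱ J) ^ᴱ suc m ≈ χᴱ (+ q) *ᴱ ℓᴱ [ + q ]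
    J-power₂ m e = begin
      (ℓᴱ * J) ^ suc m                   ≈⟨ *-identityʳ _ ⟨
      (ℓᴱ * J) ^ suc m * 1#              ≈⟨ *-congˡ (≡⇒≈ χᴱ-1) ⟨
      (ℓᴱ * J) ^ suc m * χᴱ (+ 1)        ≈⟨ app (h^⊛g (suc m)) (+ 1) ⟨
      at ((h G.^ suc m) ⊛ g) (+ 1)       ≈⟨ app (⊛-cong {u = g} {g} (g^3m≋ (suc m)) (G.≈refl {g})) (+ 1) ⟨
      at ((g G.^ (3 ℕ.* suc m)) ⊛ g) (+ 1) ≡⟨ cong (λ n → at ((g G.^ n) ⊛ g) (+ 1)) eq ⟩
      at ((g ⊛ (g G.^ q)) ⊛ g) (+ 1)     ≈⟨ app (⊛-cong {u = g} {g} (⊛-cong {g} {g} (G.≈refl {g}) g^q) (G.≈refl {g})) (+ 1) ⟩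
      at ((g ⊛ (χᴱ (+ q) • ḡ)) ⊛ g) (+ 1) ≈⟨ app (⊛-cong {u = g} {g} (⊛-• (χᴱ (+ q)) g ḡ) (G.≈refl {g})) (+ 1) ⟩
      at ((χᴱ (+ q) • (g ⊛ ḡ)) ⊛ g) (+ 1) ≈⟨ app (•-⊛ (χᴱ (+ q)) (g ⊛ ḡ) g) (+ 1) ⟩
      χᴱ (+ q) * at ((g ⊛ ḡ) ⊛ g) (+ 1)  ≈⟨ *-congˡ (app (⊛-cong {u = g} {g} (gḡ≋V (+ q)) (G.≈refl {g})) (+ 1)) ⟩
      χᴱ (+ q) * at (V ⊛ g) (+ 1)        ≈⟨ *-congˡ (app (V-⊛ g ∑g≈0) (+ 1)) ⟩
      χᴱ (+ q) * (ℓᴱ * χᴱ (+ 1))         ≈⟨ *-congˡ (*-congˡ (≡⇒≈ χᴱ-1)) ⟩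
      χᴱ (+ q) * (ℓᴱ * 1#)               ≈⟨ *-congˡ (*-identityʳ ℓᴱ) ⟩
      χᴱ (+ q) * ℓᴱ                      ∎
      where
      eq : 3 ℕ.* suc m ≡ suc q
      eq = trans (ℕₚ.*-suc 3 m) (cong suc (sym e))
      g^q : (g G.^ q) ≋ (χᴱ (+ q) • ḡ)
      g^q = pointwise λ s → ≈trans (frob s) (≡⇒≈ (conjugate s))
        where
        conjugate : ∀ s → χᴱ (q′ ℤ.* s) ^ᴱ q ≡ χᴱ (+ q) *ᴱ χ̄ᴱ s
        conjugate s = trans (cong (χᴱ (q′ ℤ.* s) ^ᴱ_) e) (trans (emb⁰-^[2+3m] (χ (q′ ℤ.* s)) m)
          (trans (cong conj (χᴱ-* q′ s)) (trans (conj-* (χᴱ q′) (χᴱ s))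
            (cong (_*ᴱ χ̄ᴱ s) (trans (cong conj χq′) (conj-conj (χᴱ (+ q))))))))

  -- The Frobenius map modulo 3 gives the coefficient χ(3′)³ = 1 of g³ at 1, with 3′ inverse to 3
  -- modulo ℓ; J is minus this coefficient.
  J-primary : J ≈ -ᴱ 1ᴱ [ + 3 ]
  J-primary = begin
    J                     ≈⟨ ≡⇒≈ (x≡-x[-1] J) ⟩
    - (J * (- 1#))        ≈⟨ -‿cong (*-congˡ V₁) ⟨
    - (J * at V (+ 1))    ≈⟨ -‿cong (app h≋ (+ 1)) ⟨
    - at h (+ 1)          ≈⟨ -‿cong (app g³≋h (+ 1)) ⟨
    - at (g G.^ 3) (+ 1)  ≈⟨ -‿cong (frobenius prime-3 (E-char 3) 3′ i g (+ 1)) ⟩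
    - (χᴱ (3′ ℤ.* + 1) ^ 3) ≈⟨ -‿cong (≡⇒≈ (trans (cong (λ x → χᴱ x *ᴱ (χᴱ x *ᴱ (χᴱ x *ᴱ 1ᴱ))) (ℤₚ.*-identityʳ 3′))
                               (trans (cong (λ z → χᴱ 3′ *ᴱ (χᴱ 3′ *ᴱ z)) (E.*-identityʳ (χᴱ 3′))) (χ³ (unit⇒∤ {3′} {+ 3} (subst (λ z → + ℓ ∣ z ℤ.- + 1) (ℤₚ.*-comm (+ 3) 3′) i)))))) ⟩
    - 1#                  ∎
    where
    open Mod (+ 3)
    open RingTheory (E/ (+ 3))
    3′ : ℤ
    3′ = proj₁ (Fermat.inverse pr (+ 3) ℓ∤3)
    i : + ℓ ∣ (+ 3 ℤ.* 3′ ℤ.- + 1)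
    i = proj₂ (Fermat.inverse pr (+ 3) ℓ∤3)

  private
    red-sum : ∀ n G → red (sum< _+ᴱ_ 0ᴱ n G) ≡ Σℤ (λ i → red (G (+ i))) n
    red-sum zero    G = refl
    red-sum (suc n) G = trans (red-+ (sum< _+ᴱ_ 0ᴱ n G) (G (+ n))) (cong (ℤ._+ red (G (+ n))) (red-sum n G))

  -- Modulo the prime containing ω - w the convolution is ∑ x^k (s - x)^k, a full sum of a
  -- polynomial of degree 2k < ℓ - 1.
  red-gg : ∀ s → + ℓ ∣ red (P.conv χᴱ χᴱ s)
  red-gg s = ∣-by-eq (sym (red-sum ℓ _)) (∣-sub total (≈⇒∣ (F.Σ-cong ℓ term)))
    where
    f : ℤ → ℤ
    f x = (+ 1 ℤ.* x ℤ.+ + 0) Z.^ k ℤ.* ((ℤ.-1ℤ ℤ.* x ℤ.+ s) Z.^ k ℤ.* + 1)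
    total : + ℓ ∣ Σℤ (λ i → f (+ i)) ℓ
    total = prime∣Σ (k ℕ.+ (k ℕ.+ 1)) f pr
      (Killed-linear-^ k (k ℕ.+ 1) (+ 1) (+ 0) {λ x → (ℤ.-1ℤ ℤ.* x ℤ.+ s) Z.^ k ℤ.* + 1}
        (Killed-linear-^ k 1 ℤ.-1ℤ s {λ _ → + 1} (λ _ → refl))) 2k+1<ℓ
    b₁ : ∀ x → + 1 ℤ.* x ℤ.+ + 0 ≡ x
    b₁ = solve-∀
    b₂ : ∀ x s → ℤ.-1ℤ ℤ.* x ℤ.+ s ≡ s ℤ.- x
    b₂ = solve-∀
    term : ∀ i → F._≈_ (red (χᴱ (+ i) *ᴱ χᴱ (s ℤ.- + i))) (f (+ i))
    term i = F.≈trans (red-* (χᴱ (+ i)) (χᴱ (s ℤ.- + i))) (F.≈trans (F.*-cong (F.≈sym (χ-spec (+ i))) (F.≈sym (χ-spec (s ℤ.- + i))))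
      (F.reflexive (sym (cong₂ ℤ._*_ (cong (Z._^ k) (b₁ (+ i))) (trans (ℤₚ.*-identityʳ ((ℤ.-1ℤ ℤ.* + i ℤ.+ s) Z.^ k)) (cong (Z._^ k) (b₂ (+ i) s)))))))

  -- Decides which of the two conjugate primes above ℓ contains J: the one with ω ≡ w. Every term of
  -- g³ at 1 has a value of g² as a factor.
  red-J : + ℓ ∣ red J
  red-J = ∣-by-eq (sym (red-neg (P.conv χᴱ (P.conv χᴱ χᴱ) (+ 1)))) (ℤ∣.∣m⇒∣-m (∣-by-eq (sym (red-sum ℓ _))
    (Σ-∣ ℓ λ i _ → ∣-sub (ℤ∣.∣n⇒∣m*n (red (χᴱ (+ i))) (red-gg (+ 1 ℤ.- + i)))
                      (≈⇒∣ (red-* (χᴱ (+ i)) (P.conv χᴱ χᴱ (+ 1 ℤ.- + i)))))))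

-- Cubic residue symbols modulo rational primes

⊙-idem : ∀ a → a ≡ a ⊙ a → a ≡ c0
⊙-idem c0 _ = refl

inv-⊙ : ∀ a b → inv (a ⊙ b) ≡ inv a ⊙ inv b
inv-⊙ c0 b  = refl
inv-⊙ c1 c0 = refl
inv-⊙ c1 c1 = refl
inv-⊙ c1 c2 = refl
inv-⊙ c2 c0 = refl
inv-⊙ c2 c1 = refl
inv-⊙ c2 c2 = refl

inv-inv : ∀ a → inv (inv a) ≡ a
inv-inv c0 = refl
inv-inv c1 = refl
inv-inv c2 = refl

opaque
  unfolding _+ᴱ_

  norm-* : ∀ x y → norm (x *ᴱ y) ≡ norm x ℤ.* norm y
  norm-* ⟨ a , b ⟩ ⟨ c , d ⟩ = f a b c d
    where
    f : ∀ a b c d → (a ℤ.* c ℤ.- b ℤ.* d) ℤ.* (a ℤ.* c ℤ.- b ℤ.* d) ℤ.- (a ℤ.* c ℤ.- b ℤ.* d) ℤ.* (a ℤ.* d ℤ.+ b ℤ.* c ℤ.- b ℤ.* d)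
          ℤ.+ (a ℤ.* d ℤ.+ b ℤ.* c ℤ.- b ℤ.* d) ℤ.* (a ℤ.* d ℤ.+ b ℤ.* c ℤ.- b ℤ.* d)
      ≡ (a ℤ.* a ℤ.- a ℤ.* b ℤ.+ b ℤ.* b) ℤ.* (c ℤ.* c ℤ.- c ℤ.* d ℤ.+ d ℤ.* d)
    f = solve-∀

  norm-conj : ∀ x → norm (conj x) ≡ norm x
  norm-conj ⟨ a , b ⟩ = f a b
    where
    f : ∀ a b → (a ℤ.- b) ℤ.* (a ℤ.- b) ℤ.- (a ℤ.- b) ℤ.* (ℤ.- b) ℤ.+ (ℤ.- b) ℤ.* (ℤ.- b) ≡ a ℤ.* a ℤ.- a ℤ.* b ℤ.+ b ℤ.* b
    f = solve-∀

  ∣-*ᴱ : ∀ {q} x y → q ∣ re x → q ∣ im x → q ∣ re (x *ᴱ y) × q ∣ im (x *ᴱ y)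
  ∣-*ᴱ ⟨ a , b ⟩ ⟨ c , d ⟩ p r =
      ℤ∣.∣m∣n⇒∣m-n (ℤ∣.∣m⇒∣m*n c p) (ℤ∣.∣m⇒∣m*n d r)
    , ℤ∣.∣m∣n⇒∣m-n (ℤ∣.∣m∣n⇒∣m+n (ℤ∣.∣m⇒∣m*n d p) (ℤ∣.∣m⇒∣m*n c r)) (ℤ∣.∣m⇒∣m*n d r)

  im-neg : ∀ x → im (-ᴱ x) ≡ ℤ.- im x
  im-neg x = refl

norm-int : ∀ a → norm (int a) ≡ a ℤ.* a
norm-int = f
  where
  f : ∀ a → a ℤ.* a ℤ.- a ℤ.* + 0 ℤ.+ + 0 ℤ.* + 0 ≡ a ℤ.* a
  f = solve-∀

emb-injective : ∀ {q} → Prime q → ∀ u v → emb u ≈ emb v [ + q ] → u ≡ v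
emb-injective pr c0 c0 e = refl
emb-injective pr c0 c1 e = contradiction (proj₁ (≈⇒∣∣ e)) (prime∤1 pr)
emb-injective pr c0 c2 e = contradiction (proj₂ (≈⇒∣∣ e)) (prime∤1 pr)
emb-injective pr c1 c0 e = contradiction (proj₂ (≈⇒∣∣ e)) (prime∤1 pr)
emb-injective pr c1 c1 e = refl
emb-injective pr c1 c2 e = contradiction (proj₁ (≈⇒∣∣ e)) (prime∤1 pr)
emb-injective pr c2 c0 e = contradiction (ℤ∣.∣m⇒∣-m (proj₂ (≈⇒∣∣ e))) (prime∤1 pr)
emb-injective pr c2 c1 e = contradiction (ℤ∣.∣m⇒∣-m (proj₁ (≈⇒∣∣ e))) (prime∤1 pr)
emb-injective pr c2 c2 e = refl

-- Transported from ℤ[ω], since the cube roots of unity are distinct even modulo 2.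
⊙-interchange : ∀ a b c d → (a ⊙ b) ⊙ (c ⊙ d) ≡ (a ⊙ c) ⊙ (b ⊙ d)
⊙-interchange a b c d = emb-injective prime[2] _ _ (≡⇒≈ (trans (expand a b c d)
  (trans (E.*-interchange (emb a) (emb b) (emb c) (emb d)) (sym (expand a c b d)))))
  where
  expand : ∀ a b c d → emb ((a ⊙ b) ⊙ (c ⊙ d)) ≡ (emb a *ᴱ emb b) *ᴱ (emb c *ᴱ emb d)
  expand a b c d = trans (emb-⊙ (a ⊙ b) (c ⊙ d)) (cong₂ _*ᴱ_ (emb-⊙ a b) (emb-⊙ c d))

norm-^∤ : ∀ {q} → Prime q → ∀ {x} → ¬ (+ q ∣ norm x) → ∀ m → ¬ (+ q ∣ norm (x ^ᴱ m))
norm-^∤ pr n zero = prime∤1 pr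
norm-^∤ {q} pr {x} n (suc m) d = prime∤* pr n (norm-^∤ pr n m) (∣-by-eq (norm-* x (x ^ᴱ m)) d)

-- Multiplication by the conjugate replaces γ by its norm, an integer that is a unit modulo q. It
-- does not matter whether q stays prime in ℤ[ω].
𝔼-cancel : ∀ {q} → Prime q → ∀ γ {x y} → ¬ (+ q ∣ norm γ) → γ *ᴱ x ≈ γ *ᴱ y [ + q ] → x ≈ y [ + q ]
𝔼-cancel {q} pr γ {x} {y} n e = ∣∣⇒≈ (drop (re x) (re y) (proj₁ d)) (drop (im x) (im y) (proj₂ d))
  where
  open RingTheory (E/ (+ q))
  scale : ∀ z → conj γ *ᴱ (γ *ᴱ z) ≡ ⟨ norm γ ℤ.* re z , norm γ ℤ.* im z ⟩
  scale z = trans (sym (*ᴱ-assoc (conj γ) γ z)) (trans (cong (_*ᴱ z) (trans (*ᴱ-comm (conj γ) γ) (*-conj γ))) (int-* (norm γ) z))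
  d = ≈⇒∣∣ (≈trans (≡⇒≈ (sym (scale x))) (≈trans (*-congˡ {conj γ} e) (≡⇒≈ (scale y))))
  drop : ∀ a b → + q ∣ (norm γ ℤ.* a ℤ.- norm γ ℤ.* b) → + q ∣ (a ℤ.- b)
  drop a b h = [ (λ k → contradiction k n) , (λ k → k) ]′ (prime∣* pr (norm γ) (a ℤ.- b) (∣-by-eq (f (norm γ) a b) h))
    where
    f : ∀ n a b → n ℤ.* a ℤ.- n ℤ.* b ≡ n ℤ.* (a ℤ.- b)
    f = solve-∀

-- The cubic residue symbol of α modulo q, as the value of a power of α/ᾱ; this needs no prime of ℤ[ω] above q.
record Symbol (q : ℕ) (α : 𝔼) (u : C₃) : Set where
  field
    case₁ : ∀ m → q ≡ suc (3 ℕ.* m) → α ^ᴱ m ≈ emb u *ᴱ conj α ^ᴱ m [ + q ]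
    -- For q ≡ 2 (mod 3) conjugation is the Frobenius map of ℤ[ω]/q. Hence (α/ᾱ)^((q+1)/3) is the
    -- inverse of α^((q²-1)/3), which explains `inv u`.
    case₂ : ∀ m → q ≡ suc (suc (3 ℕ.* m)) → α ^ᴱ suc m ≈ emb (inv u) *ᴱ conj α ^ᴱ suc m [ + q ]
open Symbol public

infix 4 _⊥ᴾ_
_⊥ᴾ_ : ℤ → ℤ → Set
m ⊥ᴾ n = ∀ {r} → Prime r → + r ∣ m → + r ∣ n → ⊥

1⊥ : ∀ {n} → + 1 ⊥ᴾ n
1⊥ pr d _ = prime∤1 pr d

-- A reciprocity law for α as data: `χ` plays the symbol of an integer modulo α, as a character
-- modulo D, and `symbol` identifies its value at q with the symbol of α modulo q.
record Reciprocity (α : 𝔼) (D : ℤ) : Set where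
  field
    χ          : ℤ → C₃
    χ-*        : ∀ {m n} → m ⊥ᴾ D → n ⊥ᴾ D → χ (m ℤ.* n) ≡ χ m ⊙ χ n
    χ-periodic : ∀ {m n} → D ∣ (m ℤ.- n) → χ m ≡ χ n
    symbol     : ∀ {q} → Prime q → q ≢ 3 → ¬ (+ q ∣ D) → Symbol q α (χ (+ q))

  χ-1 : χ (+ 1) ≡ c0
  χ-1 = ⊙-idem (χ (+ 1)) (χ-* {+ 1} {+ 1} 1⊥ 1⊥)

  χ-neg : ∀ {n} → n ⊥ᴾ D → χ (ℤ.- n) ≡ χ n
  χ-neg {n} u = trans (cong χ (sym (ℤₚ.-1*i≡-i n))) (trans (χ-* {ℤ.-1ℤ} {n} -1⊥ u) (cong (_⊙ χ n) -1≡))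
    where
    -1⊥ : ℤ.-1ℤ ⊥ᴾ D
    -1⊥ pr d = contradiction (ℤ∣.∣m⇒∣-m d) (prime∤1 pr)
    -1≡ : χ ℤ.-1ℤ ≡ c0
    -1≡ = square≡c0 (χ ℤ.-1ℤ) (trans (sym (χ-* {ℤ.-1ℤ} {ℤ.-1ℤ} -1⊥ -1⊥)) χ-1)

  χ-abs : ∀ {n} → n ⊥ᴾ D → χ (+ ℤ.∣ n ∣) ≡ χ n
  χ-abs {+ n}      u = refl
  χ-abs { -[1+ n ]} u = χ-neg u

symbol-* : ∀ {q α β u v} → Symbol q α u → Symbol q β v → Symbol q (α *ᴱ β) (u ⊙ v)
symbol-* {q} {α} {β} {u} {v} s t = record
  { case₁ = λ m e → mul m (emb-⊙ u v) (case₁ s m e) (case₁ t m e)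
  ; case₂ = λ m e → mul (suc m) (trans (cong emb (inv-⊙ u v)) (emb-⊙ (inv u) (inv v))) (case₂ s m e) (case₂ t m e) }
  where
  open RingTheory (E/ (+ q))
  mul : ∀ m {x y z} → z ≡ x *ᴱ y → α ^ᴱ m ≈ x *ᴱ conj α ^ᴱ m → β ^ᴱ m ≈ y *ᴱ conj β ^ᴱ m →
        (α *ᴱ β) ^ᴱ m ≈ z *ᴱ conj (α *ᴱ β) ^ᴱ m
  mul m {x} {y} {z} e f g = begin
    (α * β) ^ m                              ≈⟨ ^-distrib-* α β m ⟩
    α ^ m * β ^ m                            ≈⟨ *-cong f g ⟩
    (x * conj α ^ m) * (y * conj β ^ m)      ≈⟨ *-interchange x (conj α ^ m) y (conj β ^ m) ⟩
    (x * y) * (conj α ^ m * conj β ^ m)      ≈⟨ *-cong (≡⇒≈ e) (^-distrib-* (conj α) (conj β) m) ⟨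
    z * (conj α * conj β) ^ m                ≈⟨ *-congˡ {z} (^-cong m (≡⇒≈ (conj-* α β))) ⟨
    z * conj (α * β) ^ m                     ∎

reciprocity-* : ∀ {α β D D′} → Reciprocity α D → Reciprocity β D′ → Reciprocity (α *ᴱ β) (D ℤ.* D′)
reciprocity-* {α} {β} {D} {D′} A B = record
  { χ = λ n → A.χ n ⊙ B.χ n
  ; χ-* = λ {m} {n} u v → trans (cong₂ _⊙_ (A.χ-* {m} {n} (left u) (left v)) (B.χ-* {m} {n} (right u) (right v)))
                        (⊙-interchange (A.χ m) (A.χ n) (B.χ m) (B.χ n))
  ; χ-periodic = λ d → cong₂ _⊙_ (A.χ-periodic (ℤ∣.∣-trans (ℤ∣.∣m⇒∣m*n D′ ℤ∣.∣-refl) d))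
                                 (B.χ-periodic (ℤ∣.∣-trans (ℤ∣.∣n⇒∣m*n D ℤ∣.∣-refl) d))
  ; symbol = λ pr n3 n → symbol-* (A.symbol pr n3 (λ d → n (ℤ∣.∣m⇒∣m*n D′ d))) (B.symbol pr n3 (λ d → n (ℤ∣.∣n⇒∣m*n D d))) }
  where
  module A = Reciprocity A
  module B = Reciprocity B
  left : ∀ {m} → m ⊥ᴾ D ℤ.* D′ → m ⊥ᴾ D
  left u pr d e = u pr d (ℤ∣.∣m⇒∣m*n D′ e)
  right : ∀ {m} → m ⊥ᴾ D ℤ.* D′ → m ⊥ᴾ D′
  right u pr d e = u pr d (ℤ∣.∣n⇒∣m*n D e)

-- A rational integer is its own conjugate, so α/ᾱ = 1 and all symbols are trivial.
reciprocity-int : ∀ a D → Reciprocity (int a) D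
reciprocity-int a D = record
  { χ = λ _ → c0 ; χ-* = λ _ _ → refl ; χ-periodic = λ _ → refl
  ; symbol = λ {q} _ _ _ → record { case₁ = λ m _ → eq q m ; case₂ = λ m _ → eq q (suc m) } }
  where
  eq : ∀ q m → int a ^ᴱ m ≈ 1ᴱ *ᴱ conj (int a) ^ᴱ m [ + q ]
  eq q m = ≡⇒≈ (sym (trans (*ᴱ-identityˡ _) (cong (_^ᴱ m) (conj-int a))))

-- Rational factors cancel in α/ᾱ, so α matters only up to integers modulo q. Both symbols are
-- compared after multiplication by a power of γ = cᾱ ≡ c′β̄.
symbol-unique : ∀ {q α β u v} → Prime q → q ≢ 3 → Symbol q α u → Symbol q β v → ∀ c c′ →
                ¬ (+ q ∣ c) → ¬ (+ q ∣ norm α) → int c *ᴱ α ≈ int c′ *ᴱ β [ + q ] → u ≡ v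
symbol-unique {q} {α} {β} {u} {v} pr q≢3 s t c c′ nc nα e = split (q ℕ.% 3) (ℕ/.m%n<n q 3)
    (trans (ℕ/.m≡m%n+[m/n]*n q 3) (cong (q ℕ.% 3 ℕ.+_) (ℕₚ.*-comm (q ℕ./ 3) 3)))
  where
  open RingTheory (E/ (+ q))
  γ : 𝔼
  γ = int c *ᴱ conj α
  e̅ : γ ≈ int c′ * conj β
  e̅ = ≈trans (≡⇒≈ (sym (conj-scale c α))) (≈trans (conj-≈ e) (≡⇒≈ (conj-scale c′ β)))
    where
    conj-scale : ∀ c x → conj (int c *ᴱ x) ≡ int c *ᴱ conj x
    conj-scale c x = trans (conj-* (int c) x) (cong (_*ᴱ conj x) (conj-int c))
  γ∤ : ¬ (+ q ∣ norm γ)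
  γ∤ d = prime∤* pr (prime∤* pr nc nc) nα
    (∣-by-eq (trans (norm-* (int c) (conj α)) (cong₂ ℤ._*_ (norm-int c) (norm-conj α))) d)
  same : ∀ m x y → α ^ m ≈ x * conj α ^ m → β ^ m ≈ y * conj β ^ m → x ≈ y
  same m x y f g = 𝔼-cancel pr (γ ^ m) (norm-^∤ pr γ∤ m) (begin
    γ ^ m * x                         ≈⟨ *-comm (γ ^ m) x ⟩
    x * γ ^ m                         ≈⟨ *-congˡ {x} (^-distrib-* (int c) (conj α) m) ⟩
    x * (int c ^ m * conj α ^ m)      ≈⟨ *-exchangeˡ x (int c ^ m) (conj α ^ m) ⟩
    int c ^ m * (x * conj α ^ m)      ≈⟨ *-congˡ {int c ^ m} f ⟨
    int c ^ m * α ^ m                 ≈⟨ ^-distrib-* (int c) α m ⟨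
    (int c * α) ^ m                   ≈⟨ ^-cong m e ⟩
    (int c′ * β) ^ m                  ≈⟨ ^-distrib-* (int c′) β m ⟩
    int c′ ^ m * β ^ m                ≈⟨ *-congˡ {int c′ ^ m} g ⟩
    int c′ ^ m * (y * conj β ^ m)     ≈⟨ *-exchangeˡ y (int c′ ^ m) (conj β ^ m) ⟨
    y * (int c′ ^ m * conj β ^ m)     ≈⟨ *-congˡ {y} (^-distrib-* (int c′) (conj β) m) ⟨
    y * (int c′ * conj β) ^ m         ≈⟨ *-congˡ {y} (^-cong m e̅) ⟨
    y * γ ^ m                         ≈⟨ *-comm y (γ ^ m) ⟩
    γ ^ m * y                         ∎)
  split : ∀ r → r ℕ.< 3 → q ≡ r ℕ.+ 3 ℕ.* (q ℕ./ 3) → u ≡ v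
  split 0 _ h = contradiction (sym (prime∣prime prime-3 pr (ℤ∣.∣ᵤ⇒∣ (ℕ∣.divides (q ℕ./ 3) (trans h (ℕₚ.*-comm 3 (q ℕ./ 3))))))) q≢3
  split 1 _ h = emb-injective pr u v (same (q ℕ./ 3) (emb u) (emb v) (case₁ s (q ℕ./ 3) h) (case₁ t (q ℕ./ 3) h))
  split 2 _ h = trans (sym (inv-inv u)) (trans (cong inv (emb-injective pr (inv u) (inv v)
    (same (suc (q ℕ./ 3)) (emb (inv u)) (emb (inv v)) (case₂ s (q ℕ./ 3) h) (case₂ t (q ℕ./ 3) h)))) (inv-inv v))
  split (suc (suc (suc _))) (ℕ.s≤s (ℕ.s≤s (ℕ.s≤s ())))

record Proportional (q : ℕ) (α β : 𝔼) (D D′ : ℤ) : Set where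
  constructor proportional
  field
    {c c′} : ℤ
    q≢3 : q ≢ 3
    q∤D : ¬ (+ q ∣ D)
    q∤D′ : ¬ (+ q ∣ D′)
    q∤c : ¬ (+ q ∣ c)
    q∤norm : ¬ (+ q ∣ norm α)
    ratio : int c *ᴱ α ≈ int c′ *ᴱ β [ + q ]

-- Reciprocity there and back: for each prime q ∣ n, the symbol of q modulo α is that of α modulo q,
-- then that of β modulo q, then that of q modulo β. The sign of n is harmless as -1 has trivial
-- symbol.
compare : ∀ {α β D D′} (A : Reciprocity α D) (B : Reciprocity β D′) n → n ≢ + 0 →
          (∀ q → Prime q → + q ∣ n → Proportional q α β D D′) → Reciprocity.χ A n ≡ Reciprocity.χ B n
compare {α} {β} {D} {D′} A B n n≢0 h =
  trans (sym (A.χ-abs (λ pr d → Proportional.q∤D (h _ pr d)))) (trans abs (B.χ-abs (λ pr d → Proportional.q∤D′ (h _ pr d))))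
  where
  module A = Reciprocity A
  module B = Reciprocity B
  instance
    _ : ℕ.NonZero ℤ.∣ n ∣
    _ = ℕ.≢-nonZero (λ e → n≢0 (ℤₚ.∣i∣≡0⇒i≡0 e))
  go : ∀ ps → All Prime ps → (∀ q → Prime q → + q ∣ + product ps → Proportional q α β D D′) → A.χ (+ product ps) ≡ B.χ (+ product ps)
  go [] _ _ = trans A.χ-1 (sym B.χ-1)
  go (p ∷ ps) (pr ∷ prs) f = trans (cong A.χ (ℤₚ.pos-* p (product ps))) (trans (A.χ-* {+ p} {+ product ps} (uA p∣) (uA ps∣))
      (trans (cong₂ _⊙_ one (go ps prs (λ q qr d → f q qr (ps∣ d))))
      (trans (sym (B.χ-* {+ p} {+ product ps} (uB p∣) (uB ps∣))) (cong B.χ (sym (ℤₚ.pos-* p (product ps)))))))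
    where
    p∣ : ∀ {r} → + r ∣ + p → + r ∣ + product (p ∷ ps)
    p∣ d = ∣-by-eq (sym (ℤₚ.pos-* p (product ps))) (ℤ∣.∣m⇒∣m*n (+ product ps) d)
    ps∣ : ∀ {r} → + r ∣ + product ps → + r ∣ + product (p ∷ ps)
    ps∣ d = ∣-by-eq (sym (ℤₚ.pos-* p (product ps))) (ℤ∣.∣n⇒∣m*n (+ p) d)
    uA : ∀ {m} → (∀ {r} → + r ∣ m → + r ∣ + product (p ∷ ps)) → m ⊥ᴾ D
    uA k rr d = Proportional.q∤D (f _ rr (k d))
    uB : ∀ {m} → (∀ {r} → + r ∣ m → + r ∣ + product (p ∷ ps)) → m ⊥ᴾ D′
    uB k rr d = Proportional.q∤D′ (f _ rr (k d))
    one : A.χ (+ p) ≡ B.χ (+ p)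
    one with proportional {c} {c′} q≢3 nD nD′ nc nα e ← f p pr (p∣ ℤ∣.∣-refl) =
      symbol-unique pr q≢3 (A.symbol pr q≢3 nD) (B.symbol pr q≢3 nD′) c c′ nc nα e
  open PrimeFactorisation (factorise ℤ.∣ n ∣) using (factors; isFactorisation; factorsPrime)
  abs : A.χ (+ ℤ.∣ n ∣) ≡ B.χ (+ ℤ.∣ n ∣)
  abs = subst (λ z → A.χ (+ z) ≡ B.χ (+ z)) (sym isFactorisation)
    (go factors factorsPrime λ q pr d → h q pr (ℤ∣.∣-trans (subst (λ z → + q ∣ + z) (sym isFactorisation) d) ℤ∣.∣m∣∣m))

-- Cubic reciprocity

-- Dividing (ℓJ)^m ≡ χ̄(q) by its conjugate removes the rational factor ℓ and leaves χ̄/χ = χ. For q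
-- ≡ 2 (mod 3) the same division of χ(q)ℓ leaves χ/χ̄ = χ̄, in agreement with `inv u`.
jacobi-reciprocity : ∀ {ℓ} (pr : Prime ℓ) (ℓ≢3 : ℓ ≢ 3) w (w-root : + ℓ ∣ (w ℤ.* w ℤ.+ w ℤ.+ + 1)) →
                     Reciprocity (JacobiSum.J pr ℓ≢3 w w-root) (+ ℓ)
jacobi-reciprocity {ℓ} pr ℓ≢3 w w-root = record
  { χ = λ n → value (χ n)
  ; χ-* = λ {m} {n} u v → mult m n (λ d → u pr d ℤ∣.∣-refl) (λ d → v pr d ℤ∣.∣-refl)
  ; χ-periodic = λ d → cong value (χ-cong (∣⇒≈ d))
  ; symbol = sym-J }
  where
  open JacobiSum pr ℓ≢3 w w-root
  value : C₃⁰ → C₃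
  -- A default at the multiples of ℓ, where neither multiplicativity nor the symbol is demanded.
  value nul    = c0
  value (rt a) = a
  mult : ∀ m n → ¬ (+ ℓ ∣ m) → ¬ (+ ℓ ∣ n) → value (χ (m ℤ.* n)) ≡ value (χ m) ⊙ value (χ n)
  mult m n nm nn with a , e ← χ-unit nm | b , f ← χ-unit nn =
    trans (cong value (trans (χ-* m n) (cong₂ _⊡_ e f))) (sym (cong₂ (λ u v → value u ⊙ value v) e f))
  sym-J : ∀ {q} → Prime q → q ≢ 3 → ¬ (+ q ∣ + ℓ) → Symbol q J (value (χ (+ q)))
  sym-J {q} qr q≢3 q∤ℓ with a , e ← χ-unit {+ q} (λ d → q∤ℓ (subst (λ z → + z ∣ + ℓ) (prime∣prime pr qr d) ℤ∣.∣-refl)) =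
    subst (Symbol q J) (sym (cong value e)) record
      { case₁ = λ m h → unscale m (emb a) (first m h)
      ; case₂ = λ m h → unscale (suc m) (emb (inv a)) (second m h) }
    where
    open RingTheory (E/ (+ q))
    q≢ℓ : q ≢ ℓ
    q≢ℓ refl = q∤ℓ ℤ∣.∣-refl
    conj-ℓJ : ∀ m → conj ((ℓᴱ *ᴱ J) ^ᴱ m) ≡ (ℓᴱ *ᴱ conj J) ^ᴱ m
    conj-ℓJ m = trans (conj-^ (ℓᴱ *ᴱ J) m) (cong (_^ᴱ m) (trans (conj-* ℓᴱ J) (cong (_*ᴱ conj J) (conj-int (+ ℓ)))))
    unscale : ∀ m u → (ℓᴱ * J) ^ m ≈ u * (ℓᴱ * conj J) ^ m → J ^ m ≈ u * conj J ^ m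
    unscale m u h = 𝔼-cancel qr (ℓᴱ ^ m) (norm-^∤ qr {ℓᴱ} (λ d → prime∤* qr q∤ℓ q∤ℓ (∣-by-eq (norm-int (+ ℓ)) d)) m) (begin
      ℓᴱ ^ m * J ^ m              ≈⟨ ^-distrib-* ℓᴱ J m ⟨
      (ℓᴱ * J) ^ m                ≈⟨ h ⟩
      u * (ℓᴱ * conj J) ^ m       ≈⟨ *-congˡ {u} (^-distrib-* ℓᴱ (conj J) m) ⟩
      u * (ℓᴱ ^ m * conj J ^ m)   ≈⟨ *-exchangeˡ u (ℓᴱ ^ m) (conj J ^ m) ⟩
      ℓᴱ ^ m * (u * conj J ^ m)   ∎)
    χ̄≡ : χ̄ᴱ (+ q) ≡ emb (inv a)
    χ̄≡ = trans (cong (λ v → conj (emb⁰ v)) e) (conj-emb a)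
    χ≡ : χᴱ (+ q) ≡ emb a
    χ≡ = cong emb⁰ e
    square : ∀ a → inv a ≡ a ⊙ a
    square c0 = refl
    square c1 = refl
    square c2 = refl
    first : ∀ m → q ≡ suc (3 ℕ.* m) → (ℓᴱ * J) ^ m ≈ emb a * (ℓᴱ * conj J) ^ m
    first m h = begin
      (ℓᴱ * J) ^ m                   ≈⟨ J-power₁ qr q≢ℓ m h ⟩
      χ̄ᴱ (+ q)                       ≈⟨ ≡⇒≈ (trans χ̄≡ (trans (cong emb (square a)) (emb-⊙ a a))) ⟩
      emb a * emb a                  ≈⟨ *-congˡ {emb a} (≡⇒≈ (trans (sym (conj-conj (emb a))) (cong conj (trans (conj-emb a) (sym χ̄≡))))) ⟩
      emb a * conj (χ̄ᴱ (+ q))        ≈⟨ *-congˡ {emb a} (conj-≈ (J-power₁ qr q≢ℓ m h)) ⟨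
      emb a * conj ((ℓᴱ * J) ^ m)    ≈⟨ *-congˡ {emb a} (≡⇒≈ (conj-ℓJ m)) ⟩
      emb a * (ℓᴱ * conj J) ^ m      ∎
    second : ∀ m → q ≡ suc (suc (3 ℕ.* m)) → (ℓᴱ * J) ^ suc m ≈ emb (inv a) * (ℓᴱ * conj J) ^ suc m
    second m h = begin
      (ℓᴱ * J) ^ suc m                        ≈⟨ J-power₂ qr q≢ℓ m h ⟩
      χᴱ (+ q) * ℓᴱ                           ≈⟨ ≡⇒≈ (trans (cong (_*ᴱ ℓᴱ) (trans χ≡ (trans (cong emb (trans (sym (inv-inv a)) (square (inv a)))) (emb-⊙ (inv a) (inv a)))))
                                                    (*ᴱ-assoc (emb (inv a)) (emb (inv a)) ℓᴱ)) ⟩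
      emb (inv a) * (emb (inv a) * ℓᴱ)        ≈⟨ *-congˡ {emb (inv a)} (≡⇒≈ (cong₂ _*ᴱ_ (sym χ̄≡) (sym (conj-int (+ ℓ))))) ⟩
      emb (inv a) * (χ̄ᴱ (+ q) * conj ℓᴱ)      ≈⟨ *-congˡ {emb (inv a)} (≡⇒≈ (sym (conj-* (χᴱ (+ q)) ℓᴱ))) ⟩
      emb (inv a) * conj (χᴱ (+ q) * ℓᴱ)      ≈⟨ *-congˡ {emb (inv a)} (conj-≈ (J-power₂ qr q≢ℓ m h)) ⟨
      emb (inv a) * conj ((ℓᴱ * J) ^ suc m)   ≈⟨ *-congˡ {emb (inv a)} (≡⇒≈ (conj-ℓJ (suc m))) ⟩
      emb (inv a) * (ℓᴱ * conj J) ^ suc m     ∎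

Primitive : 𝔼 → Set
Primitive α = ∀ {r} → Prime r → + r ∣ re α → + r ∣ im α → ⊥

opaque
  unfolding _+ᴱ_

  μ[-1] : ∀ x → x *ᴱ (-ᴱ 1ᴱ) ≡ -ᴱ x
  μ[-1] = ring-∀ 𝔼-acr

  -- x and y lie in the ideal (ℓ, ω - w), and its product with the conjugate ideal is contained in
  -- (ℓ), because (ω - w)(ω̄ - w) = w² + w + 1.
  ∣-*conj : ∀ {ℓ w} x y → ℓ ∣ (w ℤ.* w ℤ.+ w ℤ.+ + 1) → ℓ ∣ (re x ℤ.+ im x ℤ.* w) → ℓ ∣ (re y ℤ.+ im y ℤ.* w) →
            ℓ ∣ re (x *ᴱ conj y) × ℓ ∣ im (x *ᴱ conj y)
  ∣-*conj {ℓ} {w} ⟨ a , b ⟩ ⟨ c , d ⟩ r p q =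
      ∣-by-eq (f a b c d w) (ℤ∣.∣m∣n⇒∣m+n (ℤ∣.∣m∣n⇒∣m+n (ℤ∣.∣n⇒∣m*n (a ℤ.+ b ℤ.* w ℤ.- b ℤ.* w) q) (ℤ∣.∣m⇒∣m*n (ℤ.- (d ℤ.* w) ℤ.- d) p)) (ℤ∣.∣n⇒∣m*n (b ℤ.* d) r))
    , ∣-by-eq (g a b c d w) (ℤ∣.∣m∣n⇒∣m-n (ℤ∣.∣n⇒∣m*n b q) (ℤ∣.∣n⇒∣m*n d p))
    where
    f : ∀ a b c d w → (a ℤ.+ b ℤ.* w ℤ.- b ℤ.* w) ℤ.* (c ℤ.+ d ℤ.* w) ℤ.+ (a ℤ.+ b ℤ.* w) ℤ.* (ℤ.- (d ℤ.* w) ℤ.- d) ℤ.+ b ℤ.* d ℤ.* (w ℤ.* w ℤ.+ w ℤ.+ + 1)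
      ≡ a ℤ.* (c ℤ.- d) ℤ.- b ℤ.* (ℤ.- d)
    f = solve-∀
    g : ∀ a b c d w → b ℤ.* (c ℤ.+ d ℤ.* w) ℤ.- d ℤ.* (a ℤ.+ b ℤ.* w) ≡ a ℤ.* (ℤ.- d) ℤ.+ b ℤ.* (c ℤ.- d) ℤ.- b ℤ.* (ℤ.- d)
    g = solve-∀

square-abs : ∀ i → i ℤ.* i ≡ + (ℤ.∣ i ∣ ℕ.* ℤ.∣ i ∣)
square-abs (+ n)    = sym (ℤₚ.pos-* n n)
square-abs -[1+ n ] = refl

-- With b = 3c the norm equation reads 4 = (2a - b)² + 27c² and forces c = 0: the primary units are
-- ±1.
norm≡1⇒int : ∀ α → norm α ≡ + 1 → + 3 ∣ im α → im α ≡ + 0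
norm≡1⇒int ⟨ a , b ⟩ e (divides c refl) = trans (cong (ℤ._* + 3) (ℤₚ.∣i∣≡0⇒i≡0 {c} c≡0)) refl
  where
  f : ∀ a c → + 4 ℤ.* (a ℤ.* a ℤ.- a ℤ.* (c ℤ.* + 3) ℤ.+ c ℤ.* + 3 ℤ.* (c ℤ.* + 3))
    ≡ (+ 2 ℤ.* a ℤ.- c ℤ.* + 3) ℤ.* (+ 2 ℤ.* a ℤ.- c ℤ.* + 3) ℤ.+ + 27 ℤ.* (c ℤ.* c)
  f = solve-∀
  d = ℤ.∣ + 2 ℤ.* a ℤ.- c ℤ.* + 3 ∣
  total : 4 ≡ d ℕ.* d ℕ.+ 27 ℕ.* (ℤ.∣ c ∣ ℕ.* ℤ.∣ c ∣)
  total = ℤₚ.+-injective (trans (cong (+ 4 ℤ.*_) (sym e)) (trans (f a c)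
    (cong₂ ℤ._+_ (square-abs (+ 2 ℤ.* a ℤ.- c ℤ.* + 3)) (trans (cong (+ 27 ℤ.*_) (square-abs c)) (sym (ℤₚ.pos-* 27 (ℤ.∣ c ∣ ℕ.* ℤ.∣ c ∣)))))))
  small : ∀ n → 27 ℕ.* (n ℕ.* n) ℕ.≤ 4 → n ≡ 0
  small zero    _ = refl
  small (suc n) h = contradiction (ℕₚ.≤-trans (ℕₚ.*-monoʳ-≤ 27 (ℕ.s≤s ℕ.z≤n)) h) λ { (ℕ.s≤s (ℕ.s≤s (ℕ.s≤s (ℕ.s≤s ())))) }
  c≡0 : ℤ.∣ c ∣ ≡ 0
  c≡0 = small ℤ.∣ c ∣ (subst (27 ℕ.* (ℤ.∣ c ∣ ℕ.* ℤ.∣ c ∣) ℕ.≤_) (sym total) (ℕₚ.m≤n+m _ (d ℕ.* d)))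

-- Split off the Jacobi sums of the primes dividing the norm, one at a time.
primary-reciprocity : ∀ N → Acc ℕ._<_ N → .{{ℕ.NonZero N}} → ∀ α → norm α ≡ + N → + 3 ∣ im α → Primitive α → Reciprocity α (+ N)
primary-reciprocity N (acc rec) α nα 3∣b prim with factorise N
... | record { factors = [] ; isFactorisation = refl } =
  subst (λ z → Reciprocity z (+ 1)) (cong₂ ⟨_,_⟩ refl (sym (norm≡1⇒int α nα 3∣b))) (reciprocity-int (re α) (+ 1))
... | record { factors = ℓ ∷ ps ; isFactorisation = N≡ ; factorsPrime = pr ∷ prs } =
  subst₂ Reciprocity (sym α≡μJ) (trans (sym (ℤₚ.pos-* N′ ℓ)) (cong +_ (trans (ℕₚ.*-comm N′ ℓ) (sym N≡))))
    (reciprocity-* (primary-reciprocity N′ (rec N′<N) μ nμ 3∣μ primμ) (jacobi-reciprocity pr ℓ≢3 w w-root))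
  where
  N′ : ℕ
  N′ = product ps
  instance
    N′≢0 : ℕ.NonZero N′
    N′≢0 = productOfPrimes≢0 prs
    ℓ≢0 : ℤ.NonZero (+ ℓ)
    ℓ≢0 = prime⇒nonZero pr
  a b : ℤ
  a = re α
  b = im α
  N′<N : N′ ℕ.< N
  N′<N = subst (N′ ℕ.<_) (trans (ℕₚ.*-comm N′ ℓ) (sym N≡)) (ℕₚ.m<m*n N′ ℓ (ℕ.nonTrivial⇒n>1 ℓ {{prime⇒nonTrivial pr}}))
  ℓ∣N : + ℓ ∣ norm α
  ℓ∣N = ∣-by-eq (sym nα) (ℤ∣.∣ᵤ⇒∣ (ℕ∣.divides N′ (trans N≡ (ℕₚ.*-comm ℓ N′))))
  ℓ∤b : ¬ (+ ℓ ∣ b)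
  ℓ∤b d = [ (λ e → prim pr e d) , (λ e → prim pr e d) ]′ (prime∣* pr a a (∣-by-eq (f a b)
      (ℤ∣.∣m∣n⇒∣m+n ℓ∣N (ℤ∣.∣m⇒∣m*n (a ℤ.- b) d))))
    where
    f : ∀ a b → a ℤ.* a ℤ.- a ℤ.* b ℤ.+ b ℤ.* b ℤ.+ b ℤ.* (a ℤ.- b) ≡ a ℤ.* a
    f = solve-∀
  ℓ≢3 : ℓ ≢ 3
  ℓ≢3 refl = ℓ∤b 3∣b
  b′ : ℤ
  b′ = proj₁ (Fermat.inverse pr b ℓ∤b)
  -- w ≡ -a/b is the value of ω modulo the prime above ℓ that contains α; J is to lie in the same
  -- prime.
  w : ℤ
  w = ℤ.- (a ℤ.* b′)
  red∣ : + ℓ ∣ (a ℤ.+ b ℤ.* w)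
  red∣ = ∣-by-eq (f a b b′) (ℤ∣.∣n⇒∣m*n (ℤ.- a) (proj₂ (Fermat.inverse pr b ℓ∤b)))
    where
    f : ∀ a b b′ → ℤ.- a ℤ.* (b ℤ.* b′ ℤ.- + 1) ≡ a ℤ.+ b ℤ.* (ℤ.- (a ℤ.* b′))
    f = solve-∀
  w-root : + ℓ ∣ (w ℤ.* w ℤ.+ w ℤ.+ + 1)
  w-root = [ (λ d → contradiction d (prime∤* pr ℓ∤b ℓ∤b)) , (λ d → d) ]′ (prime∣* pr (b ℤ.* b) (w ℤ.* w ℤ.+ w ℤ.+ + 1)
      (∣-by-eq (f a b w) (ℤ∣.∣m∣n⇒∣m-n ℓ∣N (ℤ∣.∣m⇒∣m*n (a ℤ.- b ℤ.* w ℤ.- b) red∣))))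
    where
    f : ∀ a b w → a ℤ.* a ℤ.- a ℤ.* b ℤ.+ b ℤ.* b ℤ.- (a ℤ.+ b ℤ.* w) ℤ.* (a ℤ.- b ℤ.* w ℤ.- b)
      ≡ b ℤ.* b ℤ.* (w ℤ.* w ℤ.+ w ℤ.+ + 1)
    f = solve-∀
  open JacobiSum pr ℓ≢3 w w-root using (J; J-norm; J-primary; red-J)
  parts : + ℓ ∣ re (α *ᴱ conj J) × + ℓ ∣ im (α *ᴱ conj J)
  parts = ∣-*conj {w = w} α J w-root red∣ red-J
  -- This is α/J: since JJ̄ = ℓ, it equals αJ̄/ℓ, and αJ̄ is divisible by ℓ because α and J share a
  -- prime above ℓ.
  μ : 𝔼
  μ = ⟨ _∣_.quotient (proj₁ parts) , _∣_.quotient (proj₂ parts) ⟩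
  αJ̄≡ : α *ᴱ conj J ≡ int (+ ℓ) *ᴱ μ
  αJ̄≡ = trans (cong₂ ⟨_,_⟩ (trans (_∣_.equality (proj₁ parts)) (ℤₚ.*-comm (re μ) (+ ℓ)))
                           (trans (_∣_.equality (proj₂ parts)) (ℤₚ.*-comm (im μ) (+ ℓ)))) (sym (int-* (+ ℓ) μ))
  α≡μJ : α ≡ μ *ᴱ J
  α≡μJ = int-cancel (+ ℓ) (begin
    int (+ ℓ) *ᴱ α           ≡⟨ cong (_*ᴱ α) J-norm ⟨
    (J *ᴱ conj J) *ᴱ α       ≡⟨ *ᴱ-comm (J *ᴱ conj J) α ⟩
    α *ᴱ (J *ᴱ conj J)       ≡⟨ cong (α *ᴱ_) (*ᴱ-comm J (conj J)) ⟩
    α *ᴱ (conj J *ᴱ J)       ≡⟨ *ᴱ-assoc α (conj J) J ⟨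
    (α *ᴱ conj J) *ᴱ J       ≡⟨ cong (_*ᴱ J) αJ̄≡ ⟩
    (int (+ ℓ) *ᴱ μ) *ᴱ J    ≡⟨ *ᴱ-assoc (int (+ ℓ)) μ J ⟩
    int (+ ℓ) *ᴱ (μ *ᴱ J)    ∎)
    where open ≡.≡-Reasoning
  norm-J : norm J ≡ + ℓ
  norm-J = cong re (trans (sym (*-conj J)) J-norm)
  nμ : norm μ ≡ + N′
  nμ = ℤₚ.*-cancelʳ-≡ (norm μ) (+ N′) (+ ℓ) (trans (cong (norm μ ℤ.*_) (sym norm-J)) (trans (sym (norm-* μ J))
    (trans (cong norm (sym α≡μJ)) (trans nα (trans (cong +_ (trans N≡ (ℕₚ.*-comm ℓ N′))) (ℤₚ.pos-* N′ ℓ))))))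
  -- J ≡ -1 (mod 3) gives α ≡ -μ, so being primary passes to the quotient.
  3∣μ : + 3 ∣ im μ
  3∣μ = ∣-by-eq (f b (im μ)) (ℤ∣.∣m∣n⇒∣m-n (∣-by-eq (cong (λ z → b ℤ.- z) (im-neg μ)) (proj₂ (≈⇒∣∣ α≈-μ))) 3∣b)
    where
    open RingTheory (E/ (+ 3))
    f : ∀ b m → b ℤ.- ℤ.- m ℤ.- b ≡ m
    f = solve-∀
    α≈-μ : α ≈ -ᴱ μ
    α≈-μ = ≈trans (≡⇒≈ α≡μJ) (≈trans (*-congˡ {μ} J-primary) (≡⇒≈ (μ[-1] μ)))
  primμ : Primitive μ
  primμ rr d e = prim rr (∣-by-eq (cong re (sym α≡μJ)) (proj₁ (∣-*ᴱ μ J d e))) (∣-by-eq (cong im (sym α≡μJ)) (proj₂ (∣-*ᴱ μ J d e)))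

-- The supplementary law for ω

_≟₃_ : ∀ (a b : C₃) → Dec (a ≡ b)
c0 ≟₃ c0 = yes refl
c0 ≟₃ c1 = no λ ()
c0 ≟₃ c2 = no λ ()
c1 ≟₃ c0 = no λ ()
c1 ≟₃ c1 = yes refl
c1 ≟₃ c2 = no λ ()
c2 ≟₃ c0 = no λ ()
c2 ≟₃ c1 = no λ ()
c2 ≟₃ c2 = yes refl

residue : ℤ → Fin 9
residue n = fromℕ< (ℤ/.n%ℕd<d n 9)

∣-residue : ∀ n → + 9 ∣ (n ℤ.- + toℕ (residue n))
∣-residue n = divides (n ℤ./ℕ 9) (trans (cong (λ r → n ℤ.- + r) (Finₚ.toℕ-fromℕ< (ℤ/.n%ℕd<d n 9)))
  (trans (cong (λ m → m ℤ.- + (n ℤ.%ℕ 9)) (ℤ/.a≡a%ℕn+[a/ℕn]*n n 9)) (f (+ (n ℤ.%ℕ 9)) (n ℤ./ℕ 9 ℤ.* + 9))))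
  where
  f : ∀ r s → r ℤ.+ s ℤ.- r ≡ s
  f = solve-∀

residue-unique : ∀ i j → + 9 ∣ (+ toℕ {9} i ℤ.- + toℕ {9} j) → i ≡ j
residue-unique = from-yes (Finₚ.all? λ i → Finₚ.all? λ j → (+ 9 ∣? (+ toℕ {9} i ℤ.- + toℕ {9} j)) →-dec (i Finₚ.≟ j))

residue-cong : ∀ {m n} → + 9 ∣ (m ℤ.- n) → residue m ≡ residue n
residue-cong {m} {n} d = residue-unique (residue m) (residue n) (∣-by-eq (f m n (+ toℕ (residue m)) (+ toℕ (residue n)))
  (ℤ∣.∣m∣n⇒∣m-n (ℤ∣.∣m∣n⇒∣m+n d (∣-residue n)) (∣-residue m)))
  where
  f : ∀ m n r s → m ℤ.- n ℤ.+ (n ℤ.- s) ℤ.- (m ℤ.- r) ≡ r ℤ.- s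
  f = solve-∀

-- ω to the power (n² - 1)/3, which depends on n modulo 9. At multiples of 3 the value is a default.
ω-table : Fin 9 → C₃
ω-table 2F = c1
ω-table 7F = c1
ω-table 4F = c2
ω-table 5F = c2
ω-table _  = c0

ω-table-* : ∀ i j → + 3 ∣ + toℕ {9} i ⊎ + 3 ∣ + toℕ {9} j ⊎ ω-table (residue (+ toℕ {9} i ℤ.* + toℕ {9} j)) ≡ ω-table i ⊙ ω-table j
ω-table-* = from-yes (Finₚ.all? λ i → Finₚ.all? λ j → (+ 3 ∣? + toℕ {9} i) ⊎-dec ((+ 3 ∣? + toℕ {9} j)
  ⊎-dec (ω-table (residue (+ toℕ {9} i ℤ.* + toℕ {9} j)) ≟₃ (ω-table i ⊙ ω-table j))))

opaque
  unfolding _+ᴱ_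

  ω-powers : ∀ (j : Fin 3) →
      emb c1 ^ᴱ toℕ j ≡ emb (ω-table (residue (+ suc (3 ℕ.* toℕ j)))) *ᴱ emb c2 ^ᴱ toℕ j
    × emb c1 ^ᴱ suc (toℕ j) ≡ emb (inv (ω-table (residue (+ suc (suc (3 ℕ.* toℕ j)))))) *ᴱ emb c2 ^ᴱ suc (toℕ j)
  ω-powers 0F = refl , refl
  ω-powers 1F = refl , refl
  ω-powers 2F = refl , refl

  -- Exhibits σ as the primary associate of 3k + ω.
  ω*σ : ∀ k → emb c1 *ᴱ ⟨ + 1 ℤ.- + 3 ℤ.* k , ℤ.- (+ 3 ℤ.* k) ⟩ ≡ ⟨ + 3 ℤ.* k , + 1 ⟩
  ω*σ k = cong₂ ⟨_,_⟩ (f k) (g k)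
    where
    f : ∀ k → + 0 ℤ.* (+ 1 ℤ.- + 3 ℤ.* k) ℤ.- + 1 ℤ.* (ℤ.- (+ 3 ℤ.* k)) ≡ + 3 ℤ.* k
    f = solve-∀
    g : ∀ k → + 0 ℤ.* (ℤ.- (+ 3 ℤ.* k)) ℤ.+ + 1 ℤ.* (+ 1 ℤ.- + 3 ℤ.* k) ℤ.- + 1 ℤ.* (ℤ.- (+ 3 ℤ.* k)) ≡ + 1
    g = solve-∀

-- As ω³ = 1, the exponent m matters modulo 3, hence q modulo 9, and three exponents remain to be
-- checked for each class of q modulo 3.
ω-reciprocity : Reciprocity (emb c1) (+ 9)
ω-reciprocity = record
  { χ = e
  ; χ-* = λ {m} {n} u v → mult m n (λ d → u prime-3 d (divides (+ 3) refl)) (λ d → v prime-3 d (divides (+ 3) refl))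
  ; χ-periodic = λ {m} {n} d → cong ω-table (residue-cong {m} {n} d)
  ; symbol = λ {q} _ _ _ → record
      { case₁ = λ m h → ≡⇒≈ (subst₂ (λ z y → emb c1 ^ᴱ m ≡ emb (e (+ z)) *ᴱ y ^ᴱ m) (sym h) (sym (conj-emb c1)) (first m))
      ; case₂ = λ m h → ≡⇒≈ (subst₂ (λ z y → emb c1 ^ᴱ suc m ≡ emb (inv (e (+ z))) *ᴱ y ^ᴱ suc m) (sym h) (sym (conj-emb c1)) (second m)) } }
  where
  e : ℤ → C₃
  e n = ω-table (residue n)
  mult : ∀ m n → ¬ (+ 3 ∣ m) → ¬ (+ 3 ∣ n) → e (m ℤ.* n) ≡ e m ⊙ e n
  mult m n nm nn = go (ω-table-* (residue m) (residue n))
    where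
    r s : ℤ
    r = + toℕ (residue m)
    s = + toℕ (residue n)
    back : ∀ m → + 3 ∣ + toℕ (residue m) → + 3 ∣ m
    back m d = ∣-sub d (ℤ∣.∣-trans (divides (+ 3) refl) (∣-residue m))
    f : ∀ m n r s → (m ℤ.- r) ℤ.* n ℤ.+ r ℤ.* (n ℤ.- s) ≡ m ℤ.* n ℤ.- r ℤ.* s
    f = solve-∀
    go : + 3 ∣ r ⊎ + 3 ∣ s ⊎ ω-table (residue (r ℤ.* s)) ≡ e m ⊙ e n → e (m ℤ.* n) ≡ e m ⊙ e n
    go (inj₁ d) = contradiction (back m d) nm
    go (inj₂ (inj₁ d)) = contradiction (back n d) nn
    go (inj₂ (inj₂ h)) = trans (cong ω-table (residue-cong {m ℤ.* n} {r ℤ.* s} (∣-by-eq (f m n r s)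
      (ℤ∣.∣m∣n⇒∣m+n (ℤ∣.∣m⇒∣m*n n (∣-residue m)) (ℤ∣.∣n⇒∣m*n r (∣-residue n)))))) h
  module _ (m : ℕ) where
    j : Fin 3
    j = fromℕ< (ℕ/.m%n<n m 3)
    t : ℕ
    t = m ℕ./ 3
    m≡ : m ≡ toℕ j ℕ.+ 3 ℕ.* t
    m≡ = trans (ℕ/.m≡m%n+[m/n]*n m 3) (cong₂ ℕ._+_ (sym (Finₚ.toℕ-fromℕ< (ℕ/.m%n<n m 3))) (ℕₚ.*-comm (m ℕ./ 3) 3))
    pow≡ : ∀ a i → emb a ^ᴱ (i ℕ.+ 3 ℕ.* t) ≡ emb a ^ᴱ i
    pow≡ a i = trans (E.^-+ (emb a) i (3 ℕ.* t)) (trans (cong (emb a ^ᴱ i *ᴱ_) (emb-^3m a t)) (E.*-identityʳ _))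
    shift : ∀ c → e (+ (c ℕ.+ 3 ℕ.* m)) ≡ e (+ (c ℕ.+ 3 ℕ.* toℕ j))
    shift c = cong ω-table (residue-cong {+ (c ℕ.+ 3 ℕ.* m)} {+ (c ℕ.+ 3 ℕ.* toℕ j)} (divides (+ t) (begin
      + (c ℕ.+ 3 ℕ.* m) ℤ.- + (c ℕ.+ 3 ℕ.* toℕ j)
        ≡⟨ cong (λ z → + (c ℕ.+ 3 ℕ.* z) ℤ.- + (c ℕ.+ 3 ℕ.* toℕ j)) m≡ ⟩
      + (c ℕ.+ 3 ℕ.* (toℕ j ℕ.+ 3 ℕ.* t)) ℤ.- + (c ℕ.+ 3 ℕ.* toℕ j)
        ≡⟨ cong₂ (λ u v → + c ℤ.+ u ℤ.- (+ c ℤ.+ v)) (trans (ℤₚ.pos-* 3 (toℕ j ℕ.+ 3 ℕ.* t)) (cong (λ z → + 3 ℤ.* (+ toℕ j ℤ.+ z)) (ℤₚ.pos-* 3 t))) (ℤₚ.pos-* 3 (toℕ j)) ⟩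
      + c ℤ.+ + 3 ℤ.* (+ toℕ j ℤ.+ + 3 ℤ.* + t) ℤ.- (+ c ℤ.+ + 3 ℤ.* + toℕ j)
        ≡⟨ f (+ c) (+ toℕ j) (+ t) ⟩
      + t ℤ.* + 9 ∎)))
      where
      open ≡.≡-Reasoning
      f : ∀ c j t → c ℤ.+ + 3 ℤ.* (j ℤ.+ + 3 ℤ.* t) ℤ.- (c ℤ.+ + 3 ℤ.* j) ≡ t ℤ.* + 9
      f = solve-∀
    first : emb c1 ^ᴱ m ≡ emb (e (+ suc (3 ℕ.* m))) *ᴱ emb c2 ^ᴱ m
    first = trans (cong (emb c1 ^ᴱ_) m≡) (trans (pow≡ c1 (toℕ j)) (trans (proj₁ (ω-powers j))
      (cong₂ (λ u v → emb u *ᴱ v) (sym (shift 1)) (sym (trans (cong (emb c2 ^ᴱ_) m≡) (pow≡ c2 (toℕ j)))))))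
    second : emb c1 ^ᴱ suc m ≡ emb (inv (e (+ suc (suc (3 ℕ.* m))))) *ᴱ emb c2 ^ᴱ suc m
    second = trans (cong (λ z → emb c1 ^ᴱ suc z) m≡) (trans (pow≡ c1 (suc (toℕ j))) (trans (proj₂ (ω-powers j))
      (cong₂ (λ u v → emb (inv u) *ᴱ v) (sym (shift 2)) (sym (trans (cong (λ z → emb c2 ^ᴱ suc z) m≡) (pow≡ c2 (suc (toℕ j))))))))

-- Reciprocity for primitive primary elements and the symbol of b/3

norm-abs : ∀ x → norm x ≡ + ℤ.∣ norm x ∣
norm-abs x = go (norm x) (trans (f (re x) (im x)) (cong₂ ℤ._+_ (square-abs (+ 2 ℤ.* re x ℤ.- im x))
    (trans (cong (+ 3 ℤ.*_) (square-abs (im x))) (sym (ℤₚ.pos-* 3 (ℤ.∣ im x ∣ ℕ.* ℤ.∣ im x ∣))))))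
  where
  f : ∀ a b → + 4 ℤ.* (a ℤ.* a ℤ.- a ℤ.* b ℤ.+ b ℤ.* b) ≡ (+ 2 ℤ.* a ℤ.- b) ℤ.* (+ 2 ℤ.* a ℤ.- b) ℤ.+ + 3 ℤ.* (b ℤ.* b)
  f = solve-∀
  go : ∀ i {n} → + 4 ℤ.* i ≡ + n → i ≡ + ℤ.∣ i ∣
  go (+ _) _ = refl

3∤norm : ∀ α → + 3 ∣ im α → ¬ (+ 3 ∣ re α) → ¬ (+ 3 ∣ norm α)
3∤norm ⟨ a , b ⟩ 3∣b 3∤a d = prime∤* prime-3 3∤a 3∤a (∣-by-eq (f a b) (ℤ∣.∣m∣n⇒∣m+n d (ℤ∣.∣m⇒∣m*n (a ℤ.- b) 3∣b)))
  where
  f : ∀ a b → a ℤ.* a ℤ.- a ℤ.* b ℤ.+ b ℤ.* b ℤ.+ b ℤ.* (a ℤ.- b) ≡ a ℤ.* a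
  f = solve-∀

∤⇒≢0 : ∀ {q n} → ¬ (q ∣ n) → n ≢ + 0
∤⇒≢0 nd refl = nd (divides (+ 0) refl)

reciprocity : ∀ α → + 3 ∣ im α → ¬ (+ 3 ∣ re α) → Primitive α → Reciprocity α (norm α)
reciprocity α 3∣b 3∤a prim = subst (Reciprocity α) (sym (norm-abs α))
  (primary-reciprocity ℤ.∣ norm α ∣ (<-wellFounded _) {{ℕ.≢-nonZero (λ e → ∤⇒≢0 (3∤norm α 3∣b 3∤a) (ℤₚ.∣i∣≡0⇒i≡0 e))}} α (norm-abs α) 3∣b prim)

ratio-by-parts : ∀ {q} c c′ α β → q ∣ (c ℤ.* re α ℤ.- c′ ℤ.* re β) → q ∣ (c ℤ.* im α ℤ.- c′ ℤ.* im β) →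
                 int c *ᴱ α ≈ int c′ *ᴱ β [ q ]
ratio-by-parts {q} c c′ α β d e = subst₂ (λ x y → x ≈ y [ q ]) (sym (int-* c α)) (sym (int-* c′ β)) (∣∣⇒≈ d e)

0∣ : ∀ {q x} → x ≡ + 0 → q ∣ x
0∣ refl = divides (+ 0) refl

⊙-cancel : ∀ a b → a ≡ a ⊙ b → b ≡ c0
⊙-cancel c0 b  e = sym e
⊙-cancel c1 c0 e = refl
⊙-cancel c2 c0 e = refl

module _ {q : ℕ} (pr : Prime q) where
  q∣9⇒q≡3 : + q ∣ + 9 → q ≡ 3
  q∣9⇒q≡3 d = [ prime∣prime pr prime-3 , prime∣prime pr prime-3 ]′ (prime∣* pr (+ 3) (+ 3) d)

  ∣square : ∀ {x} → + q ∣ x ℤ.* x → + q ∣ x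
  ∣square {x} d = [ (λ e → e) , (λ e → e) ]′ (prime∣* pr x x d)

-- The symbol of b′ = b/3 modulo α = a + bω is trivial when 9 ∣ b. As b′ need not be prime to 3, reciprocity
-- does not apply to it; but r ≡ b′ modulo k = N(α), where m + 3rω = α(1 + 3kω), and r and m are prime to 3.
-- Modulo r and m, α is proportional to σ and ωσ = 3k + ω, so the symbols of r and m are those modulo σ, up to the
-- symbol of ω, and there r ≡ km.
module Supplement (a c : ℤ) (3∤a : ¬ (+ 3 ∣ a)) (prim : Primitive ⟨ a , + 9 ℤ.* c ⟩) where
  open import Data.Integer using (_+_; _*_; _-_; -_)

  b b′ k m r : ℤ
  b  = + 9 * c
  b′ = + 3 * c
  α σ : 𝔼
  α = ⟨ a , b ⟩
  k = norm α
  σ = ⟨ + 1 - + 3 * k , - (+ 3 * k) ⟩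
  m = a - + 3 * k * b
  r = k * a - k * b + b′

  3∣b : + 3 ∣ b
  3∣b = divides (+ 3 * c) (f c)
    where
    f : ∀ c → + 9 * c ≡ + 3 * c * + 3
    f = solve-∀

  3∤k : ¬ (+ 3 ∣ k)
  3∤k = 3∤norm α 3∣b 3∤a

  A : Reciprocity α k
  A = reciprocity α 3∣b 3∤a prim

  module _ {q : ℕ} (pr : Prime q) where
    k∣a : + q ∣ k → ¬ (+ q ∣ a)
    k∣a d e = prim pr e (∣square pr (∣-by-eq (f a b) (ℤ∣.∣m∣n⇒∣m-n d (ℤ∣.∣m⇒∣m*n (a - b) e))))
      where
      f : ∀ a b → a * a - a * b + b * b - a * (a - b) ≡ b * b
      f = solve-∀
    k∣b : + q ∣ k → ¬ (+ q ∣ b)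
    k∣b d e = prim pr (∣square pr (∣-by-eq (f a b) (ℤ∣.∣m∣n⇒∣m-n d (ℤ∣.∣m⇒∣m*n (b - a) e)))) e
      where
      f : ∀ a b → a * a - a * b + b * b - b * (b - a) ≡ a * a
      f = solve-∀
    k∣b′ : + q ∣ k → ¬ (+ q ∣ b′)
    k∣b′ d e = k∣b d (∣-by-eq (f c) (ℤ∣.∣n⇒∣m*n (+ 3) e))
      where
      f : ∀ c → + 3 * (+ 3 * c) ≡ + 9 * c
      f = solve-∀

  private
    3∣σ : + 3 ∣ im σ
    3∣σ = ℤ∣.∣m⇒∣-m (ℤ∣.∣m⇒∣m*n k ℤ∣.∣-refl)
    g₁ : ∀ z → + 1 - z + z ≡ + 1
    g₁ = solve-∀
    3∤σ : ¬ (+ 3 ∣ re σ)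
    3∤σ d = prime∤1 prime-3 (∣-by-eq (g₁ (+ 3 * k)) (ℤ∣.∣m∣n⇒∣m+n d (ℤ∣.∣m⇒∣m*n k ℤ∣.∣-refl)))
    σ-primitive : Primitive σ
    σ-primitive pr d e = prime∤1 pr (∣-by-eq (f (+ 3 * k)) (ℤ∣.∣m∣n⇒∣m-n d e))
      where
      f : ∀ z → + 1 - z - - z ≡ + 1
      f = solve-∀

    B : Reciprocity σ (norm σ)
    B = reciprocity σ 3∣σ 3∤σ σ-primitive
    W : Reciprocity (emb c1) (+ 9)
    W = ω-reciprocity
    WB : Reciprocity (emb c1 *ᴱ σ) (+ 9 * norm σ)
    WB = reciprocity-* W B
    module A = Reciprocity A
    module B = Reciprocity B
    module W = Reciprocity W

    module _ {q : ℕ} (pr : Prime q) where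
      m∣k : + q ∣ m → ¬ (+ q ∣ k)
      m∣k d e = k∣a pr e (∣-by-eq (f a k b) (ℤ∣.∣m∣n⇒∣m+n d (ℤ∣.∣n⇒∣m*n (+ 3 * b) e)))
        where
        f : ∀ a k b → a - + 3 * k * b + + 3 * b * k ≡ a
        f = solve-∀
      m∣norm-σ : + q ∣ m → ¬ (+ q ∣ norm σ)
      m∣norm-σ d e = m∣k d (∣-by-eq (f a b k) (ℤ∣.∣m∣n⇒∣m+n (ℤ∣.∣n⇒∣m*n (b * b) e) (ℤ∣.∣m⇒∣m*n (a + + 3 * k * b - b) d)))
        where
        f : ∀ a b k → b * b * ((+ 1 - + 3 * k) * (+ 1 - + 3 * k) - (+ 1 - + 3 * k) * (- (+ 3 * k)) + (- (+ 3 * k)) * (- (+ 3 * k)))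
              + (a - + 3 * k * b) * (a + + 3 * k * b - b)
          ≡ a * a - a * b + b * b
        f = solve-∀
      m∣3 : + q ∣ m → q ≢ 3
      m∣3 d refl = 3∤a (∣-by-eq (f a k b) (ℤ∣.∣m∣n⇒∣m+n d (ℤ∣.∣m⇒∣m*n (k * b) ℤ∣.∣-refl)))
        where
        f : ∀ a k b → a - + 3 * k * b + + 3 * (k * b) ≡ a
        f = solve-∀
      r∣k : + q ∣ r → ¬ (+ q ∣ k)
      r∣k d e = k∣b′ pr e (∣-by-eq (f k a b b′) (ℤ∣.∣m∣n⇒∣m-n d (ℤ∣.∣m⇒∣m*n (a - b) e)))
        where
        f : ∀ k a b b′ → k * a - k * b + b′ - k * (a - b) ≡ b′
        f = solve-∀
      -- Uses 9 ∣ b: then 3 divides b and b′, so r ≡ ka (mod 3), a unit.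
      r∣3 : + q ∣ r → q ≢ 3
      r∣3 d refl = prime∤* prime-3 3∤k 3∤a (∣-by-eq (f k a c) (ℤ∣.∣m∣n⇒∣m+n d (ℤ∣.∣m⇒∣m*n (+ 3 * k * c - c) ℤ∣.∣-refl)))
        where
        f : ∀ k a c → k * a - k * (+ 9 * c) + + 3 * c + + 3 * (+ 3 * k * c - c) ≡ k * a
        f = solve-∀
      r∣norm-σ : + q ∣ r → ¬ (+ q ∣ norm σ)
      r∣norm-σ d e = prime∤* pr (prime∤* pr (prime∤* pr n3 (r∣k d)) (prime∤* pr n3 (r∣k d))) (r∣k d)
          (∣-by-eq (f a c k) (ℤ∣.∣m∣n⇒∣m+n (ℤ∣.∣n⇒∣m*n (b * b) e)
            (ℤ∣.∣n⇒∣m*n (+ 3 * (+ 3 * r - + 2 * b * (+ 1 - + 3 * k) - + 3 * k * b)) d)))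
        where
        n3 : ¬ (+ q ∣ + 3)
        n3 h = r∣3 d (prime∣prime pr prime-3 h)
        f : ∀ a c k → let b = + 9 * c ; r = k * a - k * (+ 9 * c) + + 3 * c ; N = a * a - a * (+ 9 * c) + + 9 * c * (+ 9 * c) in
          b * b * ((+ 1 - + 3 * k) * (+ 1 - + 3 * k) - (+ 1 - + 3 * k) * (- (+ 3 * k)) + (- (+ 3 * k)) * (- (+ 3 * k)))
              + + 3 * (+ 3 * r - + 2 * b * (+ 1 - + 3 * k) - + 3 * k * b) * r
          ≡ + 3 * k * (+ 3 * k) * N
        f = solve-∀
      k∣norm-σ : + q ∣ k → ¬ (+ q ∣ norm σ)
      k∣norm-σ d e = prime∤1 pr (∣-by-eq (f k) (ℤ∣.∣m∣n⇒∣m+n e (ℤ∣.∣n⇒∣m*n (+ 3 - + 9 * k) d)))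
        where
        f : ∀ k → (+ 1 - + 3 * k) * (+ 1 - + 3 * k) - (+ 1 - + 3 * k) * (- (+ 3 * k)) + (- (+ 3 * k)) * (- (+ 3 * k))
              + (+ 3 - + 9 * k) * k ≡ + 1
        f = solve-∀

    -- Modulo a prime factor of a, α = a + bω reduces to bω.
    χa≡ea : A.χ a ≡ W.χ a
    χa≡ea = compare A W a (∤⇒≢0 3∤a) λ q pr d → proportional {c = + 1} {c′ = b}
      (λ { refl → 3∤a d }) (λ e → k∣a pr e d) (λ e → 3∤a (subst (λ z → + z ∣ a) (q∣9⇒q≡3 pr e) d))
      (prime∤1 pr) (λ e → k∣a pr e d)
      (ratio-by-parts (+ 1) b α (emb c1) (∣-by-eq (f a b) d) (0∣ (g b)))
      where
      f : ∀ a b → a ≡ + 1 * a - b * + 0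
      f = solve-∀
      g : ∀ b → + 1 * b - b * + 1 ≡ + 0
      g = solve-∀

    -- Modulo a prime factor of m one has a ≡ 3kb, so α ≡ b(3k + ω) = bωσ.
    χm≡ : A.χ m ≡ W.χ m ⊙ B.χ m
    χm≡ = compare A WB m (∤⇒≢0 {+ 3} λ d → m∣3 prime-3 d refl) λ q pr d → proportional {c = + 1} {c′ = b}
      (m∣3 pr d) (m∣k pr d)
      (prime∤* pr (λ e → m∣3 pr d (q∣9⇒q≡3 pr e)) (m∣norm-σ pr d))
      (prime∤1 pr) (m∣k pr d)
      (subst (λ z → int (+ 1) *ᴱ α ≈ int b *ᴱ z [ + q ]) (sym (ω*σ k))
        (ratio-by-parts (+ 1) b α ⟨ + 3 * k , + 1 ⟩ (∣-by-eq (f a b k) d) (0∣ (g b))))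
      where
      f : ∀ a b k → a - + 3 * k * b ≡ + 1 * a - b * (+ 3 * k)
      f = solve-∀
      g : ∀ b → + 1 * b - b * + 1 ≡ + 0
      g = solve-∀

    -- 3r = 3ka + b(1 - 3k), so modulo a prime factor of r one has 3kα ≡ -bσ.
    χr≡ : A.χ r ≡ B.χ r
    χr≡ = compare A B r (∤⇒≢0 {+ 3} λ d → r∣3 prime-3 d refl) λ q pr d → proportional {c = + 3 * k} {c′ = - b}
      (r∣3 pr d) (r∣k pr d) (r∣norm-σ pr d)
      (prime∤* pr (λ e → r∣3 pr d (prime∣prime pr prime-3 e)) (r∣k pr d)) (r∣k pr d)
      (ratio-by-parts (+ 3 * k) (- b) α σ (∣-by-eq (f a c k) (ℤ∣.∣n⇒∣m*n (+ 3) d)) (0∣ (g b k)))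
      where
      f : ∀ a c k → + 3 * (k * a - k * (+ 9 * c) + + 3 * c) ≡ + 3 * k * a - - (+ 9 * c) * (+ 1 - + 3 * k)
      f = solve-∀
      g : ∀ b k → + 3 * k * b - - b * (- (+ 3 * k)) ≡ + 0
      g = solve-∀

    -- σ ≡ 1 modulo k, so σ may be replaced by 1 at every prime factor of k.
    ψk≡ : B.χ k ≡ c0
    ψk≡ = compare B (reciprocity-int (+ 1) (+ 1)) k (∤⇒≢0 3∤k) λ q pr d → proportional {c = + 1} {c′ = + 1}
      (λ { refl → 3∤k d }) (k∣norm-σ pr d) (prime∤1 pr) (prime∤1 pr) (k∣norm-σ pr d)
      (ratio-by-parts (+ 1) (+ 1) σ (int (+ 1)) (∣-by-eq (f k) (ℤ∣.∣n⇒∣m*n -[1+ 2 ] d)) (∣-by-eq (g k) (ℤ∣.∣n⇒∣m*n -[1+ 2 ] d)))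
      where
      f : ∀ k → -[1+ 2 ] * k ≡ + 1 * (+ 1 - + 3 * k) - + 1 * + 1
      f = solve-∀
      g : ∀ k → -[1+ 2 ] * k ≡ + 1 * (- (+ 3 * k)) - + 1 * + 0
      g = solve-∀

    -- r - km = b′(1 - 3k + 9k²) = b′N(σ), so r and km have the same symbol modulo σ, and that of k
    -- is trivial.
    ψr≡ : B.χ r ≡ B.χ m
    ψr≡ = trans (B.χ-periodic {r} {k * m} (∣-by-eq (f a c k) (ℤ∣.∣n⇒∣m*n b′ ℤ∣.∣-refl)))
      (trans (B.χ-* {k} {m} (λ pr d e → k∣norm-σ pr d e) (λ pr d e → m∣norm-σ pr d e)) (cong (_⊙ B.χ m) ψk≡))
      where
      f : ∀ a c k → + 3 * c * ((+ 1 - + 3 * k) * (+ 1 - + 3 * k) - (+ 1 - + 3 * k) * (- (+ 3 * k)) + (- (+ 3 * k)) * (- (+ 3 * k)))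
        ≡ k * a - k * (+ 9 * c) + + 3 * c - k * (a - + 3 * k * (+ 9 * c))
      f = solve-∀

    -- m agrees with a modulo k and modulo 9. Comparing the two formulas for their common symbol
    -- modulo α, the parts coming from ω cancel and the symbol of m modulo σ must be trivial.
    ψm≡ : B.χ m ≡ c0
    ψm≡ = ⊙-cancel (W.χ a) (B.χ m) (trans (sym χa≡ea) (trans (A.χ-periodic {a} {m} (∣-by-eq (f a k b) (ℤ∣.∣m⇒∣m*n (+ 3 * b) ℤ∣.∣-refl)))
      (trans χm≡ (cong (_⊙ B.χ m) (sym (W.χ-periodic {a} {m} (∣-by-eq (g a k c) (ℤ∣.∣m⇒∣m*n (+ 3 * k * c) ℤ∣.∣-refl))))))))
      where
      f : ∀ a k b → k * (+ 3 * b) ≡ a - (a - + 3 * k * b)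
      f = solve-∀
      g : ∀ a k c → + 9 * (+ 3 * k * c) ≡ a - (a - + 3 * k * (+ 9 * c))
      g = solve-∀

  χ-b′ : Reciprocity.χ A b′ ≡ c0
  χ-b′ = trans (sym (A.χ-periodic {r} {b′} (∣-by-eq (f k a b b′) (ℤ∣.∣m⇒∣m*n (a - b) ℤ∣.∣-refl)))) (trans χr≡ (trans ψr≡ ψm≡))
    where
    f : ∀ k a b b′ → k * (a - b) ≡ k * a - k * b + b′ - b′
    f = solve-∀

  b′⊥k : b′ ⊥ᴾ k
  b′⊥k pr d e = k∣b′ pr e d

-- The binomial sum modulo p

-- Indexed by both parts of the binomial coefficient, which makes its symmetry and its two
-- recurrences free of truncated subtraction.
choose : ℕ → ℕ → ℕ
choose j k = (j ℕ.+ k) C k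

choose-sucʳ : ∀ j k → suc k ℕ.* choose j (suc k) ≡ suc (j ℕ.+ k) ℕ.* choose j k
choose-sucʳ j k = trans (cong (λ z → suc k ℕ.* (z C suc k)) (ℕₚ.+-suc j k)) (absorption (j ℕ.+ k) k)

choose-sym : ∀ j k → choose j k ≡ choose k j
choose-sym j k = trans (nCk≡nC[n∸k] (ℕₚ.m≤n+m k j)) (cong₂ _C_ (ℕₚ.+-comm j k) (ℕₚ.m+n∸n≡m j k))

choose-sucˡ : ∀ j k → suc j ℕ.* choose (suc j) k ≡ suc (j ℕ.+ k) ℕ.* choose j k
choose-sucˡ j k = trans (cong (suc j ℕ.*_) (choose-sym (suc j) k)) (trans (choose-sucʳ k j)
  (cong₂ ℕ._*_ (cong suc (ℕₚ.+-comm k j)) (choose-sym k j)))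

choose-3k : ∀ k → suc k ℕ.* (suc (suc (2 ℕ.* k)) ℕ.* (suc (2 ℕ.* k) ℕ.* choose (2 ℕ.* suc k) (suc k)))
              ≡ (3 ℕ.* k ℕ.+ 3) ℕ.* ((3 ℕ.* k ℕ.+ 2) ℕ.* ((3 ℕ.* k ℕ.+ 1) ℕ.* choose (2 ℕ.* k) k))
choose-3k k = begin
  suc k ℕ.* (d₂ ℕ.* (d₁ ℕ.* choose (2 ℕ.* suc k) (suc k)))
    ≡⟨ cong (λ z → suc k ℕ.* (d₂ ℕ.* (d₁ ℕ.* choose z (suc k)))) (ℕₚ.*-suc 2 k) ⟩
  suc k ℕ.* (d₂ ℕ.* (d₁ ℕ.* choose d₂ (suc k)))
    ≡⟨ f (suc k) d₂ d₁ (choose d₂ (suc k)) ⟩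
  d₂ ℕ.* (d₁ ℕ.* (suc k ℕ.* choose d₂ (suc k)))
    ≡⟨ cong (λ z → d₂ ℕ.* (d₁ ℕ.* z)) (choose-sucʳ d₂ k) ⟩
  d₂ ℕ.* (d₁ ℕ.* (suc (d₂ ℕ.+ k) ℕ.* choose d₂ k))
    ≡⟨ g d₂ d₁ (suc (d₂ ℕ.+ k)) (choose d₂ k) ⟩
  suc (d₂ ℕ.+ k) ℕ.* (d₁ ℕ.* (d₂ ℕ.* choose d₂ k))
    ≡⟨ cong (λ z → suc (d₂ ℕ.+ k) ℕ.* (d₁ ℕ.* z)) (choose-sucˡ d₁ k) ⟩
  suc (d₂ ℕ.+ k) ℕ.* (d₁ ℕ.* (suc (d₁ ℕ.+ k) ℕ.* choose d₁ k))
    ≡⟨ h (suc (d₂ ℕ.+ k)) d₁ (suc (d₁ ℕ.+ k)) (choose d₁ k) ⟩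
  suc (d₂ ℕ.+ k) ℕ.* (suc (d₁ ℕ.+ k) ℕ.* (d₁ ℕ.* choose d₁ k))
    ≡⟨ cong (λ z → suc (d₂ ℕ.+ k) ℕ.* (suc (d₁ ℕ.+ k) ℕ.* z)) (choose-sucˡ (2 ℕ.* k) k) ⟩
  suc (d₂ ℕ.+ k) ℕ.* (suc (d₁ ℕ.+ k) ℕ.* (suc (2 ℕ.* k ℕ.+ k) ℕ.* choose (2 ℕ.* k) k))
    ≡⟨ e k (choose (2 ℕ.* k) k) ⟩
  (3 ℕ.* k ℕ.+ 3) ℕ.* ((3 ℕ.* k ℕ.+ 2) ℕ.* ((3 ℕ.* k ℕ.+ 1) ℕ.* choose (2 ℕ.* k) k)) ∎
  where
  open ≡.≡-Reasoning
  d₁ d₂ : ℕ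
  d₁ = suc (2 ℕ.* k)
  d₂ = suc (suc (2 ℕ.* k))
  f : ∀ a b c d → a ℕ.* (b ℕ.* (c ℕ.* d)) ≡ b ℕ.* (c ℕ.* (a ℕ.* d))
  f = ℕ-solve-∀
  g : ∀ a b c d → a ℕ.* (b ℕ.* (c ℕ.* d)) ≡ c ℕ.* (b ℕ.* (a ℕ.* d))
  g = ℕ-solve-∀
  h : ∀ a b c d → a ℕ.* (b ℕ.* (c ℕ.* d)) ≡ a ℕ.* (c ℕ.* (b ℕ.* d))
  h = ℕ-solve-∀
  e : ∀ k x → suc (suc (suc (2 ℕ.* k)) ℕ.+ k) ℕ.* (suc (suc (2 ℕ.* k) ℕ.+ k) ℕ.* (suc (2 ℕ.* k ℕ.+ k) ℕ.* x))
    ≡ (3 ℕ.* k ℕ.+ 3) ℕ.* ((3 ℕ.* k ℕ.+ 2) ℕ.* ((3 ℕ.* k ℕ.+ 1) ℕ.* x))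
  e = ℕ-solve-∀

choose-2k : ∀ j k → suc (suc (2 ℕ.* k)) ℕ.* (suc (2 ℕ.* k) ℕ.* choose j (2 ℕ.* suc k))
              ≡ (j ℕ.+ 2 ℕ.* k ℕ.+ 2) ℕ.* (suc j ℕ.* choose (suc j) (2 ℕ.* k))
choose-2k j k = begin
  d₂ ℕ.* (d₁ ℕ.* choose j (2 ℕ.* suc k))
    ≡⟨ cong (λ z → d₂ ℕ.* (d₁ ℕ.* choose j z)) (ℕₚ.*-suc 2 k) ⟩
  d₂ ℕ.* (d₁ ℕ.* choose j d₂)
    ≡⟨ f d₂ d₁ (choose j d₂) ⟩
  d₁ ℕ.* (d₂ ℕ.* choose j d₂)
    ≡⟨ cong (d₁ ℕ.*_) (choose-sucʳ j d₁) ⟩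
  d₁ ℕ.* (suc (j ℕ.+ d₁) ℕ.* choose j d₁)
    ≡⟨ f d₁ (suc (j ℕ.+ d₁)) (choose j d₁) ⟩
  suc (j ℕ.+ d₁) ℕ.* (d₁ ℕ.* choose j d₁)
    ≡⟨ cong (suc (j ℕ.+ d₁) ℕ.*_) (trans (choose-sucʳ j (2 ℕ.* k)) (sym (choose-sucˡ j (2 ℕ.* k)))) ⟩
  suc (j ℕ.+ d₁) ℕ.* (suc j ℕ.* choose (suc j) (2 ℕ.* k))
    ≡⟨ cong (ℕ._* (suc j ℕ.* choose (suc j) (2 ℕ.* k))) (g j (2 ℕ.* k)) ⟩
  (j ℕ.+ 2 ℕ.* k ℕ.+ 2) ℕ.* (suc j ℕ.* choose (suc j) (2 ℕ.* k)) ∎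
  where
  open ≡.≡-Reasoning
  d₁ d₂ : ℕ
  d₁ = suc (2 ℕ.* k)
  d₂ = suc (suc (2 ℕ.* k))
  f : ∀ a b c → a ℕ.* (b ℕ.* c) ≡ b ℕ.* (a ℕ.* c)
  f = ℕ-solve-∀
  g : ∀ j k → suc (j ℕ.+ suc k) ≡ j ℕ.+ k ℕ.+ 2
  g = ℕ-solve-∀

z : ℤ
z = -[1+ 26 ]

-- The Morgan-Voyce polynomials b_n and B_n at z.
small big : ℕ → ℤ
small n = Σℤ (λ k → + ((n ℕ.+ k) C (2 ℕ.* k)) ℤ.* z Z.^ k) (suc n)
big n   = Σℤ (λ k → + ((suc n ℕ.+ k) C suc (2 ℕ.* k)) ℤ.* z Z.^ k) (suc n)

-- Pascal's rule in each term. The two sums differ in length by a term with C(2n + 1, 2n + 2) = 0.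
small-suc : ∀ n → small (suc n) ≡ small n ℤ.+ z ℤ.* big n
small-suc n = begin
  Σℤ (t (suc n)) (suc (suc n))
    ≡⟨ Z.Σ-head (suc n) (t (suc n)) ⟩
  t (suc n) 0 ℤ.+ Σℤ (λ k → t (suc n) (suc k)) (suc n)
    ≡⟨ cong (λ y → t n 0 ℤ.+ y) (Z.Σ-cong (suc n) split) ⟩
  t n 0 ℤ.+ Σℤ (λ k → t n (suc k) ℤ.+ z ℤ.* s k) (suc n)
    ≡⟨ cong (λ y → t n 0 ℤ.+ y) (Z.Σ-+ (suc n) (λ k → t n (suc k)) (λ k → z ℤ.* s k)) ⟩
  t n 0 ℤ.+ (Σℤ (λ k → t n (suc k)) (suc n) ℤ.+ Σℤ (λ k → z ℤ.* s k) (suc n))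
    ≡⟨ ℤₚ.+-assoc (t n 0) (Σℤ (λ k → t n (suc k)) (suc n)) _ ⟨
  t n 0 ℤ.+ Σℤ (λ k → t n (suc k)) (suc n) ℤ.+ Σℤ (λ k → z ℤ.* s k) (suc n)
    ≡⟨ cong₂ ℤ._+_ (sym (Z.Σ-head (suc n) (t n))) (Z.Σ-*ˡ (suc n) z s) ⟩
  Σℤ (t n) (suc n) ℤ.+ t n (suc n) ℤ.+ z ℤ.* big n
    ≡⟨ cong (λ y → Σℤ (t n) (suc n) ℤ.+ y ℤ.+ z ℤ.* big n) (cong (λ c → + c ℤ.* z Z.^ suc n) (k>n⇒nCk≡0 {n ℕ.+ suc n} (over n))) ⟩
  Σℤ (t n) (suc n) ℤ.+ + 0 ℤ.+ z ℤ.* big n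
    ≡⟨ cong (ℤ._+ z ℤ.* big n) (ℤₚ.+-identityʳ (small n)) ⟩
  small n ℤ.+ z ℤ.* big n ∎
  where
  open ≡.≡-Reasoning
  t : ℕ → ℕ → ℤ
  t n k = + ((n ℕ.+ k) C (2 ℕ.* k)) ℤ.* z Z.^ k
  s : ℕ → ℤ
  s k = + ((suc n ℕ.+ k) C suc (2 ℕ.* k)) ℤ.* z Z.^ k
  over : ∀ n → n ℕ.+ suc n ℕ.< 2 ℕ.* suc n
  over n = ℕₚ.≤-reflexive (f n)
    where
    f : ∀ n → suc (n ℕ.+ suc n) ≡ 2 ℕ.* suc n
    f = ℕ-solve-∀
  f : ∀ x y z w → (x ℤ.+ y) ℤ.* (z ℤ.* w) ≡ y ℤ.* (z ℤ.* w) ℤ.+ z ℤ.* (x ℤ.* w)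
  f = solve-∀
  split : ∀ k → t (suc n) (suc k) ≡ t n (suc k) ℤ.+ z ℤ.* s k
  split k = trans (cong (λ c → + c ℤ.* z Z.^ suc k) pascal)
                  (f (+ ((suc n ℕ.+ k) C suc (2 ℕ.* k))) (+ ((n ℕ.+ suc k) C (2 ℕ.* suc k))) z (z Z.^ k))
    where
    pascal : (suc n ℕ.+ suc k) C (2 ℕ.* suc k) ≡ (suc n ℕ.+ k) C suc (2 ℕ.* k) ℕ.+ (n ℕ.+ suc k) C (2 ℕ.* suc k)
    pascal = begin
      (suc n ℕ.+ suc k) C (2 ℕ.* suc k)
        ≡⟨ cong₂ _C_ (cong suc (ℕₚ.+-suc n k)) (ℕₚ.*-suc 2 k) ⟩
      suc (suc n ℕ.+ k) C suc (suc (2 ℕ.* k))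
        ≡⟨ nCk+nC[k+1]≡[n+1]C[k+1] (suc n ℕ.+ k) (suc (2 ℕ.* k)) ⟨
      (suc n ℕ.+ k) C suc (2 ℕ.* k) ℕ.+ (suc n ℕ.+ k) C suc (suc (2 ℕ.* k))
        ≡⟨ cong ((suc n ℕ.+ k) C suc (2 ℕ.* k) ℕ.+_) (cong₂ _C_ (sym (ℕₚ.+-suc n k)) (sym (ℕₚ.*-suc 2 k))) ⟩
      (suc n ℕ.+ k) C suc (2 ℕ.* k) ℕ.+ (n ℕ.+ suc k) C (2 ℕ.* suc k) ∎

big-suc : ∀ n → big (suc n) ≡ big n ℤ.+ small (suc n)
big-suc n = begin
  Σℤ (s (suc n)) (suc (suc n))
    ≡⟨ Z.Σ-cong (suc (suc n)) split ⟩
  Σℤ (λ k → s n k ℤ.+ t k) (suc (suc n))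
    ≡⟨ Z.Σ-+ (suc (suc n)) (s n) t ⟩
  Σℤ (s n) (suc n) ℤ.+ s n (suc n) ℤ.+ small (suc n)
    ≡⟨ cong (λ y → big n ℤ.+ y ℤ.+ small (suc n)) (cong (λ c → + c ℤ.* z Z.^ suc n) (k>n⇒nCk≡0 {suc n ℕ.+ suc n} (over n))) ⟩
  big n ℤ.+ + 0 ℤ.+ small (suc n)
    ≡⟨ cong (ℤ._+ small (suc n)) (ℤₚ.+-identityʳ (big n)) ⟩
  big n ℤ.+ small (suc n) ∎
  where
  open ≡.≡-Reasoning
  s : ℕ → ℕ → ℤ
  s n k = + ((suc n ℕ.+ k) C suc (2 ℕ.* k)) ℤ.* z Z.^ k
  t : ℕ → ℤ
  t k = + ((suc n ℕ.+ k) C (2 ℕ.* k)) ℤ.* z Z.^ k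
  over : ∀ n → suc n ℕ.+ suc n ℕ.< suc (2 ℕ.* suc n)
  over n = ℕₚ.≤-reflexive (f n)
    where
    f : ∀ n → suc (suc n ℕ.+ suc n) ≡ suc (2 ℕ.* suc n)
    f = ℕ-solve-∀
  f : ∀ x y w → (x ℤ.+ y) ℤ.* w ≡ y ℤ.* w ℤ.+ x ℤ.* w
  f = solve-∀
  split : ∀ k → s (suc n) k ≡ s n k ℤ.+ t k
  split k = trans (cong (λ c → + c ℤ.* z Z.^ k) (sym (nCk+nC[k+1]≡[n+1]C[k+1] (suc n ℕ.+ k) (2 ℕ.* k))))
                  (f (+ ((suc n ℕ.+ k) C (2 ℕ.* k))) (+ ((suc n ℕ.+ k) C suc (2 ℕ.* k))) (z Z.^ k))

-- In terms of ρ = X/Y, b_n = (ρⁿ⁺¹ + ρ⁻ⁿ)/(ρ + 1) and B_n = (ρⁿ⁺¹ − ρ⁻ⁿ⁻¹)/(ρ − ρ⁻¹), where z = ρ + ρ⁻¹ − 2.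
opaque
  unfolding _+ᴱ_

  int-+ : ∀ a b → int (a ℤ.+ b) ≡ int a +ᴱ int b
  int-+ a b = refl

  int-mul : ∀ a b → int (a ℤ.* b) ≡ int a *ᴱ int b
  int-mul a b = sym (trans (int-* a (int b)) (cong ⟨ a ℤ.* b ,_⟩ (ℤₚ.*-zeroʳ a)))

  small-step : ∀ X Y b B P ζ → (b +ᴱ ζ *ᴱ B) *ᴱ ((X *ᴱ Y) *ᴱ P) *ᴱ (X +ᴱ Y)
    ≡ (X *ᴱ Y) *ᴱ (b *ᴱ P *ᴱ (X +ᴱ Y)) +ᴱ (ζ *ᴱ (X *ᴱ Y)) *ᴱ (B *ᴱ P *ᴱ (X +ᴱ Y))
  small-step = ring-∀ 𝔼-acr

  small-regroup : ∀ X Y B P → ((X +ᴱ -ᴱ Y) *ᴱ (X +ᴱ -ᴱ Y)) *ᴱ (B *ᴱ P *ᴱ (X +ᴱ Y)) ≡ (X +ᴱ -ᴱ Y) *ᴱ (B *ᴱ P *ᴱ (X *ᴱ X +ᴱ -ᴱ (Y *ᴱ Y)))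
  small-regroup = ring-∀ 𝔼-acr

  small-collect : ∀ X Y x y → (X *ᴱ Y) *ᴱ (x +ᴱ y) +ᴱ (X +ᴱ -ᴱ Y) *ᴱ (X *ᴱ x +ᴱ -ᴱ (Y *ᴱ y)) ≡ X *ᴱ (X *ᴱ x) +ᴱ Y *ᴱ (Y *ᴱ y)
  small-collect = ring-∀ 𝔼-acr

  big-step : ∀ X Y b B P → (B +ᴱ b) *ᴱ ((X *ᴱ Y) *ᴱ P) *ᴱ (X *ᴱ X +ᴱ -ᴱ (Y *ᴱ Y))
    ≡ (X *ᴱ Y) *ᴱ (B *ᴱ P *ᴱ (X *ᴱ X +ᴱ -ᴱ (Y *ᴱ Y))) +ᴱ (X +ᴱ -ᴱ Y) *ᴱ (b *ᴱ ((X *ᴱ Y) *ᴱ P) *ᴱ (X +ᴱ Y))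
  big-step = ring-∀ 𝔼-acr

  big-collect : ∀ X Y x y → (X *ᴱ Y) *ᴱ (X *ᴱ x +ᴱ -ᴱ (Y *ᴱ y)) +ᴱ (X +ᴱ -ᴱ Y) *ᴱ (X *ᴱ (X *ᴱ x) +ᴱ Y *ᴱ (Y *ᴱ y))
    ≡ X *ᴱ (X *ᴱ (X *ᴱ x)) +ᴱ -ᴱ (Y *ᴱ (Y *ᴱ (Y *ᴱ y)))
  big-collect = ring-∀ 𝔼-acr

  base-small : ∀ X Y → 1ᴱ *ᴱ 1ᴱ *ᴱ (X +ᴱ Y) ≡ X *ᴱ 1ᴱ +ᴱ Y *ᴱ 1ᴱ
  base-small = ring-∀ 𝔼-acr

  base-big : ∀ X Y → 1ᴱ *ᴱ 1ᴱ *ᴱ (X *ᴱ X +ᴱ -ᴱ (Y *ᴱ Y)) ≡ X *ᴱ (X *ᴱ 1ᴱ) +ᴱ -ᴱ (Y *ᴱ (Y *ᴱ 1ᴱ))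
  base-big = ring-∀ 𝔼-acr

module _ {p : ℤ} (X Y : 𝔼) (rel : int z *ᴱ (X *ᴱ Y) ≈ (X +ᴱ -ᴱ Y) *ᴱ (X +ᴱ -ᴱ Y) [ p ]) where
  open RingTheory (E/ p)

  private
    -- T to the power 2n + 1, in the shape that the induction produces.
    odd : ℕ → 𝔼 → 𝔼
    odd zero    T = T * 1#
    odd (suc n) T = T * (T * odd n T)

    -- The closed forms of bₙ and Bₙ cleared of denominators, so that X, Y and X ± Y need not be
    -- invertible. The recurrences couple the two, hence a simultaneous induction.
    closed : ∀ n → (int (small n) * (X * Y) ^ n * (X + Y) ≈ odd n X + odd n Y)
                 × (int (big n) * (X * Y) ^ n * (X * X + - (Y * Y)) ≈ X * odd n X + - (Y * odd n Y))
    closed zero = ≡⇒≈ (base-small X Y) , ≡⇒≈ (base-big X Y)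
    closed (suc n) = first , second
      where
      P : 𝔼
      P = (X * Y) ^ n
      first : int (small (suc n)) * (X * Y) ^ suc n * (X + Y) ≈ odd (suc n) X + odd (suc n) Y
      first = begin
        int (small (suc n)) * ((X * Y) * P) * (X + Y)
          ≡⟨ cong (λ c → c *ᴱ ((X *ᴱ Y) *ᴱ P) *ᴱ (X +ᴱ Y))
               (trans (cong int (small-suc n)) (trans (int-+ (small n) (z ℤ.* big n)) (cong (int (small n) +ᴱ_) (int-mul z (big n))))) ⟩
        (int (small n) + int z * int (big n)) * ((X * Y) * P) * (X + Y)
          ≡⟨ small-step X Y (int (small n)) (int (big n)) P (int z) ⟩
        (X * Y) * (int (small n) * P * (X + Y)) + (int z * (X * Y)) * (int (big n) * P * (X + Y))
          ≈⟨ +-cong (*-congˡ {X * Y} (proj₁ (closed n))) (*-congʳ rel) ⟩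
        (X * Y) * (odd n X + odd n Y) + ((X + - Y) * (X + - Y)) * (int (big n) * P * (X + Y))
          ≈⟨ +-congˡ (≡⇒≈ (small-regroup X Y (int (big n)) P)) ⟩
        (X * Y) * (odd n X + odd n Y) + (X + - Y) * (int (big n) * P * (X * X + - (Y * Y)))
          ≈⟨ +-congˡ (*-congˡ {X + - Y} (proj₂ (closed n))) ⟩
        (X * Y) * (odd n X + odd n Y) + (X + - Y) * (X * odd n X + - (Y * odd n Y))
          ≡⟨ small-collect X Y (odd n X) (odd n Y) ⟩
        odd (suc n) X + odd (suc n) Y ∎
      second : int (big (suc n)) * (X * Y) ^ suc n * (X * X + - (Y * Y)) ≈ X * odd (suc n) X + - (Y * odd (suc n) Y)
      second = begin
        int (big (suc n)) * ((X * Y) * P) * (X * X + - (Y * Y))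
          ≡⟨ cong (λ c → c *ᴱ ((X *ᴱ Y) *ᴱ P) *ᴱ (X *ᴱ X +ᴱ -ᴱ (Y *ᴱ Y))) (trans (cong int (big-suc n)) (int-+ (big n) (small (suc n)))) ⟩
        (int (big n) + int (small (suc n))) * ((X * Y) * P) * (X * X + - (Y * Y))
          ≡⟨ big-step X Y (int (small (suc n))) (int (big n)) P ⟩
        (X * Y) * (int (big n) * P * (X * X + - (Y * Y))) + (X + - Y) * (int (small (suc n)) * ((X * Y) * P) * (X + Y))
          ≈⟨ +-cong (*-congˡ {X * Y} (proj₂ (closed n))) (*-congˡ {X + - Y} first) ⟩
        (X * Y) * (X * odd n X + - (Y * odd n Y)) + (X + - Y) * (odd (suc n) X + odd (suc n) Y)
          ≡⟨ big-collect X Y (odd n X) (odd n Y) ⟩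
        X * odd (suc n) X + - (Y * odd (suc n) Y) ∎

    odd≡ : ∀ n T → odd n T ≈ T * (T ^ n * T ^ n)
    odd≡ zero    T = *-congˡ {T} (≈sym (*-identityˡ 1#))
    odd≡ (suc n) T = *-congˡ {T} (≈trans (*-congˡ {T} (odd≡ n T)) (≈trans (≈sym (*-assoc T T _)) (*-interchange T T (T ^ n) (T ^ n))))

  morgan-voyce : ∀ n → int (small n) * (X * Y) ^ n * (X + Y) ≈ X * (X ^ n * X ^ n) + Y * (Y ^ n * Y ^ n)
  morgan-voyce n = ≈trans (proj₁ (closed n)) (+-cong (odd≡ n X) (odd≡ n Y))

module BinomialSum {p n : ℕ} (pr : Prime p) (p≡ : p ≡ 1 ℕ.+ 3 ℕ.* n ⊎ p ≡ 2 ℕ.+ 3 ℕ.* n) where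
  open import Data.Integer using (_+_; _*_; _-_; -_)

  2n<p : 2 ℕ.* n ℕ.< p
  2n<p = [ (λ e → subst (2 ℕ.* n ℕ.<_) (sym e) (ℕ.s≤s 2n≤3n))
         , (λ e → subst (2 ℕ.* n ℕ.<_) (sym e) (ℕ.s≤s (ℕₚ.m≤n⇒m≤1+n 2n≤3n))) ]′ p≡
    where
    2n≤3n : 2 ℕ.* n ℕ.≤ 3 ℕ.* n
    2n≤3n = ℕₚ.m≤n+m (2 ℕ.* n) n

  private
    -- The expression equals 3(3n + 1)(3n + 2), and one of the last two factors is p. Both classes
    -- of p modulo 3 are covered at once, and this is where -27 originates.
    ratio-mod-p : ∀ k j → suc (k ℕ.+ j) ≡ n → + p ∣ (+ 3 * ((+ 3 * + k + + 2) * (+ 3 * + k + + 1)) + + 27 * ((+ j + + 2 * + k + + 2) * (+ 1 + + j)))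
    ratio-mod-p k j refl = [ (λ e → divides (+ 3 * N₂) (trans (f₁ (+ k) (+ j)) (cong (λ q → + 3 * N₂ * q) (sym (trans (cong +_ e) (pos 1))))))
                    , (λ e → divides (+ 3 * N₁) (trans (f₂ (+ k) (+ j)) (cong (λ q → + 3 * N₁ * q) (sym (trans (cong +_ e) (pos 2)))))) ]′ p≡
      where
      N₁ N₂ : ℤ
      N₁ = + 1 + + 3 * (+ 1 + (+ k + + j))
      N₂ = + 2 + + 3 * (+ 1 + (+ k + + j))
      pos : ∀ ε → + (ε ℕ.+ 3 ℕ.* suc (k ℕ.+ j)) ≡ + ε + + 3 * (+ 1 + (+ k + + j))
      pos ε = cong (λ q → + ε + q) (ℤₚ.pos-* 3 (suc (k ℕ.+ j)))
      f₁ : ∀ k j → + 3 * ((+ 3 * k + + 2) * (+ 3 * k + + 1)) + + 27 * ((j + + 2 * k + + 2) * (+ 1 + j))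
         ≡ + 3 * (+ 2 + + 3 * (+ 1 + (k + j))) * (+ 1 + + 3 * (+ 1 + (k + j)))
      f₁ = solve-∀
      f₂ : ∀ k j → + 3 * ((+ 3 * k + + 2) * (+ 3 * k + + 1)) + + 27 * ((j + + 2 * k + + 2) * (+ 1 + j))
         ≡ + 3 * (+ 1 + + 3 * (+ 1 + (k + j))) * (+ 2 + + 3 * (+ 1 + (k + j)))
      f₂ = solve-∀

  -- Consecutive terms have ratios 3(3k + 1)(3k + 2) and -27(n + k + 1)(n - k) over the common
  -- denominator (2k + 1)(2k + 2), and the numerators agree modulo p. With j = n - k - 1 the latter
  -- factors are j + 2k + 2 and j + 1.
  termwise : ∀ k j → k ℕ.+ j ≡ n → + p ∣ (+ choose (2 ℕ.* k) k - + choose j (2 ℕ.* k) * z Z.^ k)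
  termwise zero    j e = divides (+ 0) refl
  termwise (suc k) j e = cancelled
    where
    K c w T t′ c′ : ℤ
    K = + k
    c = + choose (suc j) (2 ℕ.* k)
    w = z Z.^ k
    T = + choose (2 ℕ.* k) k
    t′ = + choose (2 ℕ.* suc k) (suc k)
    c′ = + choose j (2 ℕ.* suc k)
    ih : + p ∣ (T - c * w)
    ih = termwise k (suc j) (trans (ℕₚ.+-suc k j) e)
    d₁ d₂ : ℕ
    d₁ = suc (2 ℕ.* k)
    d₂ = suc d₁
    left : + suc k * (+ d₂ * (+ d₁ * t′)) ≡ (+ 3 * K + + 3) * ((+ 3 * K + + 2) * ((+ 3 * K + + 1) * T))
    left = begin
      + suc k * (+ d₂ * (+ d₁ * t′))
        ≡⟨ cong (λ q → + suc k * (+ d₂ * q)) (ℤₚ.pos-* d₁ t) ⟨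
      + suc k * (+ d₂ * + (d₁ ℕ.* t))
        ≡⟨ cong (+ suc k ℤ.*_) (ℤₚ.pos-* d₂ (d₁ ℕ.* t)) ⟨
      + suc k * + (d₂ ℕ.* (d₁ ℕ.* t))
        ≡⟨ ℤₚ.pos-* (suc k) (d₂ ℕ.* (d₁ ℕ.* t)) ⟨
      + (suc k ℕ.* (d₂ ℕ.* (d₁ ℕ.* t)))
        ≡⟨ cong +_ (choose-3k k) ⟩
      + ((3 ℕ.* k ℕ.+ 3) ℕ.* ((3 ℕ.* k ℕ.+ 2) ℕ.* ((3 ℕ.* k ℕ.+ 1) ℕ.* choose (2 ℕ.* k) k)))
        ≡⟨ ℤₚ.pos-* (3 ℕ.* k ℕ.+ 3) ((3 ℕ.* k ℕ.+ 2) ℕ.* ((3 ℕ.* k ℕ.+ 1) ℕ.* choose (2 ℕ.* k) k)) ⟩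
      + (3 ℕ.* k ℕ.+ 3) * + ((3 ℕ.* k ℕ.+ 2) ℕ.* ((3 ℕ.* k ℕ.+ 1) ℕ.* choose (2 ℕ.* k) k))
        ≡⟨ cong₂ ℤ._*_ (lin 3) (trans (ℤₚ.pos-* (3 ℕ.* k ℕ.+ 2) ((3 ℕ.* k ℕ.+ 1) ℕ.* choose (2 ℕ.* k) k)) (cong₂ ℤ._*_ (lin 2) (trans (ℤₚ.pos-* (3 ℕ.* k ℕ.+ 1) (choose (2 ℕ.* k) k)) (cong (ℤ._* T) (lin 1))))) ⟩
      (+ 3 * K + + 3) * ((+ 3 * K + + 2) * ((+ 3 * K + + 1) * T)) ∎
      where
      open ≡.≡-Reasoning
      t : ℕ
      t = choose (2 ℕ.* suc k) (suc k)
      lin : ∀ i → + (3 ℕ.* k ℕ.+ i) ≡ + 3 * K + + i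
      lin i = cong (ℤ._+ + i) (ℤₚ.pos-* 3 k)
    right : + d₂ * (+ d₁ * c′) ≡ (+ j + + 2 * K + + 2) * ((+ 1 + + j) * c)
    right = begin
      + d₂ * (+ d₁ * c′)
        ≡⟨ trans (cong (+ d₂ ℤ.*_) (sym (ℤₚ.pos-* d₁ (choose j (2 ℕ.* suc k))))) (sym (ℤₚ.pos-* d₂ (d₁ ℕ.* choose j (2 ℕ.* suc k)))) ⟩
      + (d₂ ℕ.* (d₁ ℕ.* choose j (2 ℕ.* suc k)))
        ≡⟨ cong +_ (choose-2k j k) ⟩
      + ((j ℕ.+ 2 ℕ.* k ℕ.+ 2) ℕ.* (suc j ℕ.* choose (suc j) (2 ℕ.* k)))
        ≡⟨ trans (ℤₚ.pos-* (j ℕ.+ 2 ℕ.* k ℕ.+ 2) (suc j ℕ.* choose (suc j) (2 ℕ.* k))) (cong₂ ℤ._*_ (cong (λ q → + j + q + + 2) (ℤₚ.pos-* 2 k)) (ℤₚ.pos-* (suc j) (choose (suc j) (2 ℕ.* k)))) ⟩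
      (+ j + + 2 * K + + 2) * ((+ 1 + + j) * c) ∎
      where open ≡.≡-Reasoning
    bound : d₂ ℕ.< p
    bound = ℕₚ.≤-<-trans (ℕₚ.≤-trans (ℕₚ.≤-reflexive (sym (ℕₚ.*-suc 2 k))) (ℕₚ.*-monoʳ-≤ 2 (subst (suc k ℕ.≤_) e (ℕₚ.m≤m+n (suc k) j)))) 2n<p
    -- The denominators cleared are k + 1, 2k + 1 and 2k + 2, all below p because 2(k + 1) ≤ 2n < p.
    unit : ¬ (+ p ∣ + suc k * (+ d₂ * + d₁))
    unit = prime∤* pr (∤-small (ℕₚ.≤-<-trans (ℕ.s≤s (ℕₚ.≤-trans (ℕₚ.m≤m+n k (k ℕ.+ 0)) (ℕₚ.n≤1+n (2 ℕ.* k)))) bound))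
      (prime∤* pr (∤-small bound) (∤-small (ℕₚ.<-trans (ℕₚ.n<1+n d₁) bound)))
    combine : ∀ K T c w Q → (+ 3 * K + + 3) * ((+ 3 * K + + 2) * ((+ 3 * K + + 1) * T)) - (+ 1 + K) * (Q * c) * (-[1+ 26 ] * w)
      ≡ (+ 3 * K + + 3) * ((+ 3 * K + + 2) * (+ 3 * K + + 1)) * (T - c * w)
        + (c * w * (+ 1 + K)) * (+ 3 * ((+ 3 * K + + 2) * (+ 3 * K + + 1)) + + 27 * Q)
    combine = solve-∀
    Q : ℤ
    Q = (+ j + + 2 * K + + 2) * (+ 1 + + j)
    scaled : (+ suc k * (+ d₂ * + d₁)) * (t′ - c′ * (z * w))
           ≡ (+ 3 * K + + 3) * ((+ 3 * K + + 2) * ((+ 3 * K + + 1) * T)) - (+ 1 + K) * (Q * c) * (z * w)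
    scaled = trans (f (+ suc k) (+ d₂) (+ d₁) t′ c′ (z * w)) (cong₂ ℤ._-_ left
      (cong (λ q → + suc k * q * (z * w)) (trans right (sym (ℤₚ.*-assoc (+ j + + 2 * K + + 2) (+ 1 + + j) c)))))
      where
      f : ∀ a b d t c y → (a * (b * d)) * (t - c * y) ≡ a * (b * (d * t)) - a * (b * (d * c)) * y
      f = solve-∀
    divisible : + p ∣ (+ suc k * (+ d₂ * + d₁)) * (t′ - c′ * (z * w))
    divisible = ∣-by-eq (sym (trans scaled (combine K T c w Q)))
      (ℤ∣.∣m∣n⇒∣m+n (ℤ∣.∣n⇒∣m*n ((+ 3 * K + + 3) * ((+ 3 * K + + 2) * (+ 3 * K + + 1))) ih)
        (ℤ∣.∣n⇒∣m*n (c * w * (+ 1 + K)) (ratio-mod-p k j e)))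
    cancelled : + p ∣ (t′ - c′ * (z * w))
    cancelled = [ (λ d → contradiction d unit) , (λ d → d) ]′
      (prime∣* pr (+ suc k * (+ d₂ * + d₁)) (t′ - c′ * (z * w)) divisible)

  sumBinom3≡ : ∀ m → + sumBinom3 m ≡ Σℤ (λ k → + choose (2 ℕ.* k) k) (suc m)
  sumBinom3≡ zero    = refl
  sumBinom3≡ (suc m) = cong₂ ℤ._+_ (sumBinom3≡ m) (cong (λ q → + (q C suc m)) (f (suc m)))
    where
    f : ∀ k → 3 ℕ.* k ≡ 2 ℕ.* k ℕ.+ k
    f = ℕ-solve-∀

  Σ-sub-∣ : ∀ m {f g : ℕ → ℤ} → (∀ i → i ℕ.< m → + p ∣ (f i - g i)) → + p ∣ (Σℤ f m - Σℤ g m)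
  Σ-sub-∣ zero    h = divides (+ 0) refl
  Σ-sub-∣ (suc m) {f} {g} h = ∣-by-eq (e (Σℤ f m) (f m) (Σℤ g m) (g m))
    (ℤ∣.∣m∣n⇒∣m+n (Σ-sub-∣ m (λ i q → h i (ℕₚ.m<n⇒m<1+n q))) (h m ℕₚ.≤-refl))
    where
    e : ∀ a b c d → (a - c) + (b - d) ≡ a + b - (c + d)
    e = solve-∀

  sum≡small : + p ∣ (+ sumBinom3 n - small n)
  sum≡small = subst (λ s → + p ∣ (s - small n)) (sym (sumBinom3≡ n)) (Σ-sub-∣ (suc n) λ k k<n →
    let j = n ℕ.∸ k ; e = ℕₚ.m+[n∸m]≡n (ℕₚ.≤-pred k<n) in
    subst (λ q → + p ∣ (+ choose (2 ℕ.* k) k - + (q C (2 ℕ.* k)) * z Z.^ k)) (trans (g j k) (cong (ℕ._+ k) e)) (termwise k j e))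
    where
    g : ∀ j k → j ℕ.+ 2 ℕ.* k ≡ k ℕ.+ j ℕ.+ k
    g = ℕ-solve-∀

-- Evaluation at a represented prime

-- The trace to ℤ of a + bω multiplied by a cube root of unity.
tr : C₃ → ℤ → ℤ → ℤ
tr c0 a b = + 2 ℤ.* a ℤ.- b
tr c1 a b = ℤ.- a ℤ.- b
tr c2 a b = + 2 ℤ.* b ℤ.- a

opaque
  unfolding _+ᴱ_

  trace : ∀ u a b → emb u *ᴱ ⟨ a , b ⟩ +ᴱ emb (inv u) *ᴱ conj ⟨ a , b ⟩ ≡ int (tr u a b)
  trace c0 a b = cong₂ ⟨_,_⟩ (g a b) (f a b)
    where
    g : ∀ a b → (+ 1 ℤ.* a ℤ.- + 0 ℤ.* b) ℤ.+ (+ 1 ℤ.* (a ℤ.- b) ℤ.- + 0 ℤ.* (ℤ.- b)) ≡ + 2 ℤ.* a ℤ.- b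
    g = solve-∀
    f : ∀ a b → (+ 1 ℤ.* b ℤ.+ + 0 ℤ.* a ℤ.- + 0 ℤ.* b) ℤ.+ (+ 1 ℤ.* (ℤ.- b) ℤ.+ + 0 ℤ.* (a ℤ.- b) ℤ.- + 0 ℤ.* (ℤ.- b)) ≡ + 0
    f = solve-∀
  trace c1 a b = cong₂ ⟨_,_⟩ (g a b) (f a b)
    where
    g : ∀ a b → (+ 0 ℤ.* a ℤ.- + 1 ℤ.* b) ℤ.+ (-[1+ 0 ] ℤ.* (a ℤ.- b) ℤ.- -[1+ 0 ] ℤ.* (ℤ.- b)) ≡ ℤ.- a ℤ.- b
    g = solve-∀
    f : ∀ a b → (+ 0 ℤ.* b ℤ.+ + 1 ℤ.* a ℤ.- + 1 ℤ.* b) ℤ.+ (-[1+ 0 ] ℤ.* (ℤ.- b) ℤ.+ -[1+ 0 ] ℤ.* (a ℤ.- b) ℤ.- -[1+ 0 ] ℤ.* (ℤ.- b)) ≡ + 0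
    f = solve-∀
  trace c2 a b = cong₂ ⟨_,_⟩ (g a b) (f a b)
    where
    g : ∀ a b → (-[1+ 0 ] ℤ.* a ℤ.- -[1+ 0 ] ℤ.* b) ℤ.+ (+ 0 ℤ.* (a ℤ.- b) ℤ.- + 1 ℤ.* (ℤ.- b)) ≡ + 2 ℤ.* b ℤ.- a
    g = solve-∀
    f : ∀ a b → (-[1+ 0 ] ℤ.* b ℤ.+ -[1+ 0 ] ℤ.* a ℤ.- -[1+ 0 ] ℤ.* b) ℤ.+ (+ 0 ℤ.* (ℤ.- b) ℤ.+ + 1 ℤ.* (a ℤ.- b) ℤ.- + 1 ℤ.* (ℤ.- b)) ≡ + 0
    f = solve-∀

  α-ᾱ : ∀ a b → (⟨ a , b ⟩ +ᴱ -ᴱ conj ⟨ a , b ⟩) *ᴱ (⟨ a , b ⟩ +ᴱ -ᴱ conj ⟨ a , b ⟩) ≡ int (ℤ.- (+ 3 ℤ.* (b ℤ.* b)))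
  α-ᾱ a b = cong₂ ⟨_,_⟩ (f a b) (g a b)
    where
    f : ∀ a b → (a ℤ.+ ℤ.- (a ℤ.- b)) ℤ.* (a ℤ.+ ℤ.- (a ℤ.- b)) ℤ.- (b ℤ.+ ℤ.- (ℤ.- b)) ℤ.* (b ℤ.+ ℤ.- (ℤ.- b)) ≡ ℤ.- (+ 3 ℤ.* (b ℤ.* b))
    f = solve-∀
    g : ∀ a b → (a ℤ.+ ℤ.- (a ℤ.- b)) ℤ.* (b ℤ.+ ℤ.- (ℤ.- b)) ℤ.+ (b ℤ.+ ℤ.- (ℤ.- b)) ℤ.* (a ℤ.+ ℤ.- (a ℤ.- b)) ℤ.- (b ℤ.+ ℤ.- (ℤ.- b)) ℤ.* (b ℤ.+ ℤ.- (ℤ.- b)) ≡ + 0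
    g = solve-∀

  extractˡ : ∀ U V X Y y s → (V *ᴱ U) *ᴱ (y *ᴱ y *ᴱ (s *ᴱ (X +ᴱ Y))) ≡ V *ᴱ (s *ᴱ ((U *ᴱ y) *ᴱ y) *ᴱ (X +ᴱ Y))
  extractˡ = ring-∀ 𝔼-acr

  extractʳ : ∀ U V X Y y → V *ᴱ (X *ᴱ ((U *ᴱ y) *ᴱ (U *ᴱ y)) +ᴱ Y *ᴱ (y *ᴱ y)) ≡ y *ᴱ y *ᴱ ((V *ᴱ U) *ᴱ (U *ᴱ X) +ᴱ V *ᴱ Y)
  extractʳ = ring-∀ 𝔼-acr

  raise : ∀ s X Y P → s *ᴱ ((X *ᴱ Y) *ᴱ P) *ᴱ (Y +ᴱ X) ≡ (X *ᴱ Y) *ᴱ (s *ᴱ P *ᴱ (X +ᴱ Y))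
  raise = ring-∀ 𝔼-acr

  spread : ∀ X Y x y → (X *ᴱ Y) *ᴱ (X *ᴱ (x *ᴱ x) +ᴱ Y *ᴱ (y *ᴱ y)) ≡ Y *ᴱ ((X *ᴱ x) *ᴱ (X *ᴱ x)) +ᴱ X *ᴱ ((Y *ᴱ y) *ᴱ (Y *ᴱ y))
  spread = ring-∀ 𝔼-acr

-- The last hypothesis says -27αᾱ ≡ (α - ᾱ)², so `morgan-voyce` holds with X = α and Y = ᾱ. The
-- symbol then turns the powers of X into powers of Y, which cancel and leave a congruence between
-- traces.
module Evaluation {p n : ℕ} (pr : Prime p) (p≡ : p ≡ 1 ℕ.+ 3 ℕ.* n ⊎ p ≡ 2 ℕ.+ 3 ℕ.* n) (a b : ℤ) (u : C₃)
                  (symb : Symbol p ⟨ a , b ⟩ u) (p∤norm : ¬ (+ p ∣ norm ⟨ a , b ⟩))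
                  (p∣ : + p ∣ (z ℤ.* norm ⟨ a , b ⟩ ℤ.- ℤ.- (+ 3 ℤ.* (b ℤ.* b)))) where
  open RingTheory (E/ (+ p))

  private
    X Y U V s : 𝔼
    X = ⟨ a , b ⟩
    Y = conj X
    U = emb u
    V = emb (inv u)
    s = int (small n)

    int-cong : ∀ {i j} → + p ∣ (i ℤ.- j) → int i ≈ int j
    int-cong d = ∣∣⇒≈ d (divides (+ 0) refl)

    rel : int z * (X * Y) ≈ (X + - Y) * (X + - Y)
    rel = ≈trans (≡⇒≈ (trans (cong (int z *ᴱ_) (*-conj X)) (sym (int-mul z (norm X))))) (≈trans (int-cong p∣) (≡⇒≈ (sym (α-ᾱ a b))))

    VU : V *ᴱ U ≡ 1ᴱ
    VU = trans (*ᴱ-comm V U) (trans (sym (emb-⊙ u (inv u))) (cong emb (⊙-inv u)))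

    norm-Y^ : ∀ m → ¬ (+ p ∣ norm (Y ^ m * Y ^ m))
    norm-Y^ m d = prime∤* pr (norm-^∤ pr nY m) (norm-^∤ pr nY m) (∣-by-eq (norm-* (Y ^ m) (Y ^ m)) d)
      where
      nY : ¬ (+ p ∣ norm Y)
      nY d = p∤norm (∣-by-eq (norm-conj X) d)

    -- The hypothesis is UsY^(2m)(X′ + Y′) ≈ Y^(2m)(U²X′ + Y′); multiplying by V = U⁻¹ and
    -- cancelling Y^(2m) gives the conclusion.
    extract : ∀ U V X′ Y′ m → V *ᴱ U ≡ 1ᴱ →
      s * ((U * Y ^ m) * Y ^ m) * (X′ + Y′) ≈ X′ * ((U * Y ^ m) * (U * Y ^ m)) + Y′ * (Y ^ m * Y ^ m) →
      s * (X′ + Y′) ≈ U * X′ + V * Y′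
    extract U V X′ Y′ m VU h = 𝔼-cancel pr (Y ^ m * Y ^ m) (norm-Y^ m) (begin
      (y * y) * (s * (X′ + Y′))
        ≈⟨ *-identityˡ _ ⟨
      1# * ((y * y) * (s * (X′ + Y′)))
        ≡⟨ cong (_*ᴱ ((y *ᴱ y) *ᴱ (s *ᴱ (X′ +ᴱ Y′)))) (sym VU) ⟩
      (V * U) * ((y * y) * (s * (X′ + Y′)))
        ≡⟨ extractˡ U V X′ Y′ y s ⟩
      V * (s * ((U * y) * y) * (X′ + Y′))
        ≈⟨ *-congˡ {V} h ⟩
      V * (X′ * ((U * y) * (U * y)) + Y′ * (y * y))
        ≡⟨ extractʳ U V X′ Y′ y ⟩
      (y * y) * ((V * U) * (U * X′) + V * Y′)
        ≡⟨ cong (λ t → (y *ᴱ y) *ᴱ (t *ᴱ (U *ᴱ X′) +ᴱ V *ᴱ Y′)) VU ⟩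
      (y * y) * (1# * (U * X′) + V * Y′)
        ≈⟨ *-congˡ {y * y} (+-congʳ (*-identityˡ _)) ⟩
      (y * y) * (U * X′ + V * Y′) ∎)
      where
      y : 𝔼
      y = Y ^ m

    case-1 : p ≡ 1 ℕ.+ 3 ℕ.* n → s * (X + Y) ≈ U * X + V * Y
    case-1 e = extract U V X Y n VU (begin
      s * ((U * Y ^ n) * Y ^ n) * (X + Y)
        ≈⟨ *-congʳ (*-congˡ {s} (≈trans (^-distrib-* X Y n) (*-congʳ f))) ⟨
      s * (X * Y) ^ n * (X + Y)
        ≈⟨ morgan-voyce X Y rel n ⟩
      X * (X ^ n * X ^ n) + Y * (Y ^ n * Y ^ n)
        ≈⟨ +-congʳ (*-congˡ {X} (*-cong f f)) ⟩
      X * ((U * Y ^ n) * (U * Y ^ n)) + Y * (Y ^ n * Y ^ n) ∎)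
      where
      f : X ^ n ≈ U * Y ^ n
      f = case₁ symb n e

    -- The symbol now governs the exponent n + 1 instead of n. Multiplying `morgan-voyce` by XY
    -- raises the powers accordingly, at the price of exchanging the roles of X and Y and of U and
    -- V.
    case-2 : p ≡ 2 ℕ.+ 3 ℕ.* n → s * (X + Y) ≈ U * X + V * Y
    case-2 e = ≈trans (*-congˡ {s} (+-comm X Y)) (≈trans (extract V U Y X (suc n) (trans (*ᴱ-comm U V) VU) (begin
      s * ((V * Y ^ suc n) * Y ^ suc n) * (Y + X)
        ≈⟨ *-congʳ (*-congˡ {s} (≈trans (^-distrib-* X Y (suc n)) (*-congʳ f))) ⟨
      s * ((X * Y) * (X * Y) ^ n) * (Y + X)
        ≡⟨ raise s X Y ((X * Y) ^ n) ⟩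
      (X * Y) * (s * (X * Y) ^ n * (X + Y))
        ≈⟨ *-congˡ {X * Y} (morgan-voyce X Y rel n) ⟩
      (X * Y) * (X * (X ^ n * X ^ n) + Y * (Y ^ n * Y ^ n))
        ≡⟨ spread X Y (X ^ n) (Y ^ n) ⟩
      Y * (X ^ suc n * X ^ suc n) + X * (Y ^ suc n * Y ^ suc n)
        ≈⟨ +-congʳ (*-congˡ {Y} (*-cong f f)) ⟩
      Y * ((V * Y ^ suc n) * (V * Y ^ suc n)) + X * (Y ^ suc n * Y ^ suc n) ∎)) (+-comm (V * Y) (U * X)))
      where
      f : X ^ suc n ≈ V * Y ^ suc n
      f = case₂ symb n e

  value : + p ∣ (+ sumBinom3 n ℤ.* tr c0 a b ℤ.- tr u a b)
  value = proj₁ (≈⇒∣∣ (begin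
    int (+ sumBinom3 n ℤ.* tr c0 a b)             ≡⟨ int-mul (+ sumBinom3 n) (tr c0 a b) ⟩
    int (+ sumBinom3 n) * int (tr c0 a b)         ≈⟨ *-cong (int-cong (BinomialSum.sum≡small {n = n} pr p≡)) (≡⇒≈ sum≡) ⟩
    s * (X + Y)                                   ≈⟨ [ case-1 , case-2 ]′ p≡ ⟩
    U * X + V * Y                                 ≡⟨ trace u a b ⟩
    int (tr u a b)                                ∎))
    where
    sum≡ : int (tr c0 a b) ≡ X +ᴱ Y
    sum≡ = trans (sym (trace c0 a b)) (cong₂ _+ᴱ_ (*ᴱ-identityˡ X) (*ᴱ-identityˡ Y))

-- For a form of discriminant -207 the parameter f is (9 - B)/2. It makes 2a + 9y equal to 2ex + By,
-- which is what the norm identity amounts to.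
module Form {p : ℕ} (pr : Prime p) (p≢3 : p ≢ 3) (p≢23 : p ≢ 23) (e B D f x y : ℤ)
            (p≡form : + p ≡ qf e B D x y)
            (norm≡ : norm ⟨ e ℤ.* x ℤ.- f ℤ.* y , + 9 ℤ.* (ℤ.- y) ⟩ ≡ e ℤ.* + p ℤ.+ + 3 ℤ.* (ℤ.- y) ℤ.* (+ 3 ℤ.* (ℤ.- y)))
            (p∤e : ¬ (+ p ∣ e)) (3∤e : ¬ (+ 3 ∣ e)) where
  open import Data.Integer using (_+_; _*_; _-_; -_)

  a c : ℤ
  a = e * x - f * y
  c = - y

  private
    3∤a : ¬ (+ 3 ∣ a)
    3∤a d = prime∤* prime-3 3∤e (λ h → p≢3 (sym (prime∣prime prime-3 pr h)))
      (∣-by-eq (g (e * + p) c) (ℤ∣.∣m∣n⇒∣m-n (∣-by-eq norm≡ 3∣norm) (ℤ∣.∣m⇒∣m*n (c * (+ 3 * c)) ℤ∣.∣-refl)))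
      where
      g : ∀ q c → q + + 3 * c * (+ 3 * c) - + 3 * (c * (+ 3 * c)) ≡ q
      g = solve-∀
      h : ∀ a c → a * (a - + 9 * c) + + 3 * (+ 27 * (c * c)) ≡ a * a - a * (+ 9 * c) + + 9 * c * (+ 9 * c)
      h = solve-∀
      3∣norm : + 3 ∣ norm ⟨ a , + 9 * c ⟩
      3∣norm = ∣-by-eq (h a c) (ℤ∣.∣m∣n⇒∣m+n (ℤ∣.∣m⇒∣m*n (a - + 9 * c) d) (ℤ∣.∣m⇒∣m*n (+ 27 * (c * c)) ℤ∣.∣-refl))

    -- The case r = 3 is excluded by 3 ∤ a. Otherwise r divides y and ex: a factor of e would make r
    -- = p divide e, and a common factor of x and y would have its square dividing p.
    prim : Primitive ⟨ a , + 9 * c ⟩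
    prim {r} rr r∣a r∣b = [ (λ d → 3∤a (subst (λ q → + q ∣ a) (q∣9⇒q≡3 rr d) r∣a)) , (λ d → r∣y⇒⊥ (∣-by-eq (ℤₚ.neg-involutive y) (ℤ∣.∣m⇒∣-m d))) ]′
        (prime∣* rr (+ 9) c r∣b)
      where
      g₁ : ∀ e x f y → e * x - f * y + f * y ≡ e * x
      g₁ = solve-∀
      g₂ : ∀ e B D x y → e * (x * x) + (B * x + D * y) * y ≡ e * x * x + B * x * y + D * y * y
      g₂ = solve-∀
      g₃ : ∀ e B D x y r → e * (x * r) * (x * r) + B * (x * r) * (y * r) + D * (y * r) * (y * r)
         ≡ (e * x * x + B * x * y + D * y * y) * r * r
      g₃ = solve-∀
      instance
        _ : ℤ.NonZero (+ p)
        _ = prime⇒nonZero pr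
      r∣y⇒⊥ : + r ∣ y → ⊥
      r∣y⇒⊥ d = [ both , (λ h → common h d) ]′ (prime∣* rr e x (∣-by-eq (g₁ e x f y) (ℤ∣.∣m∣n⇒∣m+n r∣a (ℤ∣.∣n⇒∣m*n f d))))
        where
        both : + r ∣ e → ⊥
        both h = p∤e (subst (λ q → + q ∣ e) (prime∣prime rr pr (∣-by-eq (trans (g₂ e B D x y) (sym p≡form))
          (ℤ∣.∣m∣n⇒∣m+n (ℤ∣.∣m⇒∣m*n (x * x) h) (ℤ∣.∣n⇒∣m*n (B * x + D * y) d)))) h)
        common : + r ∣ x → + r ∣ y → ⊥
        common (divides x′ ex) (divides y′ ey) = prime∤1 pr (divides w′ (ℤₚ.*-cancelʳ-≡ (+ 1) (w′ * + p) (+ p)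
            (trans (ℤₚ.*-identityˡ (+ p)) (trans square (cong (λ q → w′ * + q * + q) r≡p)))))
          where
          w′ : ℤ
          w′ = qf e B D x′ y′
          square : + p ≡ w′ * + r * + r
          square = trans p≡form (trans (cong₂ (qf e B D) ex ey) (g₃ e B D x′ y′ (+ r)))
          r≡p : r ≡ p
          r≡p = prime∣prime rr pr (divides (w′ * + r) square)

  open Supplement a c 3∤a prim using (b; b′; k; α; A; χ-b′; b′⊥k)
  open Reciprocity A public

  private
    ep⊥k : e * + p ⊥ᴾ k
    ep⊥k rr d h = b′⊥k rr (∣square rr (∣-by-eq (g (e * + p) (b′ * b′)) (ℤ∣.∣m∣n⇒∣m-n (∣-by-eq norm≡ h) d))) h
      where
      g : ∀ m n → m + n - m ≡ n
      g = solve-∀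

  e⊥k : e ⊥ᴾ k
  e⊥k rr d = ep⊥k rr (ℤ∣.∣m⇒∣m*n (+ p) d)

  p⊥k : + p ⊥ᴾ k
  p⊥k rr d = ep⊥k rr (ℤ∣.∣n⇒∣m*n e d)

  p∤k : ¬ (+ p ∣ k)
  p∤k h = p⊥k pr ℤ∣.∣-refl h

  χp≡ : χ (+ p) ≡ inv (χ e)
  χp≡ = ⊙≡c0⇒inv (χ e) (χ (+ p)) (trans (sym (χ-* {e} {+ p} e⊥k p⊥k)) (trans
      (χ-periodic {e * + p} { - (b′ * b′)} (∣-by-eq (trans norm≡ (g (e * + p) (b′ * b′))) ℤ∣.∣-refl))
      (trans (χ-neg {b′ * b′} square⊥) (trans (χ-* {b′} {b′} b′⊥k b′⊥k) (cong₂ _⊙_ χ-b′ χ-b′)))))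
    where
    g : ∀ m n → m + n ≡ m - - n
    g = solve-∀
    square⊥ : b′ * b′ ⊥ᴾ k
    square⊥ rr d = b′⊥k rr (∣square rr d)

  private
    n : ℕ
    n = p ℕ./ 3

    p≡3n : p ≡ 1 ℕ.+ 3 ℕ.* n ⊎ p ≡ 2 ℕ.+ 3 ℕ.* n
    p≡3n = go (p ℕ.% 3) (ℕ/.m%n<n p 3) (trans (ℕ/.m≡m%n+[m/n]*n p 3) (cong (p ℕ.% 3 ℕ.+_) (ℕₚ.*-comm n 3)))
      where
      go : ∀ r → r ℕ.< 3 → p ≡ r ℕ.+ 3 ℕ.* n → p ≡ 1 ℕ.+ 3 ℕ.* n ⊎ p ≡ 2 ℕ.+ 3 ℕ.* n
      go 0 _ h = contradiction (sym (prime∣prime prime-3 pr (ℤ∣.∣ᵤ⇒∣ (ℕ∣.divides n (trans h (ℕₚ.*-comm 3 n)))))) p≢3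
      go 1 _ h = inj₁ h
      go 2 _ h = inj₂ h
      go (suc (suc (suc _))) (ℕ.s≤s (ℕ.s≤s (ℕ.s≤s ())))

    -- Modulo p the norm k is (b/3)², so -27k ≡ -3b² = (α - ᾱ)². The coefficient 9 in b = -9y is
    -- made for this.
    p∣rel : + p ∣ (z * k - - (+ 3 * (b * b)))
    p∣rel = ∣-by-eq (trans (g e (+ p) c) (cong (λ q → z * q - - (+ 3 * (b * b))) (sym norm≡))) (ℤ∣.∣n⇒∣m*n (z * e) ℤ∣.∣-refl)
      where
      g : ∀ e p c → -[1+ 26 ] * e * p ≡ -[1+ 26 ] * (e * p + + 3 * c * (+ 3 * c)) - - (+ 3 * (+ 9 * c * (+ 9 * c)))
      g = solve-∀

  -- The square of the trace 2a - b is 4k - 243c² = 4ep - 207c², and 207c² = 23b′² with neither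
  -- factor divisible by p.
  p∤tr : ¬ (+ p ∣ tr c0 a b)
  p∤tr d = prime∤* pr p∤23 (prime∤* pr p∤b′ p∤b′)
      (∣-by-eq (trans (cong (λ q → + 4 * (e * + p) - q) (trans (g a c) (cong (λ q → + 4 * q - + 243 * (c * c)) norm≡))) (h (e * + p) c))
        (ℤ∣.∣m∣n⇒∣m-n (ℤ∣.∣n⇒∣m*n (+ 4) (ℤ∣.∣n⇒∣m*n e ℤ∣.∣-refl)) (ℤ∣.∣m⇒∣m*n (tr c0 a b) d)))
    where
    g : ∀ a c → (+ 2 * a - + 9 * c) * (+ 2 * a - + 9 * c)
      ≡ + 4 * (a * a - a * (+ 9 * c) + + 9 * c * (+ 9 * c)) - + 243 * (c * c)
    g = solve-∀
    h : ∀ m c → + 4 * m - (+ 4 * (m + + 3 * c * (+ 3 * c)) - + 243 * (c * c)) ≡ + 23 * (+ 3 * c * (+ 3 * c))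
    h = solve-∀
    p∤23 : ¬ (+ p ∣ + 23)
    p∤23 q = p≢23 (prime∣prime pr (from-yes (prime? 23)) q)
    p∤b′ : ¬ (+ p ∣ b′)
    p∤b′ q = p∤k (∣-by-eq (sym norm≡) (ℤ∣.∣m∣n⇒∣m+n (ℤ∣.∣n⇒∣m*n e ℤ∣.∣-refl) (ℤ∣.∣m⇒∣m*n b′ q)))

  S : ℤ
  S = + sumBinom3 (floor3 p)

  value : ∀ {u} → χ e ≡ u → + p ∣ (S * tr c0 a b - tr (inv u) a b)
  value {u} h = subst (λ v → + p ∣ (S * tr c0 a b - tr v a b)) (trans χp≡ (cong inv h))
    (Evaluation.value {n = n} pr p≡3n a b (χ (+ p)) (symbol pr p≢3 p∤k) p∤k p∣rel)

  tr-cancel : ∀ {q} → + p ∣ (tr c0 a b * q) → + p ∣ q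
  tr-cancel {q} d = [ (λ h → contradiction h p∤tr) , (λ h → h) ]′ (prime∣* pr (tr c0 a b) q d)

-- The four forms and the final congruences

opaque
  unfolding _+ᴱ_

  -- For e = 13, λ = (13x - 4y) - 9yω reduces modulo 13 to y(-4 - 9ω); the exponent is (13 - 1)/3.
  13-power : let β = ⟨ -[1+ 3 ] , -[1+ 8 ] ⟩ in β ^ᴱ 4 ≈ emb c1 *ᴱ conj β ^ᴱ 4 [ + 13 ]
  13-power = let β = ⟨ -[1+ 3 ] , -[1+ 8 ] ⟩ ; l = β ^ᴱ 4 ; r = emb c1 *ᴱ conj β ^ᴱ 4 in
    ∣∣⇒≈ {x = l} {r} (from-yes (+ 13 ∣? (re l ℤ.- re r))) (from-yes (+ 13 ∣? (im l ℤ.- im r)))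

  -- For e = 29, λ reduces modulo 29 to y(-2 - 9ω). As 29 ≡ 2 (mod 3), the exponent is (29 + 1)/3
  -- and ω appears as the inverse of the symbol ω².
  29-power : let β = ⟨ -[1+ 1 ] , -[1+ 8 ] ⟩ in β ^ᴱ 10 ≈ emb c1 *ᴱ conj β ^ᴱ 10 [ + 29 ]
  29-power = let β = ⟨ -[1+ 1 ] , -[1+ 8 ] ⟩ ; l = β ^ᴱ 10 ; r = emb c1 *ᴱ conj β ^ᴱ 10 in
    ∣∣⇒≈ {x = l} {r} (from-yes (+ 29 ∣? (re l ℤ.- re r))) (from-yes (+ 29 ∣? (im l ℤ.- im r)))

13-symbol : Symbol 13 ⟨ -[1+ 3 ] , -[1+ 8 ] ⟩ c1
13-symbol = record
  { case₁ = λ m e → subst (λ m → ⟨ -[1+ 3 ] , -[1+ 8 ] ⟩ ^ᴱ m ≈ emb c1 *ᴱ conj ⟨ -[1+ 3 ] , -[1+ 8 ] ⟩ ^ᴱ m [ + 13 ])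
      (ℕₚ.*-cancelˡ-≡ 4 m 3 (ℕₚ.suc-injective e)) 13-power
  ; case₂ = λ m e → contradiction (ℕ∣.divides m (trans (ℕₚ.suc-injective (ℕₚ.suc-injective e)) (ℕₚ.*-comm 3 m))) (from-no (3 ℕ∣.∣? 11)) }

29-symbol : Symbol 29 ⟨ -[1+ 1 ] , -[1+ 8 ] ⟩ c2
29-symbol = record
  { case₁ = λ m e → contradiction (ℕ∣.divides m (trans (ℕₚ.suc-injective e) (ℕₚ.*-comm 3 m))) (from-no (3 ℕ∣.∣? 28))
  ; case₂ = λ m e → subst (λ m → ⟨ -[1+ 1 ] , -[1+ 8 ] ⟩ ^ᴱ suc m ≈ emb c1 *ᴱ conj ⟨ -[1+ 1 ] , -[1+ 8 ] ⟩ ^ᴱ suc m [ + 29 ])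
      (ℕₚ.*-cancelˡ-≡ 9 m 3 (ℕₚ.suc-injective (ℕₚ.suc-injective e))) 29-power }

module _ {p : ℕ} (pr : Prime p) (p>3 : p > 3) (p≢23 : p ≢ 23) (x y : ℤ) where
  open import Data.Integer using (_+_; _*_; _-_; -_)

  private
    p≢3 : p ≢ 3
    p≢3 refl = ℕₚ.<-irrefl refl p>3

    prime-13 : Prime 13
    prime-13 = from-yes (prime? 13)
    prime-29 : Prime 29
    prime-29 = from-yes (prime? 29)

    p∤8 : ¬ (+ p ∣ + 8)
    p∤8 = prime∤* pr {+ 2} {+ 4} p∤2 (prime∤* pr {+ 2} {+ 2} p∤2 p∤2)
      where
      p∤2 : ¬ (+ p ∣ + 2)
      p∤2 d with refl ← prime∣prime pr prime[2] d = contradiction p>3 λ { (ℕ.s≤s (ℕ.s≤s ())) }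

  value-1 : + p ≡ qf (+ 1) (+ 1) (+ 52) x y → + p ∣ (+ sumBinom3 (floor3 p) - + 1)
  value-1 e = tr-cancel (∣-by-eq (g S (tr c0 a (+ 9 * c))) (value χ-1))
    where
    nrm : ∀ x y → let a = + 1 * x - + 4 * y ; b = + 9 * (- y) in
      a * a - a * b + b * b ≡ + 1 * (+ 1 * x * x + + 1 * x * y + + 52 * y * y) + + 3 * (- y) * (+ 3 * (- y))
    nrm = solve-∀
    open Form pr p≢3 p≢23 (+ 1) (+ 1) (+ 52) (+ 4) x y e
      (trans (nrm x y) (cong (λ q → + 1 * q + + 3 * (- y) * (+ 3 * (- y))) (sym e))) (prime∤1 pr) (prime∤1 prime-3)
    g : ∀ s t → s * t - t ≡ t * (s - + 1)
    g = solve-∀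

  -- The leading coefficient 8 = 2³ is a cube, so its symbol is trivial.
  value-8 : + p ≡ qf (+ 8) (+ 7) (+ 8) x y → + p ∣ (+ sumBinom3 (floor3 p) - + 1)
  value-8 e = tr-cancel (∣-by-eq (g S (tr c0 a (+ 9 * c))) (value χ8))
    where
    nrm : ∀ x y → let a = + 8 * x - + 1 * y ; b = + 9 * (- y) in
      a * a - a * b + b * b ≡ + 8 * (+ 8 * x * x + + 7 * x * y + + 8 * y * y) + + 3 * (- y) * (+ 3 * (- y))
    nrm = solve-∀
    open Form pr p≢3 p≢23 (+ 8) (+ 7) (+ 8) (+ 1) x y e
      (trans (nrm x y) (cong (λ q → + 8 * q + + 3 * (- y) * (+ 3 * (- y))) (sym e))) p∤8 (from-no (+ 3 ∣? + 8))
    g : ∀ s t → s * t - t ≡ t * (s - + 1)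
    g = solve-∀
    cube : ∀ v → v ⊙ (v ⊙ v) ≡ c0
    cube c0 = refl
    cube c1 = refl
    cube c2 = refl
    2⊥ : + 2 ⊥ᴾ _
    2⊥ r d = e⊥k r (ℤ∣.∣-trans d (divides (+ 4) refl))
    4⊥ : + 4 ⊥ᴾ _
    4⊥ r d = e⊥k r (ℤ∣.∣-trans d (divides (+ 2) refl))
    χ8 : χ (+ 8) ≡ c0
    χ8 = trans (χ-* {+ 2} {+ 4} 2⊥ 4⊥) (trans (cong (χ (+ 2) ⊙_) (χ-* {+ 2} {+ 2} 2⊥ 2⊥)) (cube (χ (+ 2))))

  -- 13 has symbol ω, hence p has symbol ω². The identity 23y tr(ω²λ) + 78p = t(39x - 10y), with t =
  -- tr(λ), then lets t be cancelled and yields the stated numerator.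
  value-13 : + p ≡ qf (+ 13) (+ 1) (+ 4) x y → p ≢ 13 →
             + p ∣ (+ 23 * y * + sumBinom3 (floor3 p) - (+ 39 * x - + 10 * y))
  value-13 e p≢13 = tr-cancel (∣-by-eq (trans (cong (λ q → + 23 * y * (S * t - tr c2 a (+ 9 * c)) - + 78 * q) e) (g S x y))
      (ℤ∣.∣m∣n⇒∣m-n (ℤ∣.∣n⇒∣m*n (+ 23 * y) (value χ13)) (ℤ∣.∣n⇒∣m*n (+ 78) ℤ∣.∣-refl)))
    where
    nrm : ∀ x y → let a = + 13 * x - + 4 * y ; b = + 9 * (- y) in
      a * a - a * b + b * b ≡ + 13 * (+ 13 * x * x + + 1 * x * y + + 4 * y * y) + + 3 * (- y) * (+ 3 * (- y))
    nrm = solve-∀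
    open Form pr p≢3 p≢23 (+ 13) (+ 1) (+ 4) (+ 4) x y e
      (trans (nrm x y) (cong (λ q → + 13 * q + + 3 * (- y) * (+ 3 * (- y))) (sym e)))
      (λ d → p≢13 (prime∣prime pr prime-13 d)) (from-no (+ 3 ∣? + 13))
    t : ℤ
    t = tr c0 a (+ 9 * c)
    g : ∀ s x y → let a = + 13 * x - + 4 * y ; b = + 9 * (- y) in
      + 23 * y * (s * (+ 2 * a - b) - (+ 2 * b - a)) - + 78 * (+ 13 * x * x + + 1 * x * y + + 4 * y * y)
      ≡ (+ 2 * a - b) * (+ 23 * y * s - (+ 39 * x - + 10 * y))
    g = solve-∀
    13∤k : ¬ (+ 13 ∣ _)
    13∤k = e⊥k prime-13 ℤ∣.∣-refl
    χ13 : χ (+ 13) ≡ c1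
    χ13 = symbol-unique prime-13 (λ ()) (symbol prime-13 (λ ()) 13∤k) 13-symbol (+ 1) y (prime∤1 prime-13) 13∤k
      (ratio-by-parts (+ 1) y _ ⟨ -[1+ 3 ] , -[1+ 8 ] ⟩ (divides x (f₁ x y)) (0∣ (f₂ y)))
      where
      f₁ : ∀ x y → + 1 * (+ 13 * x - + 4 * y) - y * -[1+ 3 ] ≡ x * + 13
      f₁ = solve-∀
      f₂ : ∀ y → + 1 * (+ 9 * (- y)) - y * -[1+ 8 ] ≡ + 0
      f₂ = solve-∀

  -- 29 has symbol ω², hence p has symbol ω, and here 23y tr(ωλ) - 174p = -t(87x + 19y) with t =
  -- tr(λ).
  value-29 : + p ≡ qf (+ 29) (+ 5) (+ 2) x y → p ≢ 29 →
             + p ∣ (+ 23 * y * + sumBinom3 (floor3 p) - - (+ 87 * x + + 19 * y))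
  value-29 e p≢29 = tr-cancel (∣-by-eq (trans (cong (λ q → + 23 * y * (S * t - tr c1 a (+ 9 * c)) + + 174 * q) e) (g S x y))
      (ℤ∣.∣m∣n⇒∣m+n (ℤ∣.∣n⇒∣m*n (+ 23 * y) (value χ29)) (ℤ∣.∣n⇒∣m*n (+ 174) ℤ∣.∣-refl)))
    where
    nrm : ∀ x y → let a = + 29 * x - + 2 * y ; b = + 9 * (- y) in
      a * a - a * b + b * b ≡ + 29 * (+ 29 * x * x + + 5 * x * y + + 2 * y * y) + + 3 * (- y) * (+ 3 * (- y))
    nrm = solve-∀
    open Form pr p≢3 p≢23 (+ 29) (+ 5) (+ 2) (+ 2) x y e
      (trans (nrm x y) (cong (λ q → + 29 * q + + 3 * (- y) * (+ 3 * (- y))) (sym e)))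
      (λ d → p≢29 (prime∣prime pr prime-29 d)) (from-no (+ 3 ∣? + 29))
    t : ℤ
    t = tr c0 a (+ 9 * c)
    g : ∀ s x y → let a = + 29 * x - + 2 * y ; b = + 9 * (- y) in
      + 23 * y * (s * (+ 2 * a - b) - (- a - b)) + + 174 * (+ 29 * x * x + + 5 * x * y + + 2 * y * y)
      ≡ (+ 2 * a - b) * (+ 23 * y * s - - (+ 87 * x + + 19 * y))
    g = solve-∀
    29∤k : ¬ (+ 29 ∣ _)
    29∤k = e⊥k prime-29 ℤ∣.∣-refl
    χ29 : χ (+ 29) ≡ c2
    χ29 = symbol-unique prime-29 (λ ()) (symbol prime-29 (λ ()) 29∤k) 29-symbol (+ 1) y (prime∤1 prime-29) 29∤k
      (ratio-by-parts (+ 1) y _ ⟨ -[1+ 1 ] , -[1+ 8 ] ⟩ (divides x (f₁ x y)) (0∣ (f₂ y)))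
      where
      f₁ : ∀ x y → + 1 * (+ 29 * x - + 2 * y) - y * -[1+ 1 ] ≡ x * + 29
      f₁ = solve-∀
      f₂ : ∀ y → + 1 * (+ 9 * (- y)) - y * -[1+ 8 ] ≡ + 0
      f₂ = solve-∀

open import Data.Integer using (_-_; -_)

theorem3p8 : (p : ℕ) → Prime p → p > 3 → Legendre23IsOne p →
    let S = + sumBinom3 (floor3 p) in
    ((x y : ℤ) → (+ p ≡ qf (+ 1) (+ 1) (+ 52) x y ⊎ + p ≡ qf (+ 8) (+ 7) (+ 8) x y) →
    S ≡ + 1 [mod + p ])
    × ((x y : ℤ) → + p ≡ qf (+ 13) (+ 1) (+ 4) x y → p ≢ 13 →
    + 23 ℤ.* y ℤ.* S ≡ + 39 ℤ.* x - + 10 ℤ.* y [mod + p ])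
    × ((x y : ℤ) → + p ≡ qf (+ 29) (+ 5) (+ 2) x y → p ≢ 29 →
    + 23 ℤ.* y ℤ.* S ≡ - (+ 87 ℤ.* x ℤ.+ + 19 ℤ.* y) [mod + p ])
theorem3p8 p pr p>3 (p%23≢0 , _) =
    (λ x y → [ (λ e → ℤ∣.∣⇒∣ᵤ (value-1 pr p>3 p≢23 x y e)) , (λ e → ℤ∣.∣⇒∣ᵤ (value-8 pr p>3 p≢23 x y e)) ]′)
  , (λ x y e p≢13 → ℤ∣.∣⇒∣ᵤ (value-13 pr p>3 p≢23 x y e p≢13))
  , (λ x y e p≢29 → ℤ∣.∣⇒∣ᵤ (value-29 pr p>3 p≢23 x y e p≢29))
  where
  p≢23 : p ≢ 23
  p≢23 refl = p%23≢0 refl
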